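{- Let $n\ge 3$ and let $S=\{1,\dots,i,j_1,\dots,j_l\}\subseteq\{1,\dots,n-2\}$ with $i<j_1<\dots<j_l$ and $j_1-i>1$. If $i\le l$, then $b_S(n)>0$.
   Context: $\Pi_n$ is the lattice of set partitions of $\{1,\dots,n\}$ ordered by refinement, with minimum $\hat 0$ (all singletons) and maximum $\hat 1$ (one block); the rank of a partition with $k$ blocks is $n-k$, so the proper part has ranks $1,\dots,n-2$. The symmetric group $S_n$ acts on $\Pi_n$ by permuting $\{1,\dots,n\}$, and hence permutes chains. For $T\subseteq\{1,\dots,n-2\}$ let $\alpha_T$ be the permutation representation of $S_n$ (over $\mathbb{C}$) on the set of chains $\hat 0<x_1<\dots<x_k<\hat 1$ whose set of ranks is exactly $T$. For $S\subseteq\{1,\dots,n-2\}$ put $\beta_S=\sum_{T\subseteq S}(-1)^{|S-T|}\alpha_T$ (equivalently, the $S_n$-representation on the top reduced homology of the order complex of the rank-selected subposet $\Pi_n^S$ of elements with rank in $S$). Let $b_S(n)$ denote the multiplicity of the trivial representation of $S_n$ in $\beta_S$. -}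

module Defs where

open import Data.Bool using (Bool; true; false; _∧_; _∨_; not; if_then_else_)
open import Data.Nat using (ℕ; zero; suc; _+_; _∸_; _≡ᵇ_; _<ᵇ_; _!)
open import Data.Nat.Properties using (_!≢0)
open import Data.Fin using (Fin; toℕ)
open import Data.Fin.Properties using (_≟_)
open import Data.List using (List; []; _∷_; _++_; map; concatMap; allFin; filterᵇ; length; foldr)
open import Data.Bool.ListAction using (and)
open import Data.Nat.ListAction using (sum)
open import Data.Maybe using (Maybe; just; nothing)
open import Data.Vec.Functional using () renaming (_∷_ to _∷ᶠ_)
open import Data.Integer using (ℤ; +_; -_) renaming (_+_ to _+ℤ_; _*_ to _*ℤ_)
open import Data.Rational using (ℚ; _/_)
open import Relation.Nullary.Decidable using (⌊_⌋)

allFuns : {A : Set} → List A → (n : ℕ) → List (Fin n → A)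
allFuns xs zero = (λ ()) ∷ []
allFuns xs (suc n) = concatMap (λ a → map (λ f → a ∷ᶠ f) (allFuns xs n)) xs

∀ᵇ : (n : ℕ) → (Fin n → Bool) → Bool
∀ᵇ n p = and (map p (allFin n))

_⇒ᵇ_ : Bool → Bool → Bool
a ⇒ᵇ b = not a ∨ b

_==_ : Bool → Bool → Bool
true == b = b
false == b = not b

-- Set partitions of {1..n} (= Fin n), represented faithfully and uniquely
-- by their equivalence relation "i and j lie in the same block".

Rel : ℕ → Set
Rel n = Fin n → Fin n → Bool

isEquivᵇ : {n : ℕ} → Rel n → Bool
isEquivᵇ {n} R =
  ∀ᵇ n (λ i → R i i) ∧
  (∀ᵇ n (λ i → ∀ᵇ n (λ j → R i j ⇒ᵇ R j i)) ∧
   ∀ᵇ n (λ i → ∀ᵇ n (λ j → ∀ᵇ n (λ k → (R i j ∧ R j k) ⇒ᵇ R i k))))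

partitions : (n : ℕ) → List (Rel n)
partitions n = filterᵇ isEquivᵇ (allFuns (allFuns (true ∷ false ∷ []) n) n)

-- Number of blocks: count the elements that are the least element of their block.
numBlocks : {n : ℕ} → Rel n → ℕ
numBlocks {n} R =
  length (filterᵇ (λ i → ∀ᵇ n (λ j → (toℕ j <ᵇ toℕ i) ⇒ᵇ not (R i j))) (allFin n))

rank : {n : ℕ} → Rel n → ℕ
rank {n} R = n ∸ numBlocks R

_≤Π_ : {n : ℕ} → Rel n → Rel n → Bool
_≤Π_ {n} R R' = ∀ᵇ n (λ i → ∀ᵇ n (λ j → R i j ⇒ᵇ R' i j))

isBijᵇ : {n : ℕ} → (Fin n → Fin n) → Bool
isBijᵇ {n} σ = ∀ᵇ n (λ i → ∀ᵇ n (λ j → ⌊ σ i ≟ σ j ⌋ ⇒ᵇ ⌊ i ≟ j ⌋))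

Sym : (n : ℕ) → List (Fin n → Fin n)
Sym n = filterᵇ isBijᵇ (allFuns (allFin n) n)

fixesᵇ : {n : ℕ} → (Fin n → Fin n) → Rel n → Bool
fixesᵇ {n} σ R = ∀ᵇ n (λ i → ∀ᵇ n (λ j → R (σ i) (σ j) == R i j))

-- Character of α_T at σ: the number of chains 0̂ < x₁ < … < x_k < 1̂ of Π_n
-- with rank set exactly T (given as the increasing list t₁ < … < t_k of ranks)
-- which are fixed by σ.  A chain is fixed iff each x_m is fixed (σ preserves rank).
-- Strictness of the chain follows from x_m ≤ x_{m+1} and distinct ranks.

fixedChainsFrom : {n : ℕ} → (Fin n → Fin n) → Maybe (Rel n) → List ℕ → ℕ
fixedChainsFrom σ prev [] = 1
fixedChainsFrom {n} σ prev (t ∷ ts) =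
  sum (map (λ R → fixedChainsFrom σ (just R) ts)
           (filterᵇ (λ R → (rank R ≡ᵇ t) ∧ fixesᵇ σ R ∧ below prev R) (partitions n)))
  where
  below : Maybe (Rel n) → Rel n → Bool
  below nothing R = true
  below (just P) R = P ≤Π R

χα : {n : ℕ} → (Fin n → Fin n) → List ℕ → ℕ
χα σ T = fixedChainsFrom σ nothing T

sublists : List ℕ → List (List ℕ)
sublists [] = [] ∷ []
sublists (x ∷ xs) = map (x ∷_) (sublists xs) ++ sublists xs

sign : ℕ → ℤ
sign zero = + 1
sign (suc k) = - sign k

χβ : {n : ℕ} → (Fin n → Fin n) → List ℕ → ℤ
χβ σ S = foldr _+ℤ_ (+ 0)
  (map (λ T → sign (length S ∸ length T) *ℤ (+ χα σ T)) (sublists S))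

-- b_S(n) = ⟨χ_{β_S}, 1⟩ = (1/n!) Σ_{σ ∈ S_n} χ_{β_S}(σ),
-- the multiplicity of the trivial representation in β_S.
b : List ℕ → (n : ℕ) → ℚ
b S n = _/_ (foldr _+ℤ_ (+ 0) (map (λ σ → χβ σ S) (Sym n))) (n !) {{n !≢0}}

{-# OPTIONS --safe #-}
module Submission where

-- Let d be the coboundary on functions on chains with ranks in S and let h insert the rising element of the
-- EL-labelling of Π_n by block minima.  N = 1 − dh − hd commutes with d and, off the chains of full support S, strictly
-- lowers the number of inversions, so a high power P of N lives on full chains.  Since supertraces do not see the
-- homotopy dh + hd, χβ(σ) = tr(P σ), although P is not equivariant.  Summing over the group, n! b_S is the trace of
-- P ∘ Σσ, which squares to |S_n| times itself; such a trace is positive unless the operator is zero.  So it suffices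
-- to find a cycle on full chains whose sum over some S_n-orbit of chains is nonzero.
--
-- The cycle consists of interval partitions of a path.  At the ranks 1, …, i the edges of i + 1 disjoint pairs are
-- added in all orders (with signs), all but one of them; at the ranks j₁, …, j_l, on top of fixed edges, l + 1 further
-- edges are added in all orders: l − i + 1 that lengthen a big block, and i that attach the remaining pairs to it.
-- This is where i ≤ l is used.  The flag in which all edges come in the prescribed order is isomorphic to no other
-- flag of the cycle, because a pair is recognised by the moment at which it joins the big block.
open import Defs
open import Data.Bool using (Bool; true; false; if_then_else_; not; _∨_; _∧_) renaming (T to 𝕋)
open import Data.Bool.ListAction using (and)
open import Data.Bool.Properties using (∨-zeroʳ)
open import Data.Empty using (⊥; ⊥-elim)
open import Data.Fin using (Fin; zero; suc; toℕ; fromℕ<; combine; remQuot; punchOut)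
open import Data.Fin.Properties using (any?; all?; toℕ-injective; toℕ<n; toℕ-fromℕ<; remQuot-combine; injective⇒≤; punchOut-injective) renaming (_≟_ to _≟ᶠ_)
open import Data.Integer using (ℤ; 0ℤ; 1ℤ)
open import Data.Integer.Tactic.RingSolver using (solve-∀)
open import Data.List using (List; []; _∷_; _++_; map; concatMap; filterᵇ; allFin; foldr; length; replicate; upTo; applyUpTo)
open import Data.List.Membership.Propositional using (_∈_; _∉_; find)
open import Data.List.Membership.Propositional.Properties using (∈-allFin; ∈-map⁺; ∈-map⁻; ∈-++⁺ˡ; ∈-++⁺ʳ; ∈-++⁻; ∈-concatMap⁻; ∈-filter⁻)
open import Data.List.Properties using (++-identityʳ; length-++; length-map; length-replicate; map-++; map-applyUpTo)
open import Data.List.Relation.Binary.Permutation.Propositional using (_↭_; prep; swap; ↭-sym; ↭-trans; ↭-refl; ↭-reflexive; ↭⇒↭ₛ)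
open import Data.List.Relation.Binary.Permutation.Propositional.Properties using (++⁺ʳ; ∈-resp-↭) renaming (shift to ↭-shift)
open import Data.List.Relation.Unary.All using (All; []; _∷_)
open import Data.List.Relation.Unary.AllPairs using ([]; _∷_)
open import Data.List.Relation.Unary.Any using (here; there)
open import Data.List.Relation.Unary.Linked using (Linked; []; [-]; _∷_)
open import Data.List.Relation.Unary.Unique.Propositional using (Unique)
open import Data.List.Relation.Unary.Unique.Propositional.Properties using () renaming (++⁺ to Unique-++⁺)
open import Data.Maybe using (Maybe; just; nothing)
open import Data.Nat using (ℕ; zero; suc; _≤_; _<_; _∸_; z≤n; s≤s; _≤?_; _<?_; _≡ᵇ_; _<ᵇ_; _!; NonZero)
open import Data.Nat.ListAction using (sum)
open import Data.Nat.Properties using (_!≢0)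
open import Data.Product using (_×_; _,_; proj₁; proj₂; ∃)
open import Data.Rational using (0ℚ; _/_) renaming (_<_ to _<ℚ_)
open import Data.Sum using (_⊎_; inj₁; inj₂; [_,_]′)
open import Data.Unit using (⊤; tt)
open import Data.Vec using (Vec; []; _∷_; lookup; tabulate)
open import Data.Vec.Functional using () renaming (_∷_ to _∷ᶠ_)
open import Data.Vec.Properties using (lookup∘tabulate; lookup-replicate; tabulate∘lookup; tabulate-cong)
open import Function using (_∘_; id)
open import Relation.Binary using (tri<; tri≈; tri>)
open import Relation.Binary.PropositionalEquality
open import Relation.Nullary using (Dec; yes; no; ¬_; _×-dec_; ¬?)
open import Relation.Nullary.Decidable using (⌊_⌋; map′; T?; isYes≗does; dec-true; dec-false)
import Data.Bool.Properties as 𝔹ₚ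
import Data.Integer as ℤ
import Data.Integer.Properties as ℤₚ
import Data.List as List
import Data.List.Properties as Listₚ
import Data.List.Relation.Binary.Permutation.Setoid.Properties as ↭ₛ
import Data.List.Relation.Unary.All as All
import Data.List.Relation.Unary.AllPairs as AllPairs
import Data.Maybe as Maybe
import Data.Maybe.Properties as Maybeₚ
import Data.Nat as ℕ
import Data.Nat.Properties as ℕₚ
import Data.Rational.Properties as ℚₚ
import Data.Vec as Vec
import Data.Vec.Properties as Vecₚ
open import Data.List.Membership.DecPropositional ℕₚ._≟_ using (_∈?_)

open ≡-Reasoning

-- An alternating sum over orders is a cycle only if there is one item more than there are levels:
-- deleting an inner level exchanges two consecutive picks, deleting the last level exchanges the
-- last pick with the leftover item. Geometrically this is the barycentric subdivision of the
-- boundary of a simplex. Hence i + 1 low edges for i ranks, and l + 1 upper edges for l ranks. The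
-- two sums can be stacked because the upper flags do not see which low edge was left out: the
-- member of rank j₁ already contains all i + 1 low edges and at least one upper edge, which needs
-- j₁ ≥ i + 2. The condition i ≤ l leaves at least one of the l + 1 upper edges for lengthening the
-- big block, so in the distinguished flag the first upper member attaches no pair and marks the
-- block into which the pairs will be absorbed. All j_l + 1 edges fit on a path with n - 1 edges.
-- The linear algebra stays over the integers: instead of ranks of projections, traces of operators
-- are used that are idempotent up to a positive factor.

module Sums where

  -- Finite integer sums and traces of integer operators.

  open import Data.Integer using (_+_; _*_; -_; _-_; _≟_)

  private variable
    A B : Set

  ∑ : List A → (A → ℤ) → ℤ
  ∑ [] f = 0ℤ
  ∑ (x ∷ xs) f = f x + ∑ xs f

  ⟦_⟧ : Bool → ℤ
  ⟦ true ⟧ = 1ℤ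
  ⟦ false ⟧ = 0ℤ

  ∑-cong∈ : ∀ (xs : List A) {f g} → (∀ x → x ∈ xs → f x ≡ g x) → ∑ xs f ≡ ∑ xs g
  ∑-cong∈ [] eq = refl
  ∑-cong∈ (x ∷ xs) eq = cong₂ _+_ (eq x (here refl)) (∑-cong∈ xs (λ y y∈ → eq y (there y∈)))

  ∑-cong : ∀ (xs : List A) {f g} → (∀ x → f x ≡ g x) → ∑ xs f ≡ ∑ xs g
  ∑-cong xs eq = ∑-cong∈ xs (λ x _ → eq x)

  ∑-zero∈ : ∀ (xs : List A) {f} → (∀ x → x ∈ xs → f x ≡ 0ℤ) → ∑ xs f ≡ 0ℤ
  ∑-zero∈ [] eq = refl
  ∑-zero∈ (x ∷ xs) eq = cong₂ _+_ (eq x (here refl)) (∑-zero∈ xs (λ y y∈ → eq y (there y∈)))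

  ∑-+ : ∀ (xs : List A) f g → ∑ xs (λ x → f x + g x) ≡ ∑ xs f + ∑ xs g
  ∑-+ [] f g = refl
  ∑-+ (x ∷ xs) f g = trans (cong (f x + g x +_) (∑-+ xs f g)) (lem (f x) (g x) (∑ xs f) (∑ xs g))
    where
    lem : ∀ a b c d → a + b + (c + d) ≡ a + c + (b + d)
    lem = solve-∀

  ∑-* : ∀ (xs : List A) k f → ∑ xs (λ x → k * f x) ≡ k * ∑ xs f
  ∑-* [] k f = sym (ℤₚ.*-zeroʳ k)
  ∑-* (x ∷ xs) k f = trans (cong (k * f x +_) (∑-* xs k f)) (sym (ℤₚ.*-distribˡ-+ k (f x) (∑ xs f)))

  ∑-swap : ∀ (xs : List A) (ys : List B) (f : A → B → ℤ) →
    ∑ xs (λ x → ∑ ys (λ y → f x y)) ≡ ∑ ys (λ y → ∑ xs (λ x → f x y))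
  ∑-swap [] ys f = sym (∑-zero∈ ys (λ _ _ → refl))
  ∑-swap (x ∷ xs) ys f =
    trans (cong (∑ ys (f x) +_) (∑-swap xs ys f)) (sym (∑-+ ys (f x) (λ y → ∑ xs (λ x → f x y))))

  ∑-++ : ∀ (xs ys : List A) f → ∑ (xs ++ ys) f ≡ ∑ xs f + ∑ ys f
  ∑-++ [] ys f = sym (ℤₚ.+-identityˡ _)
  ∑-++ (x ∷ xs) ys f = trans (cong (f x +_) (∑-++ xs ys f)) (sym (ℤₚ.+-assoc (f x) (∑ xs f) (∑ ys f)))

  ∑-map : ∀ (g : A → B) xs f → ∑ (map g xs) f ≡ ∑ xs (f ∘ g)
  ∑-map g [] f = refl
  ∑-map g (x ∷ xs) f = cong (f (g x) +_) (∑-map g xs f)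

  ∑-concatMap : ∀ (g : A → List B) xs f → ∑ (concatMap g xs) f ≡ ∑ xs (λ x → ∑ (g x) f)
  ∑-concatMap g [] f = refl
  ∑-concatMap g (x ∷ xs) f =
    trans (∑-++ (g x) (concatMap g xs) f) (cong (∑ (g x) f +_) (∑-concatMap g xs f))

  ∑-filter : ∀ (p : A → Bool) xs f → ∑ (filterᵇ p xs) f ≡ ∑ xs (λ x → ⟦ p x ⟧ * f x)
  ∑-filter p [] f = refl
  ∑-filter p (x ∷ xs) f with p x
  ... | true = cong₂ _+_ (sym (ℤₚ.*-identityˡ (f x))) (∑-filter p xs f)
  ... | false = trans (∑-filter p xs f) (sym (ℤₚ.+-identityˡ _))

  ∑-nonneg : ∀ (xs : List A) {f} → (∀ x → 0ℤ ℤ.≤ f x) → 0ℤ ℤ.≤ ∑ xs f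
  ∑-nonneg [] nn = ℤₚ.≤-refl
  ∑-nonneg (x ∷ xs) nn = ℤₚ.+-mono-≤ (nn x) (∑-nonneg xs nn)

  ∑-lin₂ : ∀ (xs : List A) k l f g → ∑ xs (λ x → k * f x + l * g x) ≡ k * ∑ xs f + l * ∑ xs g
  ∑-lin₂ xs k l f g = trans (∑-+ xs _ _) (cong₂ _+_ (∑-* xs k f) (∑-* xs l g))

  anyNonzero : ∀ (L : List A) (f : A → ℤ) →
    (∃ λ a → a ∈ L × ¬ f a ≡ 0ℤ) ⊎ (∀ a → a ∈ L → f a ≡ 0ℤ)
  anyNonzero [] f = inj₂ λ _ ()
  anyNonzero (x ∷ L) f with f x ≟ 0ℤ | anyNonzero L f
  ... | no fx≢0 | _ = inj₁ (x , here refl , fx≢0)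
  ... | yes _ | inj₁ (a , a∈ , fa) = inj₁ (a , there a∈ , fa)
  ... | yes fx≡0 | inj₂ all0 = inj₂ λ { a (here refl) → fx≡0 ; a (there a∈) → all0 a a∈ }

  square-pos : ∀ i → ¬ i ≡ 0ℤ → 0ℤ ℤ.< i * i
  square-pos ℤ.+0 i≢0 = ⊥-elim (i≢0 refl)
  square-pos ℤ.+[1+ k ] i≢0 = ℤ.+<+ (s≤s z≤n)
  square-pos ℤ.-[1+ k ] i≢0 = ℤ.+<+ (s≤s z≤n)

  cancel-nonneg : ∀ k i → 0ℤ ℤ.< k → 0ℤ ℤ.≤ k * i → 0ℤ ℤ.≤ i
  cancel-nonneg k i 0<k 0≤ki =
    ℤₚ.*-cancelˡ-≤-pos 0ℤ i k {{ℤ.positive 0<k}} (subst (ℤ._≤ k * i) (sym (ℤₚ.*-zeroʳ k)) 0≤ki)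

  *-pos : ∀ {i j} → 0ℤ ℤ.< i → 0ℤ ℤ.< j → 0ℤ ℤ.< i * j
  *-pos {i} {j} 0<i 0<j =
    subst (ℤ._< i * j) (ℤₚ.*-zeroʳ i) (ℤₚ.*-monoˡ-<-pos i {{ℤ.positive 0<i}} 0<j)

  -- Gaussian elimination of one index at a time: each step with a nonzero row lowers the trace by m
  -- (up to a positive factor that clears denominators).
  quasi-idempotent-trace : ∀ (L : List A) (K : A → A → ℤ) m → 0ℤ ℤ.< m →
    (∀ a c → a ∈ L → c ∈ L → ∑ L (λ b → K a b * K b c) ≡ m * K a c) →
    0ℤ ℤ.≤ ∑ L (λ a → K a a) ×
    (∀ a c → a ∈ L → c ∈ L → ¬ K a c ≡ 0ℤ → 0ℤ ℤ.< ∑ L (λ a → K a a))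
  quasi-idempotent-trace [] K m 0<m idem = ℤₚ.≤-refl , λ a c ()
  quasi-idempotent-trace (a ∷ L) K m 0<m idem with anyNonzero (a ∷ L) (K a)
  ... | inj₂ row0 = subst (0ℤ ℤ.≤_) tr≡ (proj₁ IH) , positive
    where
    idem′ : ∀ x y → x ∈ L → y ∈ a ∷ L → ∑ L (λ z → K x z * K z y) ≡ m * K x y
    idem′ x y x∈ y∈ = trans
      (sym (trans (cong (_+ ∑ L (λ z → K x z * K z y)) (trans (cong (K x a *_) (row0 y y∈)) (ℤₚ.*-zeroʳ (K x a))))
                  (ℤₚ.+-identityˡ _)))
      (idem x y (there x∈) y∈)
    IH = quasi-idempotent-trace L K m 0<m (λ x y x∈ y∈ → idem′ x y x∈ (there y∈))
    tr≡ : ∑ L (λ x → K x x) ≡ K a a + ∑ L (λ x → K x x)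
    tr≡ = trans (sym (ℤₚ.+-identityˡ _)) (cong (_+ ∑ L (λ x → K x x)) (sym (row0 a (here refl))))
    positive : ∀ x y → x ∈ a ∷ L → y ∈ a ∷ L → ¬ K x y ≡ 0ℤ → 0ℤ ℤ.< K a a + ∑ L (λ x → K x x)
    positive x y (here refl) y∈ ≢0 = ⊥-elim (≢0 (row0 y y∈))
    positive x y (there x∈) y∈ ≢0 with anyNonzero L (K x)
    ... | inj₁ (z , z∈ , Kxz≢0) = subst (0ℤ ℤ.<_) tr≡ (proj₂ IH x z x∈ z∈ Kxz≢0)
    -- The nonzero entry might sit in column a, which the induction hypothesis does not cover. But m
    -- times any entry of row x is a combination of the entries of that row on L.
    ... | inj₂ Kx0 with ℤₚ.i*j≡0⇒i≡0∨j≡0 m (trans (sym (idem′ x y x∈ y∈))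
                          (∑-zero∈ L (λ z z∈ → trans (cong (_* K z y) (Kx0 z z∈)) (ℤₚ.*-zeroˡ (K z y)))))
    ...   | inj₁ m≡0 = ⊥-elim (ℤₚ.<-irrefl (sym m≡0) 0<m)
    ...   | inj₂ Kxy≡0 = ⊥-elim (≢0 Kxy≡0)
  ... | inj₁ (c , c∈ , v≢0) = ℤₚ.<⇒≤ tr>0 , λ _ _ _ _ _ → tr>0
    where
    tr = ∑ (a ∷ L) (λ x → K x x)
    v = K a c
    -- Up to the factor v², the rank-one matrix K e_c e_aᵀ K / v is subtracted from K. The remainder
    -- is again quasi-idempotent, has row a equal to zero, and has lost one eigenvalue m.
    K′ : _ → _ → ℤ
    K′ x y = v * v * K x y - v * K x c * K a y
    K′-row : ∀ y → K′ a y ≡ 0ℤ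
    K′-row y = lem v (K a y)
      where
      lem : ∀ v k → v * v * k - v * v * k ≡ 0ℤ
      lem = solve-∀
    idem′ : ∀ x y → x ∈ L → y ∈ L → ∑ L (λ z → K′ x z * K′ z y) ≡ v * v * m * K′ x y
    idem′ x y x∈ y∈ = begin
      ∑ L (λ z → K′ x z * K′ z y)
        ≡⟨ ℤₚ.+-identityˡ _ ⟨
      0ℤ + ∑ L (λ z → K′ x z * K′ z y)
        ≡⟨ cong (_+ ∑ L (λ z → K′ x z * K′ z y)) (trans (cong (K′ x a *_) (K′-row y)) (ℤₚ.*-zeroʳ (K′ x a))) ⟨
      ∑ (a ∷ L) (λ z → K′ x z * K′ z y)
        ≡⟨ ∑-cong (a ∷ L) (λ z → expand v (K x z) (K x c) (K a z) (K z y) (K z c) (K a y)) ⟩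
      ∑ (a ∷ L) (λ z → v * v * (v * v * (K x z * K z y) + - (v * K a y) * (K x z * K z c))
                     + - (v * v * K x c) * (v * (K a z * K z y) + - K a y * (K a z * K z c)))
        ≡⟨ ∑-lin₂ (a ∷ L) (v * v) (- (v * v * K x c)) _ _ ⟩
      v * v * ∑ (a ∷ L) (λ z → v * v * (K x z * K z y) + - (v * K a y) * (K x z * K z c))
        + - (v * v * K x c) * ∑ (a ∷ L) (λ z → v * (K a z * K z y) + - K a y * (K a z * K z c))
        ≡⟨ cong₂ (λ p q → v * v * p + - (v * v * K x c) * q)
             (trans (∑-lin₂ (a ∷ L) (v * v) (- (v * K a y)) _ _)
               (cong₂ (λ p q → v * v * p + - (v * K a y) * q)
                 (idem x y (there x∈) (there y∈)) (idem x c (there x∈) c∈)))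
             (trans (∑-lin₂ (a ∷ L) v (- K a y) _ _)
               (cong₂ (λ p q → v * p + - K a y * q)
                 (idem a y (here refl) (there y∈)) (idem a c (here refl) c∈))) ⟩
      v * v * (v * v * (m * K x y) + - (v * K a y) * (m * K x c))
        + - (v * v * K x c) * (v * (m * K a y) + - K a y * (m * v))
        ≡⟨ collect v m (K x y) (K x c) (K a y) ⟩
      v * v * m * K′ x y ∎
      where
      expand : ∀ v xz xc az zy zc ay →
        (v * v * xz - v * xc * az) * (v * v * zy - v * zc * ay) ≡
        v * v * (v * v * (xz * zy) + - (v * ay) * (xz * zc)) + - (v * v * xc) * (v * (az * zy) + - ay * (az * zc))
      expand = solve-∀
      collect : ∀ v m xy xc ay →
        v * v * (v * v * (m * xy) + - (v * ay) * (m * xc)) + - (v * v * xc) * (v * (m * ay) + - ay * (m * v)) ≡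
        v * v * m * (v * v * xy - v * xc * ay)
      collect = solve-∀
    tr′ : ∑ L (λ x → K′ x x) ≡ v * v * (tr - m)
    tr′ = begin
      ∑ L (λ x → K′ x x)
        ≡⟨ trans (sym (ℤₚ.+-identityˡ _)) (cong (_+ ∑ L (λ x → K′ x x)) (sym (K′-row a))) ⟩
      ∑ (a ∷ L) (λ x → K′ x x)
        ≡⟨ ∑-cong (a ∷ L) (λ x → rearr v (K x x) (K x c) (K a x)) ⟩
      ∑ (a ∷ L) (λ x → v * v * K x x + - v * (K a x * K x c))
        ≡⟨ ∑-lin₂ (a ∷ L) (v * v) (- v) _ _ ⟩
      v * v * tr + - v * ∑ (a ∷ L) (λ x → K a x * K x c)
        ≡⟨ cong (λ p → v * v * tr + - v * p) (idem a c (here refl) c∈) ⟩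
      v * v * tr + - v * (m * v)
        ≡⟨ fin v tr m ⟩
      v * v * (tr - m) ∎
      where
      rearr : ∀ v xx xc ax → v * v * xx - v * xc * ax ≡ v * v * xx + - v * (ax * xc)
      rearr = solve-∀
      fin : ∀ v t m → v * v * t + - v * (m * v) ≡ v * v * (t - m)
      fin = solve-∀
    IH = quasi-idempotent-trace L K′ (v * v * m) (*-pos (square-pos v v≢0) 0<m) idem′
    tr>0 : 0ℤ ℤ.< tr
    tr>0 = ℤₚ.<-≤-trans 0<m (ℤₚ.0≤i-j⇒j≤i
      (cancel-nonneg (v * v) (tr - m) (square-pos v v≢0) (subst (0ℤ ℤ.≤_) tr′ (proj₁ IH))))

  module Operators {I : Set} (_≟I_ : (x y : I) → Dec (x ≡ y)) (L : List I)
    (δ-sum : ∀ c → c ∈ L → ∀ (f : I → ℤ) → ∑ L (λ c′ → f c′ * ⟦ ⌊ c′ ≟I c ⌋ ⟧) ≡ f c) where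

    Op : Set
    Op = (I → ℤ) → I → ℤ

    δ : I → I → ℤ
    δ c′ c = ⟦ ⌊ c′ ≟I c ⌋ ⟧

    -- Cochains are functions on all chains, valid or not, and only their values on L carry meaning.
    -- `local` lets an operator descend to functions on L, where `kernel` provides its matrix.
    record IsOp (T : Op) : Set where
      field
        local : ∀ {φ ψ} → (∀ c → c ∈ L → φ c ≡ ψ c) → ∀ c → c ∈ L → T φ c ≡ T ψ c
        add : ∀ φ ψ c → c ∈ L → T (λ x → φ x + ψ x) c ≡ T φ c + T ψ c
        scale : ∀ k φ c → c ∈ L → T (λ x → k * φ x) c ≡ k * T φ c

      zeroOp : ∀ c → c ∈ L → T (λ _ → 0ℤ) c ≡ 0ℤ
      zeroOp c c∈ = trans (scale 0ℤ (λ _ → 0ℤ) c c∈) (ℤₚ.*-zeroˡ (T (λ _ → 0ℤ) c))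

      sumOp : ∀ {B : Set} (ys : List B) (k : B → I → ℤ) c → c ∈ L →
        T (λ x → ∑ ys (λ y → k y x)) c ≡ ∑ ys (λ y → T (k y) c)
      sumOp [] k c c∈ = zeroOp c c∈
      sumOp (y ∷ ys) k c c∈ = trans (add (k y) _ c c∈) (cong (T (k y) c +_) (sumOp ys k c c∈))

      kernel : ∀ φ c → c ∈ L → T φ c ≡ ∑ L (λ c′ → φ c′ * T (δ c′) c)
      kernel φ c c∈ = trans (local (λ x x∈ → sym (δ-sum x x∈ φ)) c c∈)
        (trans (sumOp L (λ c′ x → φ c′ * δ c′ x) c c∈)
               (∑-cong L (λ c′ → scale (φ c′) (δ c′) c c∈)))

    open IsOp

    _∘ₒ_ : ∀ {S T} → IsOp S → IsOp T → IsOp (S ∘ T)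
    (s ∘ₒ t) .local eq = local s (local t eq)
    (s ∘ₒ t) .add φ ψ c c∈ = trans (local s (λ x x∈ → add t φ ψ x x∈) c c∈) (add s _ _ c c∈)
    (s ∘ₒ t) .scale k φ c c∈ = trans (local s (λ x x∈ → scale t k φ x x∈) c c∈) (scale s k _ c c∈)

    tr : Op → ℤ
    tr T = ∑ L (λ c → T (δ c) c)

    tr-cong : ∀ {S T} → (∀ φ c → c ∈ L → S φ c ≡ T φ c) → tr S ≡ tr T
    tr-cong eq = ∑-cong∈ L (λ c c∈ → eq (δ c) c c∈)

    tr-comm : ∀ {S T} → IsOp S → IsOp T → tr (S ∘ T) ≡ tr (T ∘ S)
    tr-comm {S} {T} s t = begin
      ∑ L (λ c → S (T (δ c)) c)
        ≡⟨ ∑-cong∈ L (λ c c∈ → kernel s (T (δ c)) c c∈) ⟩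
      ∑ L (λ c → ∑ L (λ c′ → T (δ c) c′ * S (δ c′) c))
        ≡⟨ ∑-swap L L (λ c c′ → T (δ c) c′ * S (δ c′) c) ⟩
      ∑ L (λ c′ → ∑ L (λ c → T (δ c) c′ * S (δ c′) c))
        ≡⟨ ∑-cong L (λ c′ → ∑-cong L (λ c → ℤₚ.*-comm (T (δ c) c′) (S (δ c′) c))) ⟩
      ∑ L (λ c′ → ∑ L (λ c → S (δ c′) c * T (δ c) c′))
        ≡⟨ ∑-cong∈ L (λ c′ c∈ → kernel t (S (δ c′)) c′ c∈) ⟨
      ∑ L (λ c′ → T (S (δ c′)) c′) ∎

    trace-positive : ∀ {T} → IsOp T → ∀ m → 0ℤ ℤ.< m →
      (∀ φ c → c ∈ L → T (T φ) c ≡ m * T φ c) →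
      ∀ φ c → c ∈ L → ¬ T φ c ≡ 0ℤ → 0ℤ ℤ.< tr T
    trace-positive {T} t m 0<m TT φ c c∈ Tφ≢0 with anyNonzero L (λ c′ → T (δ c′) c)
    ... | inj₁ (c′ , c′∈ , ≢0) =
      proj₂ (quasi-idempotent-trace L (λ x y → T (δ y) x) m 0<m
        (λ x y x∈ y∈ → trans (∑-cong L (λ z → ℤₚ.*-comm (T (δ z) x) (T (δ y) z)))
                             (trans (sym (kernel t (T (δ y)) x x∈)) (TT (δ y) x x∈))))
        c c′ c∈ c′∈ ≢0
    ... | inj₂ all0 = ⊥-elim (Tφ≢0 (trans (kernel t φ c c∈)
      (∑-zero∈ L (λ c′ c′∈ → trans (cong (φ c′ *_) (all0 c′ c′∈)) (ℤₚ.*-zeroʳ (φ c′))))))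

open Sums

-- Set partitions coded by block minima, descents and rising elements.

module Codes where

  open import Data.Nat using (_+_)

  vec-ext : ∀ {A : Set} {n} {u w : Vec A n} → (∀ v → lookup u v ≡ lookup w v) → u ≡ w
  vec-ext {u = u} {w} eq = trans (sym (tabulate∘lookup u)) (trans (tabulate-cong eq) (tabulate∘lookup w))

  yes-true : ∀ {P : Set} (P? : Dec P) → P → ⌊ P? ⌋ ≡ true
  yes-true P? p = trans (isYes≗does P?) (dec-true P? p)

  no-false : ∀ {P : Set} (P? : Dec P) → ¬ P → ⌊ P? ⌋ ≡ false
  no-false P? ¬p = trans (isYes≗does P?) (dec-false P? ¬p)

  true-yes : ∀ {P : Set} (P? : Dec P) → ⌊ P? ⌋ ≡ true → P
  true-yes (yes p) _ = p

  card : ∀ {n} → (Fin n → Bool) → ℕ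
  card {zero} p = 0
  card {suc n} p = (if p zero then 1 else 0) + card (p ∘ suc)

  card-mono : ∀ {n} {p q : Fin n → Bool} → (∀ v → p v ≡ true → q v ≡ true) → card p ≤ card q
  card-mono {zero} p⊆q = z≤n
  card-mono {suc n} {p} {q} p⊆q with p zero in p0 | q zero in q0
  ... | false | _ = ℕₚ.≤-trans (card-mono (p⊆q ∘ suc)) (ℕₚ.m≤n+m _ _)
  ... | true | true = s≤s (card-mono (p⊆q ∘ suc))
  ... | true | false with () ← trans (sym q0) (p⊆q zero p0)

  card-cong : ∀ {n} {p q : Fin n → Bool} → (∀ v → p v ≡ q v) → card p ≡ card q
  card-cong eq = ℕₚ.≤-antisym (card-mono (λ v e → trans (sym (eq v)) e)) (card-mono (λ v e → trans (eq v) e))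

  card-strict : ∀ {n} {p q : Fin n → Bool} → (∀ v → p v ≡ true → q v ≡ true) →
    ∀ w → p w ≡ false → q w ≡ true → card p < card q
  card-strict {suc n} {p} {q} p⊆q zero pw qw rewrite pw | qw = s≤s (card-mono (p⊆q ∘ suc))
  card-strict {suc n} {p} {q} p⊆q (suc w) pw qw with p zero in p0 | q zero in q0
  ... | false | false = card-strict (p⊆q ∘ suc) w pw qw
  ... | false | true = ℕₚ.m≤n⇒m≤1+n (card-strict (p⊆q ∘ suc) w pw qw)
  ... | true | true = s≤s (card-strict (p⊆q ∘ suc) w pw qw)
  ... | true | false with () ← trans (sym q0) (p⊆q zero p0)

  card≤n : ∀ {n} (p : Fin n → Bool) → card p ≤ n
  card≤n {zero} p = z≤n
  card≤n {suc n} p with p zero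
  ... | true = s≤s (card≤n (p ∘ suc))
  ... | false = ℕₚ.m≤n⇒m≤1+n (card≤n (p ∘ suc))

  -- For `fill-rk`: raising the threshold of `fillAt` from t to t + 1 can add only the point t to
  -- the non-minima.
  card-almost : ∀ {n} {p q : Fin n → Bool} t → (∀ v → ¬ toℕ v ≡ t → q v ≡ true → p v ≡ true) →
    card q ≤ suc (card p)
  card-almost {zero} t q⊆p = z≤n
  card-almost {suc n} {p} {q} zero q⊆p with p zero | q zero
  ... | true | true = s≤s (ℕₚ.m≤n⇒m≤1+n (card-mono (λ v → q⊆p (suc v) λ ())))
  ... | false | true = s≤s (card-mono (λ v → q⊆p (suc v) λ ()))
  ... | true | false = ℕₚ.m≤n⇒m≤1+n (ℕₚ.m≤n⇒m≤1+n (card-mono (λ v → q⊆p (suc v) λ ())))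
  ... | false | false = ℕₚ.m≤n⇒m≤1+n (card-mono (λ v → q⊆p (suc v) λ ()))
  card-almost {suc n} {p} {q} (suc t) q⊆p with p zero in p0 | q zero in q0
  ... | true | true = s≤s (card-almost t (λ v v≢t → q⊆p (suc v) (v≢t ∘ ℕₚ.suc-injective)))
  ... | false | false = card-almost t (λ v v≢t → q⊆p (suc v) (v≢t ∘ ℕₚ.suc-injective))
  ... | true | false = ℕₚ.m≤n⇒m≤1+n (card-almost t (λ v v≢t → q⊆p (suc v) (v≢t ∘ ℕₚ.suc-injective)))
  ... | false | true with () ← trans (sym p0) (q⊆p zero (λ ()) q0)

  card-exchange : ∀ {n} {p q : Fin n → Bool} → card p ≡ card q → ∀ v → p v ≡ true → q v ≡ false →
    ∃ λ w → q w ≡ true × p w ≡ false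
  card-exchange {p = p} {q} p≡q v pv qv with any? (λ w → (q w ≟ᵇ true) ×-dec (p w ≟ᵇ false))
    where open import Data.Bool.Properties using () renaming (_≟_ to _≟ᵇ_)
  ... | yes found = found
  ... | no none = ⊥-elim (ℕₚ.<-irrefl (sym p≡q) (card-strict q⊆p v qv pv))
    where
    q⊆p : ∀ w → q w ≡ true → p w ≡ true
    q⊆p w qw with p w in pw
    ... | true = refl
    ... | false = ⊥-elim (none (w , qw , pw))

  card-true : ∀ {n} {p : Fin n → Bool} → (∀ v → p v ≡ true) → card p ≡ n
  card-true {zero} all = refl
  card-true {suc n} {p} all rewrite all zero = cong suc (card-true (all ∘ suc))

  card-false : ∀ {n} {p : Fin n → Bool} → (∀ v → p v ≡ false) → card p ≡ 0
  card-false {zero} all = refl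
  card-false {suc n} {p} all rewrite all zero = card-false (all ∘ suc)

  discrete-ivt : ∀ (f : ℕ → ℕ) → (∀ t → f (suc t) ≤ suc (f t)) → ∀ m s → f 0 ≤ s → s ≤ f m →
    ∃ λ t → t ≤ m × f t ≡ s
  discrete-ivt f step zero s lo hi = 0 , z≤n , ℕₚ.≤-antisym lo hi
  discrete-ivt f step (suc m) s lo hi with s ≤? f m
  ... | yes s≤fm = let t , t≤m , eq = discrete-ivt f step m s lo s≤fm in t , ℕₚ.m≤n⇒m≤1+n t≤m , eq
  ... | no s≰fm = suc m , ℕₚ.≤-refl , ℕₚ.≤-antisym (ℕₚ.≤-trans (step m) (ℕₚ.≰⇒> s≰fm)) hi

  search : ℕ → (ℕ → Bool) → ℕ
  search zero p = 0
  search (suc m) p = if p (suc m) then suc m else search m p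

  search-finds : ∀ m (p : ℕ → Bool) t → t ≤ m → p t ≡ true → p (search m p) ≡ true
  search-finds zero p zero z≤n pt = pt
  search-finds (suc m) p t t≤ pt with p (suc m) in eq
  ... | true = eq
  ... | false with ℕₚ.m≤n⇒m<n∨m≡n t≤
  ...   | inj₁ (s≤s t≤m) = search-finds m p t t≤m pt
  ...   | inj₂ refl with () ← trans (sym eq) pt

  -- A set partition of Fin n is coded by the map sending each point to the least point of its block.

  Code : ℕ → Set
  Code n = Vec (Fin n) n

  module _ {n : ℕ} where

    record IsCode (z : Code n) : Set where
      constructor isCode
      field
        decr : ∀ v → toℕ (lookup z v) ≤ toℕ v
        idem : ∀ v → lookup z (lookup z v) ≡ lookup z v
    open IsCode public

    infix 4 _⊑_
    record _⊑_ (x y : Code n) : Set where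
      constructor refines
      field
        at : ∀ v → lookup y (lookup x v) ≡ lookup y v
    open _⊑_ public

    -- In the EL-labelling a merge of two blocks is labelled by the larger of their minima, the one
    -- point that stops being a minimum. The labels used between x and y are therefore the
    -- non-minima of y that are minima of x, and `rk` counts the labels used from the bottom.
    NonMin : Code n → Fin n → Set
    NonMin z v = ¬ lookup z v ≡ v

    min? : ∀ (z : Code n) v → Dec (lookup z v ≡ v)
    min? z v = lookup z v ≟ᶠ v

    nonMin : Code n → Fin n → Bool
    nonMin z v = not ⌊ min? z v ⌋

    nonMin-true : ∀ (z : Code n) v → NonMin z v → nonMin z v ≡ true
    nonMin-true z v nm = cong not (no-false (min? z v) nm)

    nonMin-false : ∀ (z : Code n) v → lookup z v ≡ v → nonMin z v ≡ false
    nonMin-false z v m = cong not (yes-true (min? z v) m)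

    true-nonMin : ∀ (z : Code n) v → nonMin z v ≡ true → NonMin z v
    true-nonMin z v e with no ¬p ← min? z v = ¬p

    false-min : ∀ (z : Code n) v → nonMin z v ≡ false → lookup z v ≡ v
    false-min z v e with yes p ← min? z v = p

    rk : Code n → ℕ
    rk z = card (nonMin z)

    ⊑-trans : ∀ {x y z} → x ⊑ y → y ⊑ z → x ⊑ z
    ⊑-trans {x} {y} {z} x⊑y y⊑z .at v =
      trans (sym (at y⊑z (lookup x v))) (trans (cong (lookup z) (at x⊑y v)) (at y⊑z v))

    NonMin-mono : ∀ {x y} → IsCode x → IsCode y → x ⊑ y → ∀ v → NonMin x v → NonMin y v
    NonMin-mono {x} {y} ix iy x⊑y v nm yv≡v = nm (toℕ-injective (ℕₚ.≤-antisym (decr ix v)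
      (subst (λ w → toℕ w ≤ toℕ (lookup x v)) (trans (at x⊑y v) yv≡v) (decr iy (lookup x v)))))

    min-anti : ∀ {x y} → IsCode x → IsCode y → x ⊑ y → ∀ v → lookup y v ≡ v → lookup x v ≡ v
    min-anti {x} ix iy x⊑y v yv with min? x v
    ... | yes p = p
    ... | no nm = ⊥-elim (NonMin-mono ix iy x⊑y v nm yv)

    newNonMin : ∀ (x y : Code n) → rk x < rk y → ∃ λ v → NonMin y v × lookup x v ≡ v
    newNonMin x y lt with any? (λ v → ¬? (min? y v) ×-dec min? x v)
    ... | yes found = found
    ... | no none = ⊥-elim (ℕₚ.<⇒≱ lt (card-mono λ v yv → nonMin-true x v
                      (λ xv → none (v , true-nonMin y v yv , xv))))

    -- A label b used between x and z exceeds a label a used between z and y. For chains that skip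
    -- ranks this replaces a descent of the label sequence at z; without it, z lies on the
    -- increasing chain of the interval.
    data Des (x z y : Code n) : Set where
      des : ∀ b a → toℕ a < toℕ b → NonMin z b → lookup x b ≡ b → NonMin y a → lookup z a ≡ a → Des x z y

    Des? : ∀ (x z y : Code n) → Dec (Des x z y)
    Des? x z y = map′
      (λ { (b , a , p , q , r , s , t) → des b a p q r s t })
      (λ { (des b a p q r s t) → b , a , p , q , r , s , t })
      (any? λ b → any? λ a →
        (toℕ a <? toℕ b) ×-dec ¬? (min? z b) ×-dec min? x b ×-dec ¬? (min? y a) ×-dec min? z a)

    -- The threshold is compared with the block minimum `lookup x v` and not with v, so that blocks
    -- of x move as a whole; the merges performed are those with label below t.
    fillAt : Code n → Code n → ℕ → Code n
    fillAt x y t = tabulate λ v → if ⌊ toℕ (lookup x v) <? t ⌋ then lookup y v else lookup x v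

    fillAt-< : ∀ (x y : Code n) t v → toℕ (lookup x v) < t → lookup (fillAt x y t) v ≡ lookup y v
    fillAt-< x y t v lt = trans (lookup∘tabulate _ v)
      (cong (if_then lookup y v else lookup x v) (yes-true (toℕ (lookup x v) <? t) lt))

    fillAt-≥ : ∀ (x y : Code n) t v → ¬ toℕ (lookup x v) < t → lookup (fillAt x y t) v ≡ lookup x v
    fillAt-≥ x y t v ge = trans (lookup∘tabulate _ v)
      (cong (if_then lookup y v else lookup x v) (no-false (toℕ (lookup x v) <? t) ge))

    module FillAt {x y : Code n} (ix : IsCode x) (iy : IsCode y) (x⊑y : x ⊑ y) (t : ℕ) where

      f : Code n
      f = fillAt x y t

      y≤x : ∀ v → toℕ (lookup y v) ≤ toℕ (lookup x v)
      y≤x v = subst (λ w → toℕ w ≤ toℕ (lookup x v)) (at x⊑y v) (decr iy (lookup x v))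

      cases : ∀ v → (toℕ (lookup x v) < t × lookup f v ≡ lookup y v) ⊎
                    (¬ toℕ (lookup x v) < t × lookup f v ≡ lookup x v)
      cases v with toℕ (lookup x v) <? t
      ... | yes lt = inj₁ (lt , fillAt-< x y t v lt)
      ... | no ge = inj₂ (ge , fillAt-≥ x y t v ge)

      lower : x ⊑ f
      lower .at v with cases v
      ... | inj₁ (lt , eq) = trans (fillAt-< x y t (lookup x v) (subst (λ w → toℕ w < t) (sym (idem ix v)) lt))
                                   (trans (at x⊑y v) (sym eq))
      ... | inj₂ (ge , eq) = trans (fillAt-≥ x y t (lookup x v) (ge ∘ subst (λ w → toℕ w < t) (idem ix v)))
                                   (trans (idem ix v) (sym eq))

      upper : f ⊑ y
      upper .at v with cases v
      ... | inj₁ (lt , eq) = trans (cong (lookup y) eq) (idem iy v)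
      ... | inj₂ (ge , eq) = trans (cong (lookup y) eq) (at x⊑y v)

      x-fixes-y : ∀ v → lookup x (lookup y v) ≡ lookup y v
      x-fixes-y v = min-anti ix iy x⊑y (lookup y v) (idem iy v)

      isCode-f : IsCode f
      isCode-f .decr v with cases v
      ... | inj₁ (lt , eq) = subst (λ w → toℕ w ≤ toℕ v) (sym eq) (decr iy v)
      ... | inj₂ (ge , eq) = subst (λ w → toℕ w ≤ toℕ v) (sym eq) (decr ix v)
      isCode-f .idem v with cases v
      ... | inj₁ (lt , eq) = trans (cong (lookup f) eq) (trans
              (fillAt-< x y t (lookup y v)
                (subst (λ w → toℕ w < t) (sym (x-fixes-y v)) (ℕₚ.≤-<-trans (y≤x v) lt)))
              (trans (idem iy v) (sym eq)))
      ... | inj₂ (ge , eq) = trans (cong (lookup f) eq) (trans (at lower v) refl)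

      nonMin-f : ∀ v → NonMin f v → NonMin x v ⊎ (NonMin y v × toℕ v < t)
      nonMin-f v nm with min? x v
      ... | no xv = inj₁ xv
      ... | yes xv with cases v
      ...   | inj₁ (lt , eq) = inj₂ ((λ yv → nm (trans eq yv)) , subst (λ w → toℕ w < t) xv lt)
      ...   | inj₂ (ge , eq) = ⊥-elim (nm (trans eq xv))

      f-nonMin : ∀ v → NonMin y v → toℕ v < t → NonMin f v
      f-nonMin v yv v<t with min? x v
      ... | no xv = NonMin-mono ix isCode-f lower v xv
      ... | yes xv = λ fv → yv (trans (sym (fillAt-< x y t v (subst (λ w → toℕ w < t) (sym xv) v<t))) fv)

      noDes : ¬ Des x f y
      noDes (des b a a<b fb xb ya fa) with nonMin-f b fb
      ... | inj₁ nxb = nxb xb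
      ... | inj₂ (_ , b<t) = f-nonMin a ya (ℕₚ.<-trans a<b b<t) fa

    -- The rising element of rank s. A suitable threshold exists by `discrete-ivt`, because labels
    -- are distinct numbers and the rank grows by at most one per step.
    fill : Code n → Code n → ℕ → Code n
    fill x y s = fillAt x y (search n (λ t → rk (fillAt x y t) ≡ᵇ s))

    fill-rk : ∀ {x y} → IsCode x → IsCode y → x ⊑ y → ∀ s → rk x ≤ s → s ≤ rk y → rk (fill x y s) ≡ s
    fill-rk {x} {y} ix iy x⊑y s lo hi = ℕₚ.≡ᵇ⇒≡ _ _ (subst 𝕋 (sym found) _)
      where
      module F = FillAt ix iy x⊑y
      g : ℕ → ℕ
      g t = rk (fillAt x y t)
      g0 : g 0 ≤ rk x
      g0 = card-mono λ v e → nonMin-true x v (case0 v (F.nonMin-f 0 v (true-nonMin (fillAt x y 0) v e)))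
        where
        case0 : ∀ v → NonMin x v ⊎ (NonMin y v × toℕ v < 0) → NonMin x v
        case0 v (inj₁ p) = p
        case0 v (inj₂ (_ , ()))
      gn : rk y ≤ g n
      gn = card-mono λ v e → nonMin-true (fillAt x y n) v (F.f-nonMin n v (true-nonMin y v e) (toℕ<n v))
      step : ∀ t → g (suc t) ≤ suc (g t)
      step t = card-almost t λ v v≢t e →
        nonMin-true (fillAt x y t) v (caseS v v≢t (F.nonMin-f (suc t) v (true-nonMin (fillAt x y (suc t)) v e)))
        where
        caseS : ∀ v → ¬ toℕ v ≡ t → NonMin x v ⊎ (NonMin y v × toℕ v < suc t) → NonMin (fillAt x y t) v
        caseS v v≢t (inj₁ p) = NonMin-mono ix (F.isCode-f t) (F.lower t) v p
        caseS v v≢t (inj₂ (p , s≤s v≤t)) = F.f-nonMin t v p (ℕₚ.≤∧≢⇒< v≤t v≢t)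
      ivt = discrete-ivt g step n s (ℕₚ.≤-trans g0 lo) (ℕₚ.≤-trans hi gn)
      found : (g (search n (λ t → g t ≡ᵇ s)) ≡ᵇ s) ≡ true
      found = search-finds n (λ t → g t ≡ᵇ s) (proj₁ ivt) (proj₁ (proj₂ ivt))
        (trans (cong (_≡ᵇ s) (proj₂ (proj₂ ivt))) (≡ᵇ-refl s))
        where
        ≡ᵇ-refl : ∀ s → (s ≡ᵇ s) ≡ true
        ≡ᵇ-refl zero = refl
        ≡ᵇ-refl (suc s) = ≡ᵇ-refl s

    -- Otherwise equal ranks give a label v used only by z and a label w used only by z′. The
    -- element that uses the larger one has passed over the smaller one, which is a descent.
    noDes-nonMin : ∀ {x z z′ y} → IsCode x → IsCode z → IsCode z′ → IsCode y →
      x ⊑ z → z ⊑ y → x ⊑ z′ → z′ ⊑ y → rk z ≡ rk z′ → ¬ Des x z y → ¬ Des x z′ y →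
      ∀ v → NonMin z v → NonMin z′ v
    noDes-nonMin {x} {z} {z′} {y} ix iz iz′ iy x⊑z z⊑y x⊑z′ z′⊑y rk≡ nd nd′ v zv z′v
      with w , z′w , zw ← card-exchange rk≡ v (nonMin-true z v zv) (nonMin-false z′ v z′v)
      with ℕₚ.<-cmp (toℕ v) (toℕ w)
    ... | tri< v<w _ _ = nd′ (des w v v<w (true-nonMin z′ w z′w) (min-anti ix iz x⊑z w (false-min z w zw))
                                  (NonMin-mono iz iy z⊑y v zv) z′v)
    ... | tri> _ _ w<v = nd (des v w w<v zv (min-anti ix iz′ x⊑z′ v z′v)
                                 (NonMin-mono iz′ iy z′⊑y w (true-nonMin z′ w z′w)) (false-min z w zw))
    ... | tri≈ _ v≡w _ = true-nonMin z′ w z′w (subst (λ u → lookup z′ u ≡ u) (toℕ-injective v≡w) z′v)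

    -- If z merged u into a block whose minimum y merges further, that minimum would be a label
    -- smaller than u used after u.
    noDes-lookup : ∀ {x z y} → IsCode z → z ⊑ y → ¬ Des x z y →
      ∀ u → lookup x u ≡ u → NonMin z u → lookup z u ≡ lookup y u
    noDes-lookup {x} {z} {y} iz z⊑y nd u xu zu with min? y (lookup z u)
    ... | yes p = trans (sym p) (at z⊑y u)
    ... | no p = ⊥-elim (nd (des u (lookup z u) (ℕₚ.≤∧≢⇒< (decr iz u) (zu ∘ toℕ-injective)) zu xu p (idem iz u)))

    noDes-unique : ∀ {x z z′ y} → IsCode x → IsCode z → IsCode z′ → IsCode y →
      x ⊑ z → z ⊑ y → x ⊑ z′ → z′ ⊑ y → rk z ≡ rk z′ → ¬ Des x z y → ¬ Des x z′ y → z ≡ z′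
    noDes-unique {x} {z} {z′} {y} ix iz iz′ iy x⊑z z⊑y x⊑z′ z′⊑y rk≡ nd nd′ = vec-ext eq
      where
      eqMin : ∀ u → lookup x u ≡ u → lookup z u ≡ lookup z′ u
      eqMin u xu with min? z u | min? z′ u
      ... | yes p | yes p′ = trans p (sym p′)
      ... | yes p | no p′ = ⊥-elim (noDes-nonMin ix iz′ iz iy x⊑z′ z′⊑y x⊑z z⊑y (sym rk≡) nd′ nd u p′ p)
      ... | no p | yes p′ = ⊥-elim (noDes-nonMin ix iz iz′ iy x⊑z z⊑y x⊑z′ z′⊑y rk≡ nd nd′ u p p′)
      ... | no p | no p′ = trans (noDes-lookup iz z⊑y nd u xu p) (sym (noDes-lookup iz′ z′⊑y nd′ u xu p′))
      eq : ∀ v → lookup z v ≡ lookup z′ v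
      eq v = trans (sym (at x⊑z v)) (trans (eqMin (lookup x v) (idem ix v)) (at x⊑z′ v))

    -- Removing the rising element z from x ⊏ z ⊏ y does not affect descents of its neighbours.
    Des-upper⁻ : ∀ {w x z y} → rk x < rk z → ¬ Des x z y → Des w x y → Des w x z
    Des-upper⁻ {w} {x} {z} {y} lt nd (des b a a<b xb wb ya xa) with min? z a
    ... | no za = des b a a<b xb wb za xa
    ... | yes za with c , zc , xc ← newNonMin x z lt with ℕₚ.<-cmp (toℕ a) (toℕ c)
    ...   | tri< a<c _ _ = ⊥-elim (nd (des c a a<c zc xc ya za))
    ...   | tri≈ _ a≡c _ = ⊥-elim (zc (subst (λ u → lookup z u ≡ u) (toℕ-injective a≡c) za))
    ...   | tri> _ _ c<a = des b c (ℕₚ.<-trans c<a a<b) xb wb zc xc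

    Des-upper⁺ : ∀ {w x z y} → IsCode z → IsCode y → z ⊑ y → Des w x z → Des w x y
    Des-upper⁺ iz iy z⊑y (des b a a<b xb wb za xa) =
      des b a a<b xb wb (NonMin-mono iz iy z⊑y a za) xa

    Des-lower⁻ : ∀ {x z y w} → rk z < rk y → ¬ Des x z y → Des x y w → Des z y w
    Des-lower⁻ {x} {z} {y} {w} lt nd (des b a a<b yb xb wa ya) with min? z b
    ... | yes zb = des b a a<b yb zb wa ya
    ... | no zb with c , yc , zc ← newNonMin z y lt with ℕₚ.<-cmp (toℕ c) (toℕ b)
    ...   | tri< c<b _ _ = ⊥-elim (nd (des b c c<b zb xb yc zc))
    ...   | tri≈ _ c≡b _ = ⊥-elim (zb (subst (λ u → lookup z u ≡ u) (toℕ-injective c≡b) zc))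
    ...   | tri> _ _ b<c = des c a (ℕₚ.<-trans a<b b<c) yc zc wa ya

    -- For the case where y is deleted from a chain: if y was rising, the element inserted below it
    -- remains the rising one with respect to the following member y′.
    noDes-trans : ∀ {x f y y′} → IsCode f → IsCode y → f ⊑ y → rk f < rk y →
      ¬ Des x f y → ¬ Des x y y′ → ¬ Des x f y′
    noDes-trans {x} {f} {y} {y′} ifc iy f⊑y lt nd nd′ (des b a a<b fb xb ya′ fa) with min? y a
    ... | no ya = nd (des b a a<b fb xb ya fa)
    ... | yes ya = nd′ (des b a a<b (NonMin-mono ifc iy f⊑y b fb) xb ya′ ya)

  module _ {k : ℕ} where

    top : Code (suc k)
    top = Vec.replicate (suc k) zero

    bot : Code (suc k)
    bot = tabulate id

    top-isCode : IsCode top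
    top-isCode .decr v = subst (λ w → toℕ w ≤ toℕ v) (sym (lookup-replicate v zero)) z≤n
    top-isCode .idem v = trans (lookup-replicate (lookup top v) zero) (sym (lookup-replicate v zero))

    ⊑-top : ∀ z → z ⊑ top
    ⊑-top z .at v = trans (lookup-replicate (lookup z v) zero) (sym (lookup-replicate v zero))

    top-rk : rk top ≡ k
    top-rk = card-true λ v → nonMin-true top (suc v) (λ e → case (trans (sym (lookup-replicate (suc v) zero)) e))
      where
      case : ∀ {v : Fin k} → zero ≡ suc v → ⊥
      case ()

    bot-isCode : IsCode bot
    bot-isCode .decr v = ℕₚ.≤-reflexive (cong toℕ (lookup∘tabulate id v))
    bot-isCode .idem v = cong (lookup bot) (lookup∘tabulate id v)

    bot-min : ∀ v → lookup bot v ≡ v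
    bot-min = lookup∘tabulate id

    bot-rk : rk bot ≡ 0
    bot-rk = card-false λ v → nonMin-false bot v (bot-min v)

    ⊑-bot : ∀ z → bot ⊑ z
    ⊑-bot z .at v = cong (lookup z) (bot-min v)

open Codes

-- Chains, coboundary, the insertion homotopy and inversions.

module Chains where

  open import Data.Integer using (_+_; _*_; -_; _-_)

  -- A T-chain with T ⊆ S is recorded as a list indexed by S, with nothing at the ranks outside T.

  module _ {k : ℕ} where

    private
      n : ℕ
      n = suc k

    Chain : Set
    Chain = List (Maybe (Code n))

    next : Chain → Code n
    next [] = top
    next (nothing ∷ c) = next c
    next (just z ∷ c) = z

    absent : Chain → ℕ
    absent [] = 0
    absent (nothing ∷ c) = suc (absent c)
    absent (just z ∷ c) = absent c

    data Valid : Code n → List ℕ → Chain → Set where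
      [] : ∀ {x} → Valid x [] []
      omit : ∀ {x s S c} → Valid x S c → Valid x (s ∷ S) (nothing ∷ c)
      pick : ∀ {x s S z c} → IsCode z → x ⊑ z → rk z ≡ s → Valid z S c → Valid x (s ∷ S) (just z ∷ c)

    -- The bound k is the rank of `top`, which `next` treats as the member following the last one;
    -- so every rank of the list is strictly below it.
    data Asc : ℕ → List ℕ → Set where
      [] : ∀ {r} → r < k → Asc r []
      _∷_ : ∀ {r s S} → r < s → Asc s S → Asc r (s ∷ S)

    next-rk : ∀ {r x S c} → Asc r S → Valid x S c → r < rk (next c)
    next-rk ([] r<k) [] = subst (_ <_) (sym top-rk) r<k
    next-rk (r<s ∷ asc) (omit v) = ℕₚ.<-trans r<s (next-rk asc v)
    next-rk (r<s ∷ asc) (pick _ _ refl _) = r<s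

    next-isCode : ∀ {x S c} → Valid x S c → IsCode (next c)
    next-isCode [] = top-isCode
    next-isCode (omit v) = next-isCode v
    next-isCode (pick iz _ _ _) = iz

    next-⊒ : ∀ {x S c} → Valid x S c → x ⊑ next c
    next-⊒ [] = ⊑-top _
    next-⊒ (omit v) = next-⊒ v
    next-⊒ (pick _ x⊑z _ _) = x⊑z

    Valid-weaken : ∀ {w x S c} → w ⊑ x → Valid x S c → Valid w S c
    Valid-weaken w⊑x [] = []
    Valid-weaken w⊑x (omit v) = omit (Valid-weaken w⊑x v)
    Valid-weaken w⊑x (pick iz x⊑z eq v) = pick iz (⊑-trans w⊑x x⊑z) eq v

    Valid-raise : ∀ {x f S c} → f ⊑ next c → Valid x S c → Valid f S c
    Valid-raise f⊑ [] = []
    Valid-raise f⊑ (omit v) = omit (Valid-raise f⊑ v)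
    Valid-raise f⊑ (pick iz _ eq v) = pick iz f⊑ eq v

    record Filled (x y : Code n) (s : ℕ) (f : Code n) : Set where
      field
        code : IsCode f
        lower : x ⊑ f
        upper : f ⊑ y
        rank≡ : rk f ≡ s
        rising : ¬ Des x f y

    filled : ∀ {x y s} → IsCode x → IsCode y → x ⊑ y → rk x < s → s < rk y → Filled x y s (fill x y s)
    filled {x} {y} {s} ix iy x⊑y lo hi = record
      { code = F.isCode-f ; lower = F.lower ; upper = F.upper
      ; rank≡ = fill-rk ix iy x⊑y s (ℕₚ.<⇒≤ lo) (ℕₚ.<⇒≤ hi) ; rising = F.noDes }
      where module F = FillAt ix iy x⊑y _

    fillNext : ∀ {x s S c} → IsCode x → Asc (rk x) (s ∷ S) → Valid x S c →
      Filled x (next c) s (fill x (next c) s)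
    fillNext ix (r<s ∷ asc) v = filled ix (next-isCode v) (next-⊒ v) r<s (next-rk asc v)

    d : (Chain → ℤ) → Chain → ℤ
    d φ [] = 0ℤ
    d φ (nothing ∷ c) = d (φ ∘ (nothing ∷_)) c
    d φ (just z ∷ c) = φ (nothing ∷ c) - d (φ ∘ (just z ∷_)) c

    -- A matching in the sense of discrete Morse theory. From the bottom, members that are descents
    -- are passed, each with a sign; at the first other position a vacant rank is filled by the
    -- rising element, while a rising member gives 0.
    h : Code n → List ℕ → (Chain → ℤ) → Chain → ℤ
    h x [] φ c = 0ℤ
    h x (s ∷ S) φ [] = 0ℤ
    h x (s ∷ S) φ (nothing ∷ c) = φ (just (fill x (next c) s) ∷ c)
    h x (s ∷ S) φ (just z ∷ c) =
      if ⌊ Des? x z (next c) ⌋ then - h z S (φ ∘ (just z ∷_)) c else 0ℤ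

    -- `Face` and `Ins` record on which chains the values of `d` and `h` depend; all congruence and
    -- vanishing arguments are made on these supports.
    data Face : Chain → Chain → Set where
      drop : ∀ {z c} → Face (nothing ∷ c) (just z ∷ c)
      keep : ∀ {m c′ c} → Face c′ c → Face (m ∷ c′) (m ∷ c)

    data Ins (x : Code n) : List ℕ → Chain → Chain → Set where
      here : ∀ {s S c} → Ins x (s ∷ S) (nothing ∷ c) (just (fill x (next c) s) ∷ c)
      there : ∀ {s S z c c′} → Des x z (next c) → Ins z S c c′ → Ins x (s ∷ S) (just z ∷ c) (just z ∷ c′)

    d-cong : ∀ {φ ψ} c → (∀ c′ → Face c′ c → φ c′ ≡ ψ c′) → d φ c ≡ d ψ c
    d-cong [] eq = refl
    d-cong (nothing ∷ c) eq = d-cong c (λ c′ f → eq (nothing ∷ c′) (keep f))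
    d-cong (just z ∷ c) eq = cong₂ _-_ (eq _ drop) (d-cong c (λ c′ f → eq (just z ∷ c′) (keep f)))

    h-des : ∀ x s S φ z c → Des x z (next c) → h x (s ∷ S) φ (just z ∷ c) ≡ - h z S (φ ∘ (just z ∷_)) c
    h-des x s S φ z c p with Des? x z (next c)
    ... | yes _ = refl
    ... | no ¬p = ⊥-elim (¬p p)

    h-cong : ∀ x S {φ ψ} c → (∀ c′ → Ins x S c c′ → φ c′ ≡ ψ c′) → h x S φ c ≡ h x S ψ c
    h-cong x [] c eq = refl
    h-cong x (s ∷ S) [] eq = refl
    h-cong x (s ∷ S) (nothing ∷ c) eq = eq _ here
    h-cong x (s ∷ S) (just z ∷ c) eq with Des? x z (next c)
    ... | yes p = cong -_ (h-cong z S c (λ c′ i → eq (just z ∷ c′) (there p i)))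
    ... | no _ = refl

    d-lin : ∀ a b φ ψ c → d (λ x → a * φ x + b * ψ x) c ≡ a * d φ c + b * d ψ c
    d-lin a b φ ψ [] = lem a b
      where
      lem : ∀ a b → 0ℤ ≡ a * 0ℤ + b * 0ℤ
      lem = solve-∀
    d-lin a b φ ψ (nothing ∷ c) = d-lin a b _ _ c
    d-lin a b φ ψ (just z ∷ c) =
      trans (cong (λ q → a * φ (nothing ∷ c) + b * ψ (nothing ∷ c) - q) (d-lin a b (φ ∘ (just z ∷_)) (ψ ∘ (just z ∷_)) c))
            (lem a b (φ (nothing ∷ c)) (ψ (nothing ∷ c)) _ _)
      where
      lem : ∀ a b p q r s → a * p + b * q - (a * r + b * s) ≡ a * (p - r) + b * (q - s)
      lem = solve-∀

    h-lin : ∀ x S a b φ ψ c → h x S (λ x → a * φ x + b * ψ x) c ≡ a * h x S φ c + b * h x S ψ c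
    h-lin x [] a b φ ψ c = lem a b
      where
      lem : ∀ a b → 0ℤ ≡ a * 0ℤ + b * 0ℤ
      lem = solve-∀
    h-lin x (s ∷ S) a b φ ψ [] = lem a b
      where
      lem : ∀ a b → 0ℤ ≡ a * 0ℤ + b * 0ℤ
      lem = solve-∀
    h-lin x (s ∷ S) a b φ ψ (nothing ∷ c) = refl
    h-lin x (s ∷ S) a b φ ψ (just z ∷ c) with Des? x z (next c)
    ... | yes _ = trans (cong -_ (h-lin z S a b _ _ c)) (lem a b _ _)
      where
      lem : ∀ a b p q → - (a * p + b * q) ≡ a * - p + b * - q
      lem = solve-∀
    ... | no _ = lem a b
      where
      lem : ∀ a b → 0ℤ ≡ a * 0ℤ + b * 0ℤ
      lem = solve-∀

    module Linear (T : (Chain → ℤ) → Chain → ℤ)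
      (T-cong : ∀ {φ ψ} → (∀ c → φ c ≡ ψ c) → ∀ c → T φ c ≡ T ψ c)
      (T-lin : ∀ a b φ ψ c → T (λ x → a * φ x + b * ψ x) c ≡ a * T φ c + b * T ψ c) where

      scale : ∀ a φ c → T (λ x → a * φ x) c ≡ a * T φ c
      scale a φ c = trans (T-cong (λ x → lem a (φ x)) c) (trans (T-lin a 0ℤ φ φ c) (sym (lem a (T φ c))))
        where
        lem : ∀ a p → a * p ≡ a * p + 0ℤ * p
        lem = solve-∀

      add : ∀ φ ψ c → T (λ x → φ x + ψ x) c ≡ T φ c + T ψ c
      add φ ψ c = trans (T-cong (λ x → lem (φ x) (ψ x)) c) (trans (T-lin 1ℤ 1ℤ φ ψ c) (sym (lem (T φ c) (T ψ c))))
        where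
        lem : ∀ p q → p + q ≡ 1ℤ * p + 1ℤ * q
        lem = solve-∀

      sub : ∀ φ ψ c → T (λ x → φ x - ψ x) c ≡ T φ c - T ψ c
      sub φ ψ c = trans (T-cong (λ x → lem (φ x) (ψ x)) c)
        (trans (T-lin 1ℤ (- 1ℤ) φ ψ c) (sym (lem (T φ c) (T ψ c))))
        where
        lem : ∀ p q → p - q ≡ 1ℤ * p + - 1ℤ * q
        lem = solve-∀

      zeroᵀ : ∀ c → T (λ _ → 0ℤ) c ≡ 0ℤ
      zeroᵀ c = trans (T-cong (λ _ → refl) c) (trans (scale 0ℤ (λ _ → 0ℤ) c) (ℤₚ.*-zeroˡ (T (λ _ → 0ℤ) c)))

    module Lin-d = Linear d (λ eq c → d-cong c (λ c′ _ → eq c′)) d-lin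
    module Lin-h x S = Linear (h x S) (λ eq c → h-cong x S c (λ c′ _ → eq c′)) (h-lin x S)

    d-vanish : ∀ {φ} c → (∀ c′ → Face c′ c → φ c′ ≡ 0ℤ) → d φ c ≡ 0ℤ
    d-vanish c eq = trans (d-cong c eq) (Lin-d.zeroᵀ c)

    h-vanish : ∀ x S {φ} c → (∀ c′ → Ins x S c c′ → φ c′ ≡ 0ℤ) → h x S φ c ≡ 0ℤ
    h-vanish x S c eq = trans (h-cong x S c eq) (Lin-h.zeroᵀ x S c)

    d-d : ∀ φ c → d (d φ) c ≡ 0ℤ
    d-d φ [] = refl
    d-d φ (nothing ∷ c) = d-d (φ ∘ (nothing ∷_)) c
    d-d φ (just z ∷ c) = trans
      (cong (λ q → d φ₀ c - q) (trans (Lin-d.sub φ₀ (d (φ ∘ (just z ∷_))) c) (cong (λ q → d φ₀ c - q) (d-d (φ ∘ (just z ∷_)) c))))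
      (lem (d φ₀ c))
      where
      φ₀ = φ ∘ (nothing ∷_)
      lem : ∀ p → p - (p - 0ℤ) ≡ 0ℤ
      lem = solve-∀

    Face-absent : ∀ {c′ c} → Face c′ c → absent c′ ≡ suc (absent c)
    Face-absent drop = refl
    Face-absent (keep {nothing} f) = cong suc (Face-absent f)
    Face-absent (keep {just z} f) = Face-absent f

    Ins-absent : ∀ {x S c c′} → Ins x S c c′ → absent c ≡ suc (absent c′)
    Ins-absent here = refl
    Ins-absent (there _ i) = Ins-absent i

    Face-valid : ∀ {x S c c′} → Face c′ c → Valid x S c → Valid x S c′
    Face-valid drop (pick iz x⊑z eq v) = omit (Valid-weaken x⊑z v)
    Face-valid (keep f) (omit v) = omit (Face-valid f v)
    Face-valid (keep f) (pick iz x⊑z eq v) = pick iz x⊑z eq (Face-valid f v)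

    Asc-at : ∀ {r} (z : Code n) {s S} → rk z ≡ s → Asc r (s ∷ S) → Asc (rk z) S
    Asc-at _ refl (_ ∷ asc) = asc

    Ins-valid : ∀ {x S c c′} → IsCode x → Asc (rk x) S → Ins x S c c′ → Valid x S c → Valid x S c′
    Ins-valid {x} ix asc (here {s} {S} {c}) (omit v) = pick F.code F.lower F.rank≡ (Valid-raise F.upper v)
      where module F = Filled (fillNext ix asc v)
    Ins-valid ix asc (there {z = z} _ i) (pick iz x⊑z eq v) = pick iz x⊑z eq (Ins-valid iz (Asc-at z eq asc) i v)

    -- Inversions: the pairs a < b such that b, but not a, is a non-minimum of some member of the chain.

    Pair : Set
    Pair = Fin n × Fin n

    data Inverted (z : Code n) : Pair → Set where
      -- The last condition excludes a = 0, the only point that is never a label. Thus `top`, which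
      -- is not listed as a member, contributes no inversion.
      inv : ∀ {a b} → toℕ a < toℕ b → NonMin z b → lookup z a ≡ a → NonMin top a → Inverted z (a , b)

    Inverted? : ∀ z p → Dec (Inverted z p)
    Inverted? z (a , b) = map′
      (λ { (p , q , r , s) → inv p q r s }) (λ { (inv p q r s) → p , q , r , s })
      ((toℕ a <? toℕ b) ×-dec ¬? (min? z b) ×-dec min? z a ×-dec ¬? (min? top a))

    PairSet : Set
    PairSet = Pair → Bool

    infix 4 _⊆ₚ_
    _⊆ₚ_ : PairSet → PairSet → Set
    I ⊆ₚ J = ∀ p → I p ≡ true → J p ≡ true

    infixl 5 _⊔_
    _⊔_ : PairSet → Code n → PairSet
    (J ⊔ z) p = J p ∨ ⌊ Inverted? z p ⌋

    ⊔-left : ∀ J z → J ⊆ₚ J ⊔ z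
    ⊔-left J z p Jp rewrite Jp = refl

    ⊔-right : ∀ J z p → Inverted z p → (J ⊔ z) p ≡ true
    ⊔-right J z p i = trans (cong (J p ∨_) (yes-true (Inverted? z p) i)) (∨-zeroʳ (J p))

    ⊔-cases : ∀ J z p → (J ⊔ z) p ≡ true → J p ≡ true ⊎ Inverted z p
    ⊔-cases J z p e with J p
    ... | true = inj₁ refl
    ... | false = inj₂ (true-yes (Inverted? z p) e)

    inversions : PairSet → Chain → PairSet
    inversions J [] = J
    inversions J (nothing ∷ c) = inversions J c
    inversions J (just z ∷ c) = inversions (J ⊔ z) c

    size : PairSet → ℕ
    size J = card {n Data.Nat.* n} (J ∘ remQuot n)

    size-mono : ∀ {I J} → I ⊆ₚ J → size I ≤ size J
    size-mono I⊆J = card-mono (λ v → I⊆J (remQuot n v))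

    size-strict : ∀ {I J} → I ⊆ₚ J → ∀ p → ¬ I p ≡ true → J p ≡ true → size I < size J
    size-strict {I} {J} I⊆J (a , b) ¬Ip Jp = card-strict (λ v → I⊆J (remQuot n v)) (combine a b)
      (trans (cong I (remQuot-combine a b)) (¬true (I (a , b)) ¬Ip)) (trans (cong J (remQuot-combine a b)) Jp)
      where
      ¬true : ∀ x → ¬ x ≡ true → x ≡ false
      ¬true true ¬t = ⊥-elim (¬t refl)
      ¬true false _ = refl

    inversions-split : ∀ {I J} c p → inversions I c p ≡ true → I p ≡ true ⊎ inversions J c p ≡ true
    inversions-⊆ : ∀ {I J} → I ⊆ₚ J → ∀ c → inversions I c ⊆ₚ inversions J c
    inversions-⊇ : ∀ J c → J ⊆ₚ inversions J c

    inversions-⊇ J [] p e = e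
    inversions-⊇ J (nothing ∷ c) = inversions-⊇ J c
    inversions-⊇ J (just z ∷ c) p e = inversions-⊇ (J ⊔ z) c p (⊔-left J z p e)

    inversions-⊆ I⊆J [] = I⊆J
    inversions-⊆ I⊆J (nothing ∷ c) = inversions-⊆ I⊆J c
    inversions-⊆ {I} {J} I⊆J (just z ∷ c) = inversions-⊆ sub c
      where
      sub : I ⊔ z ⊆ₚ J ⊔ z
      sub p e with ⊔-cases I z p e
      ... | inj₁ Ip = ⊔-left J z p (I⊆J p Ip)
      ... | inj₂ zp = ⊔-right J z p zp

    inversions-split [] p e = inj₁ e
    inversions-split (nothing ∷ c) p e = inversions-split c p e
    inversions-split {I} {J} (just z ∷ c) p e with inversions-split {I ⊔ z} {J ⊔ z} c p e
    ... | inj₂ q = inj₂ q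
    ... | inj₁ q with ⊔-cases I z p q
    ...   | inj₁ Ip = inj₁ Ip
    ...   | inj₂ zp = inj₂ (inversions-⊇ (J ⊔ z) c p (⊔-right J z p zp))

    inversions-absorb : ∀ {I J} c → I ⊆ₚ inversions J c → inversions I c ⊆ₚ inversions J c
    inversions-absorb {I} {J} c I⊆ p e with inversions-split {I} {J} c p e
    ... | inj₁ Ip = I⊆ p Ip
    ... | inj₂ q = q

    inversions-next : ∀ J c p → Inverted (next c) p → inversions J c p ≡ true
    inversions-next J [] p (inv _ _ ta nta) = ⊥-elim (nta ta)
    inversions-next J (nothing ∷ c) p i = inversions-next J c p i
    inversions-next J (just z ∷ c) p i = inversions-⊇ (J ⊔ z) c p (⊔-right J z p i)

    Face-inversions : ∀ {c′ c} J → Face c′ c → inversions J c′ ⊆ₚ inversions J c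
    Face-inversions J (drop {z} {c}) = inversions-⊆ (⊔-left J z) c
    Face-inversions J (keep {nothing} f) = Face-inversions J f
    Face-inversions J (keep {just z} f) = Face-inversions (J ⊔ z) f

    -- A non-minimum of the next member stays one in all later members, so none of them can
    -- contribute an inversion whose smaller label is a.
    inversions-later : ∀ {x S c} J a b → Valid x S c → NonMin (next c) a →
      inversions J c (a , b) ≡ true → J (a , b) ≡ true
    inversions-later J a b [] na e = e
    inversions-later J a b (omit v) na e = inversions-later J a b v na e
    inversions-later J a b (pick {z = z} iz _ _ v) na e
      with ⊔-cases J z (a , b) (inversions-later (J ⊔ z) a b v (NonMin-mono iz (next-isCode v) (next-⊒ v) a na) e)
    ... | inj₁ q = q
    ... | inj₂ (inv _ _ za _) = ⊥-elim (na za)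

    NonMin-top : ∀ {z : Code n} → IsCode z → ∀ a → NonMin z a → NonMin (top {k}) a
    NonMin-top iz a = NonMin-mono iz top-isCode (⊑-top _) a

    -- J collects the inversions of the members up to x. `contains` finds the inversions of x in J
    -- again; `bounded` keeps out pairs whose larger label has not been used yet.
    record Prefix (x : Code n) (J : PairSet) : Set where
      field
        contains : ∀ p → Inverted x p → J p ≡ true
        bounded : ∀ a b → J (a , b) ≡ true → NonMin x b
    open Prefix

    Prefix-extend : ∀ {x z J} → IsCode x → IsCode z → x ⊑ z → Prefix x J → Prefix z (J ⊔ z)
    Prefix-extend {z = z} {J} ix iz x⊑z pre .contains p i = ⊔-right J z p i
    Prefix-extend {z = z} {J} ix iz x⊑z pre .bounded a b e with ⊔-cases J z (a , b) e
    ... | inj₁ Jp = NonMin-mono ix iz x⊑z b (bounded pre a b Jp)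
    ... | inj₂ (inv _ zb _ _) = zb

    -- An inversion (a, b) of the rising element f is one of x if b is already a non-minimum of x,
    -- and one of the next member if a is still a minimum there; otherwise it would be a descent at
    -- f. So inserting f creates no inversion.
    rising-absorbed : ∀ {x J c s f} → IsCode x → Prefix x J → Filled x (next c) s f → IsCode (next c) →
      J ⊔ f ⊆ₚ inversions J c
    rising-absorbed {x} {J} {c} {s} {f} ix pre fl iy p e with ⊔-cases J f p e
    ... | inj₁ Jp = inversions-⊇ J c p Jp
    rising-absorbed {x} {J} {c} {s} {f} ix pre fl iy (a , b) e | inj₂ (inv a<b fb fa ta) with min? x b
    ... | no xb = inversions-⊇ J c _ (contains pre _ (inv a<b xb (min-anti ix (Filled.code fl) (Filled.lower fl) a fa) ta))
    ... | yes xb with min? (next c) a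
    ...   | yes ya = inversions-next J c _ (inv a<b (NonMin-mono (Filled.code fl) iy (Filled.upper fl) b fb) ya ta)
    ...   | no ya = ⊥-elim (Filled.rising fl (des b a a<b fb xb ya fa))

    Ins-inversions : ∀ {x J S c c′} → IsCode x → Asc (rk x) S → Prefix x J → Valid x S c → Ins x S c c′ →
      inversions J c′ ⊆ₚ inversions J c
    Ins-inversions {J = J} ix asc pre (omit v) (here {c = c}) =
      inversions-absorb c (rising-absorbed {c = c} ix pre (fillNext ix asc v) (next-isCode v))
    Ins-inversions ix asc pre (pick iz x⊑z eq v) (there {z = z} _ i) =
      Ins-inversions iz (Asc-at z eq asc) (Prefix-extend ix iz x⊑z pre) v i

    data RemFirst : Chain → Chain → Set where
      drop : ∀ {z c} → RemFirst (nothing ∷ c) (just z ∷ c)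
      skip : ∀ {c′ c} → RemFirst c′ c → RemFirst (nothing ∷ c′) (nothing ∷ c)

    Face-next : ∀ {c′ c} → Face c′ c → next c′ ≡ next c ⊎ RemFirst c′ c
    Face-next drop = inj₂ drop
    Face-next (keep {just z} f) = inj₁ refl
    Face-next (keep {nothing} f) with Face-next f
    ... | inj₁ eq = inj₁ eq
    ... | inj₂ r = inj₂ (skip r)

    RemFirst-⊑ : ∀ {x S c′ c} → RemFirst c′ c → Valid x S c → next c ⊑ next c′
    RemFirst-⊑ drop (pick _ _ _ v) = next-⊒ v
    RemFirst-⊑ (skip r) (omit v) = RemFirst-⊑ r v

    removal-lowers : ∀ {x S c′ c I J w} → Valid x S c → Face c′ c →
      I ⊆ₚ inversions J c → (∀ a b → lookup w b ≡ b → ¬ I (a , b) ≡ true) → Des w (next c) (next c′) →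
      size (inversions I c′) < size (inversions J c)
    removal-lowers {c′ = c′} {c} {I} {J} v f I⊆ w∌ (des b a a<b yb wb y′a ya) =
      size-strict sub (a , b)
        (λ e → w∌ a b wb (inversions-later I a b (Face-valid f v) y′a e))
        (inversions-next J c (a , b) (inv a<b yb ya (NonMin-top (next-isCode (Face-valid f v)) a y′a)))
      where
      sub : inversions I c′ ⊆ₚ inversions J c
      sub p e with inversions-split {I} {J} c′ p e
      ... | inj₁ Ip = I⊆ p Ip
      ... | inj₂ q = Face-inversions J f p q

    Prefix-avoids : ∀ {x J} → Prefix x J → ∀ a b → lookup x b ≡ b → ¬ J (a , b) ≡ true
    Prefix-avoids pre a b xb Jab = bounded pre a b Jab xb

    ⊔-avoids : ∀ {x f J} → IsCode x → IsCode f → x ⊑ f → Prefix x J →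
      ∀ a b → lookup f b ≡ b → ¬ (J ⊔ f) (a , b) ≡ true
    ⊔-avoids {x} {f} {J} ix ifc x⊑f pre a b fb e with ⊔-cases J f (a , b) e
    ... | inj₁ Jp = bounded pre a b Jp (min-anti ix ifc x⊑f b fb)
    ... | inj₂ (inv _ nfb _ _) = nfb fb

    Ins-next : ∀ {x z S c c′} → IsCode z → Asc (rk z) S → Valid z S c → Ins z S c c′ →
      Des x z (next c) → Des x z (next c′)
    Ins-next iz asc@(r<s ∷ _) (omit v) here p =
      Des-upper⁻ (subst (_ <_) (sym (Filled.rank≡ fl)) r<s) (Filled.rising fl) p
      where fl = fillNext iz asc v
    Ins-next iz asc v (there _ i) p = p

    fill-unique : ∀ {x y s f z} → IsCode x → IsCode y → Filled x y s f → Filled x y s z → f ≡ z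
    fill-unique ix iy F Z = noDes-unique ix (F.code) (Z.code) iy F.lower F.upper Z.lower Z.upper
      (trans F.rank≡ (sym Z.rank≡)) F.rising Z.rising
      where
      module F = Filled F
      module Z = Filled Z

    -- Apart from φ c, the terms on the left cancel or evaluate φ at a chain with strictly fewer
    -- inversions, where it vanishes by assumption. The number of vacant ranks agrees in all terms,
    -- since `d` and `h` change it by one in opposite directions.
    homotopy : ∀ {x S c J} → IsCode x → Asc (rk x) S → Prefix x J → Valid x S c → ¬ absent c ≡ 0 → ∀ φ →
      (∀ c′ → Valid x S c′ → absent c′ ≡ absent c → size (inversions J c′) < size (inversions J c) → φ c′ ≡ 0ℤ) →
      h x S (d φ) c + d (h x S φ) c ≡ φ c
    homotopy ix asc pre [] ne φ low = ⊥-elim (ne refl)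
    homotopy {x} {s ∷ S} {nothing ∷ c} {J} ix asc@(r<s ∷ asc′) pre (omit v) ne φ low = begin
      φ (nothing ∷ c) - d (φ ∘ (just f ∷_)) c + d (λ c′ → φ (just (fill x (next c′) s) ∷ c′)) c
        ≡⟨ cong (φ (nothing ∷ c) - d (φ ∘ (just f ∷_)) c +_) (d-cong c agree) ⟩
      φ (nothing ∷ c) - d (φ ∘ (just f ∷_)) c + d (φ ∘ (just f ∷_)) c
        ≡⟨ lem (φ (nothing ∷ c)) (d (φ ∘ (just f ∷_)) c) ⟩
      φ (nothing ∷ c) ∎
      where
      f = fill x (next c) s
      fl = fillNext ix asc v
      module F = Filled fl
      f<y : rk f < rk (next c)
      f<y = subst (_< rk (next c)) (sym F.rank≡) (next-rk asc′ v)
      lem : ∀ p q → p - q + q ≡ p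
      lem = solve-∀
      -- Inserting f commutes with deleting a member above it, unless the deleted member was the
      -- next one and not rising. In that case both orders lead to chains with fewer inversions.
      agree : ∀ c′ → Face c′ c → φ (just (fill x (next c′) s) ∷ c′) ≡ φ (just f ∷ c′)
      agree c′ face = cases (Face-next face) (Des? x (next c) (next c′))
        where
        v′ = Face-valid face v
        cases : next c′ ≡ next c ⊎ RemFirst c′ c → Dec (Des x (next c) (next c′)) →
          φ (just (fill x (next c′) s) ∷ c′) ≡ φ (just f ∷ c′)
        cases (inj₁ eq) _ = cong (λ y → φ (just (fill x y s) ∷ c′)) eq
        cases (inj₂ r) (no rising) = cong (λ g → φ (just g ∷ c′)) (fill-unique ix (next-isCode v′) (fillNext ix asc v′) record
          { code = F.code ; lower = F.lower ; upper = ⊑-trans F.upper (RemFirst-⊑ r v) ; rank≡ = F.rank≡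
          ; rising = noDes-trans F.code (next-isCode v) F.upper f<y F.rising rising })
        cases (inj₂ r) (yes p) = trans
          (low _ (Ins-valid ix asc here (omit v′)) (Face-absent face)
            (ℕₚ.≤-<-trans
              (size-mono (inversions-absorb c′ (rising-absorbed {c = c′} ix pre (fillNext ix asc v′) (next-isCode v′))))
              (removal-lowers v face (inversions-⊇ J c) (Prefix-avoids pre) p)))
          (sym (low _ (pick F.code F.lower F.rank≡ (Valid-raise (⊑-trans F.upper (RemFirst-⊑ r v)) v′)) (Face-absent face)
            (removal-lowers v face (rising-absorbed {c = c} ix pre fl (next-isCode v)) (⊔-avoids ix F.code F.lower pre)
              (Des-lower⁻ f<y F.rising p))))
    homotopy {x} {s ∷ S} {just z ∷ c} {J} ix asc@(r<s ∷ _) pre (pick iz x⊑z eq v) ne φ low with Des? x z (next c)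
    ... | no rising = begin
      0ℤ + (φ (just (fill x (next c) s) ∷ c) - d (λ c′ → h x (s ∷ S) φ (just z ∷ c′)) c)
        ≡⟨ cong₂ (λ p q → 0ℤ + (p - q)) (cong (λ g → φ (just g ∷ c)) fill≡z) (d-vanish c dead) ⟩
      0ℤ + (φ (just z ∷ c) - 0ℤ)
        ≡⟨ lem (φ (just z ∷ c)) ⟩
      φ (just z ∷ c) ∎
      where
      lem : ∀ p → 0ℤ + (p - 0ℤ) ≡ p
      lem = solve-∀
      ascz = Asc-at z eq asc
      fill≡z : fill x (next c) s ≡ z
      fill≡z = fill-unique ix (next-isCode v) (fillNext ix asc (Valid-weaken x⊑z v)) record
        { code = iz ; lower = x⊑z ; upper = next-⊒ v ; rank≡ = eq ; rising = rising }
      -- A rising z can turn into a descent only if the face deletes the next member and that member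
      -- was a descent itself; then the inversions have already dropped.
      dead : ∀ c′ → Face c′ c → h x (s ∷ S) φ (just z ∷ c′) ≡ 0ℤ
      dead c′ face with Des? x z (next c′)
      ... | no _ = refl
      ... | yes p = trans (cong -_ (h-vanish z S c′ λ c″ i →
            low _ (pick iz x⊑z eq (Ins-valid iz ascz i v′)) (ℕₚ.suc-injective (trans (sym (Ins-absent i)) (Face-absent face)))
              (ℕₚ.≤-<-trans (size-mono (Ins-inversions iz ascz pre′ v′ i))
                (removal-lowers v face (inversions-⊇ (J ⊔ z) c) (Prefix-avoids pre′) newDes)))) refl
        where
        v′ = Face-valid face v
        pre′ = Prefix-extend ix iz x⊑z pre
        newDes : Des z (next c) (next c′)
        newDes with Des? z (next c) (next c′)
        ... | yes q = q
        ... | no ¬q with Face-next face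
        ...   | inj₁ same = ⊥-elim (rising (subst (Des x z) same p))
        ...   | inj₂ r = ⊥-elim (rising (Des-upper⁻ (next-rk ascz v) ¬q p))
    ... | yes p = begin
      - h z S (λ c′ → φ (nothing ∷ c′) - d φz c′) c
        + (φ (just (fill x (next c) s) ∷ c) - d (λ c′ → h x (s ∷ S) φ (just z ∷ c′)) c)
        ≡⟨ cong₂ (λ a b → - a + (φ (just (fill x (next c) s) ∷ c) - b))
             (Lin-h.sub z S (φ ∘ (nothing ∷_)) (d φz) c)
             (trans (d-cong c (λ c′ face → trans (h-des x s S φ z c′ (persists face)) (negate (h z S φz c′))))
                    (Lin-d.scale (- 1ℤ) (h z S φz) c)) ⟩
      - (h z S (φ ∘ (nothing ∷_)) c - h z S (d φz) c)
        + (φ (just (fill x (next c) s) ∷ c) - - 1ℤ * d (h z S φz) c)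
        ≡⟨ cong₂ (λ a b → - (a - h z S (d φz) c) + (b - - 1ℤ * d (h z S φz) c)) dead-ins dead-fill ⟩
      - (0ℤ - h z S (d φz) c) + (0ℤ - - 1ℤ * d (h z S φz) c)
        ≡⟨ lem (h z S (d φz) c) (d (h z S φz) c) ⟩
      h z S (d φz) c + d (h z S φz) c
        ≡⟨ homotopy iz ascz pre′ v ne φz
             (λ c′ v′ abs lt → low (just z ∷ c′) (pick iz x⊑z eq v′) abs lt) ⟩
      φ (just z ∷ c) ∎
      where
      φz = φ ∘ (just z ∷_)
      ascz = Asc-at z eq asc
      pre′ = Prefix-extend ix iz x⊑z pre
      negate : ∀ p → - p ≡ - 1ℤ * p
      negate = solve-∀
      lem : ∀ p q → - (0ℤ - p) + (0ℤ - - 1ℤ * q) ≡ p + q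
      lem = solve-∀
      persists : ∀ {c′} → Face c′ c → Des x z (next c′)
      persists face with Face-next face
      ... | inj₁ same = subst (Des x z) (sym same) p
      ... | inj₂ r = Des-upper⁺ (next-isCode v) (next-isCode (Face-valid face v)) (RemFirst-⊑ r v) p
      -- Without z the inversion coming from its descent is gone, and an insertion above z does not
      -- bring it back, because by `Ins-next` the next member has still used the label a.
      dead-ins : h z S (φ ∘ (nothing ∷_)) c ≡ 0ℤ
      dead-ins = h-vanish z S c λ c″ i → low (nothing ∷ c″) (omit (Valid-weaken x⊑z (Ins-valid iz ascz i v)))
          (sym (Ins-absent i)) (lower i)
        where
        lower : ∀ {c″} → Ins z S c c″ → size (inversions J c″) < size (inversions (J ⊔ z) c)
        lower {c″} i with des b a a<b zb xb ya za ← Ins-next iz ascz v i p =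
          size-strict (λ q e → Ins-inversions iz ascz pre′ v i q (inversions-⊆ (⊔-left J z) c″ q e)) (a , b)
            (λ e → Prefix-avoids pre a b xb (inversions-later J a b v″ ya e))
            (inversions-⊇ (J ⊔ z) c (a , b)
              (⊔-right J z (a , b) (inv a<b zb za (NonMin-top (next-isCode v″) a ya))))
          where v″ = Ins-valid iz ascz i v
      -- Here z is replaced by the rising element of the same rank, which cannot invert the pair of
      -- the descent at z.
      dead-fill : φ (just (fill x (next c) s) ∷ c) ≡ 0ℤ
      dead-fill = low _ (pick F.code F.lower F.rank≡ (Valid-raise F.upper v)) refl (lower p)
        where
        vx = Valid-weaken x⊑z v
        fl = fillNext ix asc vx
        module F = Filled fl
        f = fill x (next c) s
        lower : Des x z (next c) → size (inversions (J ⊔ f) c) < size (inversions (J ⊔ z) c)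
        lower (des b a a<b zb xb ya za) = size-strict
          (λ q e → inversions-⊆ (⊔-left J z) c q
                     (inversions-absorb c (rising-absorbed {c = c} ix pre fl (next-isCode v)) q e))
          (a , b)
          (λ e → absurd (⊔-cases J f (a , b) (inversions-later (J ⊔ f) a b vx ya e)))
          (inversions-⊇ (J ⊔ z) c (a , b)
            (⊔-right J z (a , b) (inv a<b zb za (NonMin-top (next-isCode v) a ya))))
          where
          absurd : ¬ (J (a , b) ≡ true ⊎ Inverted f (a , b))
          absurd (inj₁ Jp) = Prefix-avoids pre a b xb Jp
          absurd (inj₂ (inv _ fb fa _)) = F.rising (des b a a<b fb xb ya fa)

open Chains

-- Boolean equivalence relations and permutations translated into codes.

module Relations where

  open import Data.Integer using (_+_; _*_)

  ind-iff : ∀ {P Q : Set} (P? : Dec P) (Q? : Dec Q) → (P → Q) → (Q → P) → ⌊ P? ⌋ ≡ ⌊ Q? ⌋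
  ind-iff (yes p) Q? f g = sym (yes-true Q? (f p))
  ind-iff (no ¬p) Q? f g = sym (no-false Q? (¬p ∘ g))

  ind-× : ∀ {P Q R : Set} (R? : Dec R) (P? : Dec P) (Q? : Dec Q) → (R → P) → (R → Q) → (P → Q → R) →
    ⟦ ⌊ R? ⌋ ⟧ ≡ ⟦ ⌊ P? ⌋ ⟧ * ⟦ ⌊ Q? ⌋ ⟧
  ind-× R? (yes p) (yes q) f g k = cong ⟦_⟧ (yes-true R? (k p q))
  ind-× R? (yes p) (no ¬q) f g k = cong ⟦_⟧ (no-false R? (¬q ∘ g))
  ind-× R? (no ¬p) Q? f g k = trans (cong ⟦_⟧ (no-false R? (¬p ∘ f))) (sym (ℤₚ.*-zeroˡ ⟦ ⌊ Q? ⌋ ⟧))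

  ⟦∧⟧ : ∀ a b → ⟦ a ∧ b ⟧ ≡ ⟦ a ⟧ * ⟦ b ⟧
  ⟦∧⟧ true b = sym (ℤₚ.*-identityˡ ⟦ b ⟧)
  ⟦∧⟧ false b = sym (ℤₚ.*-zeroˡ ⟦ b ⟧)

  bool-ext : ∀ {a b} → (a ≡ true → b ≡ true) → (b ≡ true → a ≡ true) → a ≡ b
  bool-ext {true} f g = sym (f refl)
  bool-ext {false} {true} f g = g refl
  bool-ext {false} {false} f g = refl

  ∧-true : ∀ {a b} → a ∧ b ≡ true → a ≡ true × b ≡ true
  ∧-true {true} {true} _ = refl , refl

  true-∧ : ∀ {a b} → a ≡ true → b ≡ true → a ∧ b ≡ true
  true-∧ refl refl = refl

  ⇒ᵇ-true : ∀ {a b} → (a ⇒ᵇ b) ≡ true → a ≡ true → b ≡ true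
  ⇒ᵇ-true {true} e refl = e

  true-⇒ᵇ : ∀ {a b} → (a ≡ true → b ≡ true) → (a ⇒ᵇ b) ≡ true
  true-⇒ᵇ {true} f = f refl
  true-⇒ᵇ {false} f = refl

  ==-true : ∀ {a b} → (a == b) ≡ true → a ≡ b
  ==-true {true} {true} _ = refl
  ==-true {false} {false} _ = refl

  true-== : ∀ {a b} → a ≡ b → (a == b) ≡ true
  true-== {true} refl = refl
  true-== {false} refl = refl

  𝕋-true : ∀ {a} → 𝕋 a → a ≡ true
  𝕋-true {true} _ = refl

  <ᵇ-true : ∀ {a b} → a < b → (a <ᵇ b) ≡ true
  <ᵇ-true a<b = 𝕋-true (ℕₚ.<⇒<ᵇ a<b)

  ∀ᵇ-true : ∀ n {p} → ∀ᵇ n p ≡ true → ∀ i → p i ≡ true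
  ∀ᵇ-true n {p} e i = go (allFin n) e (∈-allFin i)
    where
    go : ∀ xs → and (map p xs) ≡ true → i ∈ xs → p i ≡ true
    go (x ∷ xs) e (here refl) = proj₁ (∧-true e)
    go (x ∷ xs) e (there i∈) = go xs (proj₂ (∧-true {p x} e)) i∈

  true-∀ᵇ : ∀ n {p} → (∀ i → p i ≡ true) → ∀ᵇ n p ≡ true
  true-∀ᵇ n {p} all = go (allFin n)
    where
    go : ∀ xs → and (map p xs) ≡ true
    go [] = refl
    go (x ∷ xs) = true-∧ (all x) (go xs)

  length-filter-tabulate : ∀ {A : Set} {n} (p : A → Bool) (f : Fin n → A) →
    length (filterᵇ p (List.tabulate f)) ≡ card (p ∘ f)
  length-filter-tabulate {n = zero} p f = refl
  length-filter-tabulate {n = suc n} p f with p (f zero)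
  ... | true = cong suc (length-filter-tabulate p (f ∘ suc))
  ... | false = length-filter-tabulate p (f ∘ suc)

  card-not : ∀ {n} (p : Fin n → Bool) → n ∸ card (not ∘ p) ≡ card p
  card-not {n} p = trans (cong (_∸ card (not ∘ p)) (sym (total p))) (ℕₚ.m+n∸n≡m (card p) (card (not ∘ p)))
    where
    total : ∀ {n} (p : Fin n → Bool) → card p ℕ.+ card (not ∘ p) ≡ n
    total {zero} p = refl
    total {suc n} p with p zero
    ... | true = cong suc (total (p ∘ suc))
    ... | false = trans (ℕₚ.+-suc _ _) (cong suc (total (p ∘ suc)))

  -- Functions have no decidable equality, so they are compared through their tables, and being
  -- listed exactly once is expressed as a sum of indicators. In this form it can be inserted
  -- directly into other sums.
  allFuns-once : ∀ {A B : Set} (_≟B_ : (x y : B) → Dec (x ≡ y)) (code : A → B) xs →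
    (∀ b → ∑ xs (λ a → ⟦ ⌊ code a ≟B b ⌋ ⟧) ≡ 1ℤ) → ∀ n (v : Vec B n) →
    ∑ (allFuns xs n) (λ f → ⟦ ⌊ Vecₚ.≡-dec _≟B_ (tabulate (code ∘ f)) v ⌋ ⟧) ≡ 1ℤ
  allFuns-once _≟B_ code xs once zero [] = refl
  allFuns-once _≟B_ code xs once (suc n) (b ∷ v) = begin
    ∑ (allFuns xs (suc n)) (λ f → ⟦ ⌊ Vecₚ.≡-dec _≟B_ (tabulate (code ∘ f)) (b ∷ v) ⌋ ⟧)
      ≡⟨ ∑-concatMap (λ a → map (a ∷ᶠ_) (allFuns xs n)) xs _ ⟩
    ∑ xs (λ a → ∑ (map (a ∷ᶠ_) (allFuns xs n)) (λ f → ⟦ ⌊ Vecₚ.≡-dec _≟B_ (tabulate (code ∘ f)) (b ∷ v) ⌋ ⟧))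
      ≡⟨ ∑-cong xs (λ a → trans (∑-map (a ∷ᶠ_) (allFuns xs n) _) (trans
           (∑-cong (allFuns xs n) (λ f → ind-× (Vecₚ.≡-dec _≟B_ (code a ∷ tabulate (code ∘ f)) (b ∷ v))
             (code a ≟B b) (Vecₚ.≡-dec _≟B_ (tabulate (code ∘ f)) v)
             Vecₚ.∷-injectiveˡ Vecₚ.∷-injectiveʳ (cong₂ _∷_)))
           (trans (∑-* (allFuns xs n) ⟦ ⌊ code a ≟B b ⌋ ⟧ _)
             (trans (cong (⟦ ⌊ code a ≟B b ⌋ ⟧ *_) (allFuns-once _≟B_ code xs once n v)) (ℤₚ.*-identityʳ _))))) ⟩
    ∑ xs (λ a → ⟦ ⌊ code a ≟B b ⌋ ⟧)
      ≡⟨ once b ⟩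
    1ℤ ∎

  allFin-once : ∀ {n} (b : Fin n) → ∑ (allFin n) (λ a → ⟦ ⌊ a ≟ᶠ b ⌋ ⟧) ≡ 1ℤ
  allFin-once b = go id b (λ e → e)
    where
    miss : ∀ {n m} (f : Fin n → Fin m) b → (∀ i → ¬ f i ≡ b) → ∑ (List.tabulate f) (λ a → ⟦ ⌊ a ≟ᶠ b ⌋ ⟧) ≡ 0ℤ
    miss {zero} f b ne = refl
    miss {suc n} f b ne =
      cong₂ _+_ (cong ⟦_⟧ (no-false (f zero ≟ᶠ b) (ne zero))) (miss (f ∘ suc) b (ne ∘ suc))
    go : ∀ {n m} (f : Fin n → Fin m) (i : Fin n) → (∀ {i j} → f i ≡ f j → i ≡ j) →
      ∑ (List.tabulate f) (λ a → ⟦ ⌊ a ≟ᶠ f i ⌋ ⟧) ≡ 1ℤ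
    go f zero inj = cong₂ _+_ (cong ⟦_⟧ (yes-true (f zero ≟ᶠ f zero) refl))
      (miss (f ∘ suc) (f zero) λ i e → case (inj e))
      where
      case : ∀ {n} {i : Fin n} → ¬ suc i ≡ zero
      case ()
    go f (suc i) inj = cong₂ _+_ (cong ⟦_⟧ (no-false (f zero ≟ᶠ f (suc i)) (λ e → case (inj e))))
      (go (f ∘ suc) i (λ e → suc-inj (inj e)))
      where
      case : ∀ {n} {i : Fin n} → ¬ zero ≡ suc i
      case ()
      suc-inj : ∀ {n} {i j : Fin n} → suc i ≡ suc j → i ≡ j
      suc-inj refl = refl

  bools-once : ∀ b → ∑ (true ∷ false ∷ []) (λ a → ⟦ ⌊ a 𝔹ₚ.≟ b ⌋ ⟧) ≡ 1ℤ
  bools-once true = refl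
  bools-once false = refl

  -- The point w bounds the search and is returned when no smaller point satisfies p; where the
  -- function is used, w itself satisfies p.
  least : ∀ {n} → (Fin n → Bool) → Fin n → Fin n
  least p zero = zero
  least p (suc w) = if p zero then zero else suc (least (p ∘ suc) w)

  least-≤ : ∀ {n} (p : Fin n → Bool) (w : Fin n) → toℕ (least p w) ≤ toℕ w
  least-≤ p zero = z≤n
  least-≤ p (suc w) with p zero
  ... | true = z≤n
  ... | false = s≤s (least-≤ (p ∘ suc) w)

  least-true : ∀ {n} (p : Fin n → Bool) (w : Fin n) → p w ≡ true → p (least p w) ≡ true
  least-true p zero pw = pw
  least-true p (suc w) pw with p zero in eq
  ... | true = eq
  ... | false = least-true (p ∘ suc) w pw

  least-min : ∀ {n} (p : Fin n → Bool) (w u : Fin n) → p u ≡ true → toℕ (least p w) ≤ toℕ u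
  least-min p zero u pu = z≤n
  least-min p (suc w) u pu with p zero in eq
  least-min p (suc w) u pu | true = z≤n
  least-min p (suc w) (suc u) pu | false = s≤s (least-min (p ∘ suc) w u pu)
  least-min p (suc w) zero pu | false with () ← trans (sym eq) pu

  least-unique : ∀ {n} {p : Fin n → Bool} w m → p w ≡ true → p m ≡ true →
    (∀ u → p u ≡ true → toℕ m ≤ toℕ u) → least p w ≡ m
  least-unique {p = p} w m pw pm min =
    toℕ-injective (ℕₚ.≤-antisym (least-min p w m pm) (min (least p w) (least-true p w pw)))

  least-cong : ∀ {n} {p q : Fin n → Bool} w w′ → p w ≡ true → q w′ ≡ true → (∀ u → p u ≡ q u) →
    least p w ≡ least q w′
  least-cong {p = p} {q} w w′ pw qw′ p≗q = least-unique w (least q w′) pw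
    (trans (p≗q _) (least-true q w′ qw′)) (λ u pu → least-min q w′ u (trans (sym (p≗q u)) pu))

  module _ {n : ℕ} where

    record Equiv (R : Rel n) : Set where
      field
        rfl : ∀ i → R i i ≡ true
        symm : ∀ i j → R i j ≡ true → R j i ≡ true
        tran : ∀ i j l → R i j ≡ true → R j l ≡ true → R i l ≡ true
    open Equiv

    isEquivᵇ-sound : ∀ R → isEquivᵇ R ≡ true → Equiv R
    isEquivᵇ-sound R e = record
      { rfl = ∀ᵇ-true n e₁
      ; symm = λ i j → ⇒ᵇ-true (∀ᵇ-true n (∀ᵇ-true n e₂ i) j)
      ; tran = λ i j l p q → ⇒ᵇ-true (∀ᵇ-true n (∀ᵇ-true n (∀ᵇ-true n e₃ i) j) l) (true-∧ p q) }
      where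
      e₁ = proj₁ (∧-true {∀ᵇ n (λ i → R i i)} e)
      e₂₃ = proj₂ (∧-true {∀ᵇ n (λ i → R i i)} e)
      e₂ = proj₁ (∧-true {∀ᵇ n (λ i → ∀ᵇ n (λ j → R i j ⇒ᵇ R j i))} e₂₃)
      e₃ = proj₂ (∧-true {∀ᵇ n (λ i → ∀ᵇ n (λ j → R i j ⇒ᵇ R j i))} e₂₃)

    isEquivᵇ-complete : ∀ R → Equiv R → isEquivᵇ R ≡ true
    isEquivᵇ-complete R eq = true-∧ (true-∀ᵇ n (rfl eq)) (true-∧
      (true-∀ᵇ n λ i → true-∀ᵇ n λ j → true-⇒ᵇ (symm eq i j))
      (true-∀ᵇ n λ i → true-∀ᵇ n λ j → true-∀ᵇ n λ l →
        true-⇒ᵇ (λ e → tran eq i j l (proj₁ (∧-true e)) (proj₂ (∧-true {R i j} e)))))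

    partitions-Equiv : ∀ R → R ∈ partitions n → Equiv R
    partitions-Equiv R R∈ = isEquivᵇ-sound R (𝕋-true (proj₂ (∈-filter⁻ (T? ∘ isEquivᵇ) {xs = allFuns _ n} R∈)))

    code : Rel n → Code n
    code R = tabulate (λ v → least (R v) v)

    rel : Code n → Rel n
    rel z i j = ⌊ lookup z i ≟ᶠ lookup z j ⌋

    rel-true : ∀ z {i j} → lookup z i ≡ lookup z j → rel z i j ≡ true
    rel-true z {i} {j} = yes-true (lookup z i ≟ᶠ lookup z j)

    true-rel : ∀ z {i j} → rel z i j ≡ true → lookup z i ≡ lookup z j
    true-rel z {i} {j} = true-yes (lookup z i ≟ᶠ lookup z j)

    rel-Equiv : ∀ z → Equiv (rel z)
    rel-Equiv z = record
      { rfl = λ i → rel-true z {i} refl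
      ; symm = λ i j e → rel-true z (sym (true-rel z e))
      ; tran = λ i j l e f → rel-true z (trans (true-rel z {i} e) (true-rel z f)) }

    pull : (Fin n → Fin n) → Rel n → Rel n
    pull σ R i j = R (σ i) (σ j)

    pull-Equiv : ∀ σ {R} → Equiv R → Equiv (pull σ R)
    pull-Equiv σ eq = record
      { rfl = λ i → rfl eq (σ i)
      ; symm = λ i j → symm eq (σ i) (σ j)
      ; tran = λ i j l → tran eq (σ i) (σ j) (σ l) }

    module _ {R : Rel n} (eq : Equiv R) where

      rows : ∀ {i j} → R i j ≡ true → ∀ u → R i u ≡ R j u
      rows {i} {j} e u = bool-ext (λ f → tran eq j i u (symm eq i j e) f) (λ f → tran eq i j u e f)

      code-related : ∀ v → R v (lookup (code R) v) ≡ true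
      code-related v = trans (cong (R v) (Vecₚ.lookup∘tabulate _ v)) (least-true (R v) v (rfl eq v))

      code-rows : ∀ {i j} → R i j ≡ true → lookup (code R) i ≡ lookup (code R) j
      code-rows {i} {j} e = trans (Vecₚ.lookup∘tabulate _ i) (trans
        (least-cong i j (rfl eq i) (rfl eq j) (rows e)) (sym (Vecₚ.lookup∘tabulate _ j)))

      rel-code : ∀ i j → rel (code R) i j ≡ R i j
      rel-code i j = bool-ext
        (λ e → tran eq i (lookup (code R) i) j (code-related i)
          (subst (λ m → R m j ≡ true) (sym (true-rel (code R) e)) (symm eq j _ (code-related j))))
        (λ e → rel-true (code R) (code-rows e))

      code-isCode : IsCode (code R)
      code-isCode .decr v = subst (λ m → toℕ m ≤ toℕ v) (sym (Vecₚ.lookup∘tabulate _ v)) (least-≤ (R v) v)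
      code-isCode .idem v = sym (code-rows (code-related v))

    code-rel : ∀ {z} → IsCode z → code (rel z) ≡ z
    code-rel {z} iz = vec-ext λ v → trans (Vecₚ.lookup∘tabulate _ v)
      (least-unique v (lookup z v) (rel-true z {v} refl) (rel-true z (sym (idem iz v)))
        (λ u e → subst (λ m → toℕ m ≤ toℕ u) (sym (true-rel z e)) (decr iz u)))

    code-cong : ∀ {R R′ : Rel n} → Equiv R → Equiv R′ → (∀ i j → R i j ≡ R′ i j) → code R ≡ code R′
    code-cong eq eq′ ext = Vecₚ.tabulate-cong (λ v → least-cong v v (rfl eq v) (rfl eq′ v) (ext v))

    rel-injective : ∀ {z z′} → IsCode z → IsCode z′ → (∀ i j → rel z i j ≡ rel z′ i j) → z ≡ z′
    rel-injective {z} {z′} iz iz′ ext =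
      trans (sym (code-rel iz)) (trans (code-cong (rel-Equiv z) (rel-Equiv z′) ext) (code-rel iz′))

    code-min : ∀ {R} → Equiv R → ∀ i → ∀ᵇ n (λ j → (toℕ j <ᵇ toℕ i) ⇒ᵇ not (R i j)) ≡ not (nonMin (code R) i)
    code-min {R} eq i = bool-ext to from
      where
      z = code R
      iz = code-isCode eq
      to : ∀ᵇ n (λ j → (toℕ j <ᵇ toℕ i) ⇒ᵇ not (R i j)) ≡ true → not (nonMin z i) ≡ true
      to e with min? z i
      ... | yes _ = refl
      ... | no nm with () ← trans (sym (⇒ᵇ-true (∀ᵇ-true n e (lookup z i))
                    (<ᵇ-true (ℕₚ.≤∧≢⇒< (decr iz i) (nm ∘ toℕ-injective))))) (cong not (code-related eq i))
      from : not (nonMin z i) ≡ true → ∀ᵇ n (λ j → (toℕ j <ᵇ toℕ i) ⇒ᵇ not (R i j)) ≡ true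
      from e with min? z i
      ... | yes zi = true-∀ᵇ n λ j → true-⇒ᵇ λ j<i → notR j j<i
        where
        notR : ∀ j → (toℕ j <ᵇ toℕ i) ≡ true → not (R i j) ≡ true
        notR j j<i with R i j in Rij
        ... | false = refl
        ... | true = ⊥-elim (ℕₚ.<⇒≱ (ℕₚ.<ᵇ⇒< (toℕ j) (toℕ i) (subst 𝕋 (sym j<i) _))
          (subst (λ m → toℕ m ≤ toℕ j) (trans (sym (code-rows eq Rij)) zi) (decr iz j)))

    rank-code : ∀ {R} → Equiv R → rank R ≡ rk (code R)
    rank-code {R} eq = trans
      (cong (n ∸_) (trans (length-filter-tabulate (λ i → ∀ᵇ n (λ j → (toℕ j <ᵇ toℕ i) ⇒ᵇ not (R i j))) id)
                          (card-cong (code-min eq))))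
      (card-not (nonMin (code R)))

    ⊑? : ∀ (x y : Code n) → Dec (x ⊑ y)
    ⊑? x y = map′ refines at (all? (λ v → lookup y (lookup x v) ≟ᶠ lookup y v))

    ≤Π-code : ∀ {P R} → Equiv P → Equiv R → (P ≤Π R) ≡ ⌊ ⊑? (code P) (code R) ⌋
    ≤Π-code {P} {R} eP eR = bool-ext
      (λ e → yes-true (⊑? (code P) (code R)) (refines λ v → code-rows eR (symm eR v _
        (⇒ᵇ-true (∀ᵇ-true n (∀ᵇ-true n e v) (lookup (code P) v)) (code-related eP v)))))
      (λ e → true-∀ᵇ n λ i → true-∀ᵇ n λ j → true-⇒ᵇ λ Pij →
        let le = true-yes (⊑? (code P) (code R)) e in
        trans (sym (rel-code eR i j)) (rel-true (code R)
          (trans (sym (at le i)) (trans (cong (lookup (code R)) (code-rows eP Pij)) (at le j)))))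

    -- Pulling back gives a right action, see `act-∘`; consequently the operators `shift` on
    -- functions of chains form a left action.
    act : (Fin n → Fin n) → Code n → Code n
    act σ z = code (pull σ (rel z))

    _≟ᶜ_ : (x y : Code n) → Dec (x ≡ y)
    _≟ᶜ_ = Vecₚ.≡-dec _≟ᶠ_

    act-isCode : ∀ σ z → IsCode (act σ z)
    act-isCode σ z = code-isCode (pull-Equiv σ (rel-Equiv z))

    rel-act : ∀ σ z i j → rel (act σ z) i j ≡ rel z (σ i) (σ j)
    rel-act σ z = rel-code (pull-Equiv σ (rel-Equiv z))

    fixes-code : ∀ σ {R} → Equiv R → fixesᵇ σ R ≡ ⌊ act σ (code R) ≟ᶜ code R ⌋
    fixes-code σ {R} eq = bool-ext
      (λ e → yes-true (act σ (code R) ≟ᶜ code R) (rel-injective (act-isCode σ (code R)) (code-isCode eq) λ i j →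
        trans (rel-act σ (code R) i j) (trans (rel-code eq (σ i) (σ j)) (trans
          (==-true (∀ᵇ-true n (∀ᵇ-true n e i) j)) (sym (rel-code eq i j))))))
      (λ e → true-∀ᵇ n λ i → true-∀ᵇ n λ j → true-== (trans (sym (rel-code eq (σ i) (σ j)))
        (trans (sym (rel-act σ (code R) i j)) (trans
          (cong (λ z → rel z i j) (true-yes (act σ (code R) ≟ᶜ code R) e)) (rel-code eq i j)))))

    codes : List (Code n)
    codes = map code (partitions n)

    codes-isCode : ∀ z → z ∈ codes → IsCode z
    codes-isCode z z∈ with R , R∈ , refl ← ∈-map⁻ code z∈ = code-isCode (partitions-Equiv R R∈)

    codes-once : ∀ {z} → IsCode z → ∑ codes (λ w → ⟦ ⌊ w ≟ᶜ z ⌋ ⟧) ≡ 1ℤ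
    codes-once {z} iz = begin
      ∑ codes (λ w → ⟦ ⌊ w ≟ᶜ z ⌋ ⟧)
        ≡⟨ ∑-map code (partitions n) _ ⟩
      ∑ (partitions n) (λ R → ⟦ ⌊ code R ≟ᶜ z ⌋ ⟧)
        ≡⟨ ∑-filter isEquivᵇ (allFuns _ n) _ ⟩
      ∑ (allFuns _ n) (λ R → ⟦ isEquivᵇ R ⟧ * ⟦ ⌊ code R ≟ᶜ z ⌋ ⟧)
        ≡⟨ ∑-cong (allFuns _ n) (λ R → trans (sym (⟦∧⟧ (isEquivᵇ R) ⌊ code R ≟ᶜ z ⌋)) (cong ⟦_⟧ (same R))) ⟩
      ∑ (allFuns _ n) (λ R → ⟦ ⌊ table R ≟ᵗ table (rel z) ⌋ ⟧)
        ≡⟨ allFuns-once (Vecₚ.≡-dec 𝔹ₚ._≟_) tabulate (allFuns (true ∷ false ∷ []) n)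
             (allFuns-once 𝔹ₚ._≟_ id (true ∷ false ∷ []) bools-once n) n (table (rel z)) ⟩
      1ℤ ∎
      where
      table : Rel n → Vec (Vec Bool n) n
      table R = tabulate (λ i → tabulate (R i))
      _≟ᵗ_ : (s t : Vec (Vec Bool n) n) → Dec (s ≡ t)
      _≟ᵗ_ = Vecₚ.≡-dec (Vecₚ.≡-dec 𝔹ₚ._≟_)
      table-ext : ∀ {R R′} → table R ≡ table R′ → ∀ i j → R i j ≡ R′ i j
      table-ext {R} {R′} e i j = trans (sym (Vecₚ.lookup∘tabulate (R i) j)) (trans
        (cong (λ r → lookup r j) (trans (sym (Vecₚ.lookup∘tabulate (λ i → tabulate (R i)) i)) (trans (cong (λ t → lookup t i) e)
          (Vecₚ.lookup∘tabulate (λ i → tabulate (R′ i)) i))))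
        (Vecₚ.lookup∘tabulate (R′ i) j))
      same : ∀ R → isEquivᵇ R ∧ ⌊ code R ≟ᶜ z ⌋ ≡ ⌊ table R ≟ᵗ table (rel z) ⌋
      same R = bool-ext
        (λ e → let eq = isEquivᵇ-sound R (proj₁ (∧-true e)) in
          yes-true (table R ≟ᵗ table (rel z)) (Vecₚ.tabulate-cong λ i → Vecₚ.tabulate-cong λ j →
            trans (sym (rel-code eq i j)) (cong (λ w → rel w i j)
              (true-yes (code R ≟ᶜ z) (proj₂ (∧-true {isEquivᵇ R} e))))))
        (λ e → let ext = table-ext {R} {rel z} (true-yes (table R ≟ᵗ table (rel z)) e)
                   eqR = record
                     { rfl = λ i → trans (ext i i) (rfl (rel-Equiv z) i)
                     ; symm = λ i j p → trans (ext j i) (symm (rel-Equiv z) i j (trans (sym (ext i j)) p))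
                     ; tran = λ i j l p q → trans (ext i l) (tran (rel-Equiv z) i j l
                         (trans (sym (ext i j)) p) (trans (sym (ext j l)) q)) }
               in true-∧ (isEquivᵇ-complete R eqR)
                    (yes-true (code R ≟ᶜ z) (trans (code-cong eqR (rel-Equiv z) ext) (code-rel iz))))

    Perm : (Fin n → Fin n) → Set
    Perm σ = ∀ {i j} → σ i ≡ σ j → i ≡ j

    Sym-Perm : ∀ σ → σ ∈ Sym n → Perm σ
    Sym-Perm σ σ∈ {i} {j} e = true-yes (i ≟ᶠ j)
      (⇒ᵇ-true (∀ᵇ-true n (∀ᵇ-true n bij i) j) (yes-true (σ i ≟ᶠ σ j) e))
      where
      bij : isBijᵇ σ ≡ true
      bij = 𝕋-true (proj₂ (∈-filter⁻ (T? ∘ isBijᵇ) {xs = allFuns _ n} σ∈))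

    Perm-bij : ∀ σ → Perm σ → isBijᵇ σ ≡ true
    Perm-bij σ inj = true-∀ᵇ n λ i → true-∀ᵇ n λ j → true-⇒ᵇ λ e →
      yes-true (i ≟ᶠ j) (inj (true-yes (σ i ≟ᶠ σ j) e))

    surjective : ∀ {σ : Fin n → Fin n} → Perm σ → ∀ j → ∃ λ i → σ i ≡ j
    surjective {σ} inj j = go {n} {σ} inj j
      where
      go : ∀ {m} {σ : Fin m → Fin m} → (∀ {i j} → σ i ≡ σ j → i ≡ j) → ∀ j → ∃ λ i → σ i ≡ j
      go {suc m} {σ} inj j with any? (λ i → σ i ≟ᶠ j)
      ... | yes found = found
      ... | no none = ⊥-elim (ℕₚ.1+n≰n (injective⇒≤ {f = λ i → punchOut {i = j} {j = σ i} (λ e → none (i , sym e))}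
              (λ {x} {y} e → inj (punchOut-injective (λ q → none (x , sym q)) (λ q → none (y , sym q)) e))))

    inverse : ∀ {σ : Fin n → Fin n} → Perm σ → Fin n → Fin n
    inverse p j = proj₁ (surjective p j)

    inverseʳ : ∀ {σ : Fin n → Fin n} (p : Perm σ) j → σ (inverse p j) ≡ j
    inverseʳ p j = proj₂ (surjective p j)

    tabulate-ext : ∀ {σ ρ : Fin n → Fin n} → tabulate σ ≡ tabulate ρ → ∀ i → σ i ≡ ρ i
    tabulate-ext {σ} {ρ} e i =
      trans (sym (Vecₚ.lookup∘tabulate σ i)) (trans (cong (λ t → lookup t i) e) (Vecₚ.lookup∘tabulate ρ i))

    Sym-once : ∀ ρ → Perm ρ → ∑ (Sym n) (λ σ → ⟦ ⌊ tabulate σ ≟ᶜ tabulate ρ ⌋ ⟧) ≡ 1ℤ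
    Sym-once ρ p = begin
      ∑ (Sym n) (λ σ → ⟦ ⌊ tabulate σ ≟ᶜ tabulate ρ ⌋ ⟧)
        ≡⟨ ∑-filter isBijᵇ (allFuns (allFin n) n) _ ⟩
      ∑ (allFuns (allFin n) n) (λ σ → ⟦ isBijᵇ σ ⟧ * ⟦ ⌊ tabulate σ ≟ᶜ tabulate ρ ⌋ ⟧)
        ≡⟨ ∑-cong (allFuns (allFin n) n) (λ σ → trans (sym (⟦∧⟧ (isBijᵇ σ) _)) (cong ⟦_⟧ (bool-ext
             (λ e → proj₂ (∧-true {isBijᵇ σ} e)) (λ e → true-∧ (Perm-bij σ (perm σ (true-yes (_ ≟ᶜ _) e))) e)))) ⟩
      ∑ (allFuns (allFin n) n) (λ σ → ⟦ ⌊ tabulate σ ≟ᶜ tabulate ρ ⌋ ⟧)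
        ≡⟨ allFuns-once _≟ᶠ_ id (allFin n) allFin-once n (tabulate ρ) ⟩
      1ℤ ∎
      where
      perm : ∀ σ → tabulate σ ≡ tabulate ρ → Perm σ
      perm σ e {i} {j} eq = p (trans (sym (tabulate-ext e i)) (trans eq (tabulate-ext e j)))

    -- Both sides equal one double sum over the pairs (σ, ρ) with ρ = τ ∘ σ. F has to respect
    -- pointwise equality because equal tables give no more than that.
    Sym-shift : ∀ (F : (Fin n → Fin n) → ℤ) → (∀ {σ ρ} → (∀ i → σ i ≡ ρ i) → F σ ≡ F ρ) →
      ∀ τ → Perm τ → ∑ (Sym n) (λ σ → F (τ ∘ σ)) ≡ ∑ (Sym n) F
    Sym-shift F F-ext τ pτ = begin
      ∑ (Sym n) (λ σ → F (τ ∘ σ))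
        ≡⟨ ∑-cong∈ (Sym n) (λ σ σ∈ → sym (trans (∑-* (Sym n) (F (τ ∘ σ)) _)
             (trans (cong (F (τ ∘ σ) *_) (Sym-once (τ ∘ σ) (λ e → Sym-Perm σ σ∈ (pτ e)))) (ℤₚ.*-identityʳ _)))) ⟩
      ∑ (Sym n) (λ σ → ∑ (Sym n) (λ ρ → F (τ ∘ σ) * ⟦ ⌊ tabulate ρ ≟ᶜ tabulate (τ ∘ σ) ⌋ ⟧))
        ≡⟨ ∑-swap (Sym n) (Sym n) (λ σ ρ → F (τ ∘ σ) * ⟦ ⌊ tabulate ρ ≟ᶜ tabulate (τ ∘ σ) ⌋ ⟧) ⟩
      ∑ (Sym n) (λ ρ → ∑ (Sym n) (λ σ → F (τ ∘ σ) * ⟦ ⌊ tabulate ρ ≟ᶜ tabulate (τ ∘ σ) ⌋ ⟧))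
        ≡⟨ ∑-cong∈ (Sym n) (λ ρ ρ∈ → trans (∑-cong (Sym n) (λ σ → swapped σ ρ)) (trans (∑-* (Sym n) (F ρ) _)
             (trans (cong (F ρ *_) (Sym-once (inverse pτ ∘ ρ) (λ e → Sym-Perm ρ ρ∈ (unpull e)))) (ℤₚ.*-identityʳ _)))) ⟩
      ∑ (Sym n) F ∎
      where
      unpull : ∀ {i j} → inverse pτ i ≡ inverse pτ j → i ≡ j
      unpull {i} {j} e = trans (sym (inverseʳ pτ i)) (trans (cong τ e) (inverseʳ pτ j))
      swapped : ∀ σ ρ → F (τ ∘ σ) * ⟦ ⌊ tabulate ρ ≟ᶜ tabulate (τ ∘ σ) ⌋ ⟧ ≡
        F ρ * ⟦ ⌊ tabulate σ ≟ᶜ tabulate (inverse pτ ∘ ρ) ⌋ ⟧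
      swapped σ ρ with tabulate ρ ≟ᶜ tabulate (τ ∘ σ)
      ... | yes e = cong₂ _*_ (F-ext (λ i → sym (tabulate-ext e i)))
        (cong ⟦_⟧ (sym (yes-true (_ ≟ᶜ _) (Vecₚ.tabulate-cong λ i →
          pτ (trans (sym (tabulate-ext e i)) (sym (inverseʳ pτ (ρ i))))))))
      ... | no ne = trans (ℤₚ.*-zeroʳ (F (τ ∘ σ))) (sym (trans
        (cong (λ x → F ρ * ⟦ x ⟧) (no-false (_ ≟ᶜ _) λ e → ne (Vecₚ.tabulate-cong λ i →
          trans (sym (inverseʳ pτ (ρ i))) (cong τ (sym (tabulate-ext e i))))))
        (ℤₚ.*-zeroʳ (F ρ))))

open Relations

-- The character of β_S as a signed count of fixed chains.

module FixedChains where

  open import Data.Integer using (_+_; _*_; -_)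

  card-∑ : ∀ {n} (p : Fin n → Bool) → ℤ.+ card p ≡ ∑ (allFin n) (λ i → ⟦ p i ⟧)
  card-∑ p = go p id
    where
    go : ∀ {n m} (p : Fin m → Bool) (f : Fin n → Fin m) →
      ℤ.+ card (p ∘ f) ≡ ∑ (List.tabulate f) (λ i → ⟦ p i ⟧)
    go {zero} p f = refl
    go {suc n} p f with p (f zero)
    ... | true = cong (λ q → 1ℤ + q) (go p (f ∘ suc))
    ... | false = trans (go p (f ∘ suc)) (sym (ℤₚ.+-identityˡ _))

  module _ {n : ℕ} (σ : Fin n → Fin n) (z : Code n) where

    act-related : ∀ i j → lookup z (σ i) ≡ lookup z (σ j) → lookup (act σ z) i ≡ lookup (act σ z) j
    act-related i j e = true-rel (act σ z) {i} {j} (trans (rel-act σ z i j) (rel-true z {σ i} {σ j} e))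

    related-act : ∀ i j → lookup (act σ z) i ≡ lookup (act σ z) j → lookup z (σ i) ≡ lookup z (σ j)
    related-act i j e = true-rel z {σ i} {σ j} (trans (sym (rel-act σ z i j)) (rel-true (act σ z) {i} {j} e))

  module _ {n : ℕ} {σ : Fin n → Fin n} (pσ : Perm σ) {z : Code n} (iz : IsCode z) where

    private
      z′ = act σ z
      iz′ = act-isCode σ z

    -- Count pairs consisting of a block minimum i of act σ z and the minimum j of the block of σ i in z.
    act-minima : card (not ∘ nonMin z′) ≡ card (not ∘ nonMin z)
    act-minima = ℤₚ.+-injective (begin
      ℤ.+ card (not ∘ nonMin z′)
        ≡⟨ card-∑ (not ∘ nonMin z′) ⟩
      ∑ (allFin n) (λ i → m′ i)
        ≡⟨ ∑-cong (allFin n) (λ i → sym (trans (∑-* (allFin n) (m′ i) _)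
             (trans (cong (m′ i *_) (allFin-once (lookup z (σ i)))) (ℤₚ.*-identityʳ (m′ i))))) ⟩
      ∑ (allFin n) (λ i → ∑ (allFin n) (λ j → m′ i * ⟦ ⌊ j ≟ᶠ lookup z (σ i) ⌋ ⟧))
        ≡⟨ ∑-swap (allFin n) (allFin n) (λ i j → m′ i * ⟦ ⌊ j ≟ᶠ lookup z (σ i) ⌋ ⟧) ⟩
      ∑ (allFin n) (λ j → ∑ (allFin n) (λ i → m′ i * ⟦ ⌊ j ≟ᶠ lookup z (σ i) ⌋ ⟧))
        ≡⟨ ∑-cong (allFin n) (λ j → trans (∑-cong (allFin n) (λ i → pairs i j)) (trans (∑-* (allFin n) (m j) _)
             (trans (cong (m j *_) (allFin-once (rep j))) (ℤₚ.*-identityʳ (m j))))) ⟩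
      ∑ (allFin n) (λ j → m j)
        ≡⟨ card-∑ (not ∘ nonMin z) ⟨
      ℤ.+ card (not ∘ nonMin z) ∎)
      where
      m m′ : Fin n → ℤ
      m j = ⟦ not (nonMin z j) ⟧
      m′ i = ⟦ not (nonMin z′ i) ⟧
      rep : Fin n → Fin n
      rep j = lookup z′ (inverse pσ j)
      min-ind : ∀ w i → not (nonMin {n} w i) ≡ ⌊ min? w i ⌋
      min-ind w i = 𝔹ₚ.not-involutive _
      pairs : ∀ i j → m′ i * ⟦ ⌊ j ≟ᶠ lookup z (σ i) ⌋ ⟧ ≡ m j * ⟦ ⌊ i ≟ᶠ rep j ⌋ ⟧
      pairs i j = begin
        ⟦ not (nonMin z′ i) ⟧ * ⟦ ⌊ j ≟ᶠ lookup z (σ i) ⌋ ⟧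
          ≡⟨ cong (λ q → ⟦ q ⟧ * ⟦ ⌊ j ≟ᶠ lookup z (σ i) ⌋ ⟧) (min-ind z′ i) ⟩
        ⟦ ⌊ min? z′ i ⌋ ⟧ * ⟦ ⌊ j ≟ᶠ lookup z (σ i) ⌋ ⟧
          ≡⟨ ind-× (min? z′ i ×-dec (j ≟ᶠ lookup z (σ i))) (min? z′ i) (j ≟ᶠ lookup z (σ i)) proj₁ proj₂ _,_ ⟨
        ⟦ ⌊ min? z′ i ×-dec (j ≟ᶠ lookup z (σ i)) ⌋ ⟧
          ≡⟨ cong ⟦_⟧ (ind-iff (min? z′ i ×-dec (j ≟ᶠ lookup z (σ i))) (min? z j ×-dec (i ≟ᶠ rep j)) to from) ⟩
        ⟦ ⌊ min? z j ×-dec (i ≟ᶠ rep j) ⌋ ⟧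
          ≡⟨ ind-× (min? z j ×-dec (i ≟ᶠ rep j)) (min? z j) (i ≟ᶠ rep j) proj₁ proj₂ _,_ ⟩
        ⟦ ⌊ min? z j ⌋ ⟧ * ⟦ ⌊ i ≟ᶠ rep j ⌋ ⟧
          ≡⟨ cong (λ q → ⟦ q ⟧ * ⟦ ⌊ i ≟ᶠ rep j ⌋ ⟧) (min-ind z j) ⟨
        ⟦ not (nonMin z j) ⟧ * ⟦ ⌊ i ≟ᶠ rep j ⌋ ⟧ ∎
        where
        to : lookup z′ i ≡ i × j ≡ lookup z (σ i) → lookup z j ≡ j × i ≡ rep j
        to (mi , refl) = idem iz (σ i) , trans (sym mi) (act-related σ z i _
          (trans (sym (idem iz (σ i))) (cong (lookup z) (sym (inverseʳ pσ (lookup z (σ i)))))))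
        from : lookup z j ≡ j × i ≡ rep j → lookup z′ i ≡ i × j ≡ lookup z (σ i)
        from (mj , refl) = idem iz′ (inverse pσ j) , sym (trans (related-act σ z (rep j) (inverse pσ j) (idem iz′ (inverse pσ j)))
          (trans (cong (lookup z) (inverseʳ pσ j)) mj))

    act-rk : rk z′ ≡ rk z
    act-rk = trans (sym (card-not (nonMin z′))) (trans (cong (n ∸_) act-minima) (card-not (nonMin z)))

  module _ {k : ℕ} where

    private
      n : ℕ
      n = suc k

    _≟ᶜʰ_ : (c c′ : Chain {k}) → Dec (c ≡ c′)
    _≟ᶜʰ_ = Listₚ.≡-dec (Maybeₚ.≡-dec _≟ᶜ_)

    above : Code n → ℕ → Code n → Bool
    above x s z = (rk z ≡ᵇ s) ∧ ⌊ ⊑? x z ⌋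

    chains : Code n → List ℕ → List Chain
    chains x [] = [] ∷ []
    chains x (s ∷ S) = map (nothing ∷_) (chains x S) ++
      concatMap (λ z → map (just z ∷_) (chains z S)) (filterᵇ (above x s) codes)

    ∑-chains : ∀ x s S f → ∑ (chains x (s ∷ S)) f ≡ ∑ (chains x S) (f ∘ (nothing ∷_)) +
      ∑ codes (λ z → ⟦ above x s z ⟧ * ∑ (chains z S) (f ∘ (just z ∷_)))
    ∑-chains x s S f = trans (∑-++ (map (nothing ∷_) (chains x S)) _ f) (cong₂ _+_ (∑-map _ (chains x S) f)
      (trans (∑-concatMap _ (filterᵇ (above x s) codes) f)
        (trans (∑-cong (filterᵇ (above x s) codes) (λ z → ∑-map (just z ∷_) (chains z S) f))
          (∑-filter (above x s) codes _))))

    above-sound : ∀ {x s z} → above x s z ≡ true → rk z ≡ s × x ⊑ z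
    above-sound {x} {s} {z} e =
      ℕₚ.≡ᵇ⇒≡ (rk z) s (subst 𝕋 (sym (proj₁ (∧-true e))) _) , true-yes (⊑? x z) (proj₂ (∧-true {rk z ≡ᵇ s} e))

    above-complete : ∀ {x s z} → rk z ≡ s → x ⊑ z → above x s z ≡ true
    above-complete {x} {s} {z} eq x⊑z = true-∧ (𝕋-true (ℕₚ.≡⇒≡ᵇ (rk z) s eq)) (yes-true (⊑? x z) x⊑z)

    chains-valid : ∀ x S c → c ∈ chains x S → Valid x S c
    chains-valid x [] c (here refl) = []
    chains-valid x (s ∷ S) c c∈ with ∈-++⁻ (map (nothing ∷_) (chains x S)) c∈
    ... | inj₁ p with c′ , c′∈ , refl ← ∈-map⁻ (nothing ∷_) p = omit (chains-valid x S c′ c′∈)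
    ... | inj₂ p with z , z∈ , q ← find (∈-concatMap⁻ (λ z → map (just z ∷_) (chains z S)) {xs = filterᵇ (above x s) codes} p)
        with c′ , c′∈ , refl ← ∈-map⁻ (just z ∷_) q
        with z∈codes , ab ← ∈-filter⁻ (T? ∘ above x s) {xs = codes} z∈
        with eq , x⊑z ← above-sound {x} {s} {z} (𝕋-true ab) =
      pick (codes-isCode z z∈codes) x⊑z eq (chains-valid z S c′ c′∈)

    -- This makes the indicators of valid chains a basis; it is the source of the hypothesis `δ-sum`
    -- of `Operators`.
    chains-once : ∀ {x S c} → Valid x S c → ∑ (chains x S) (λ c′ → ⟦ ⌊ c′ ≟ᶜʰ c ⌋ ⟧) ≡ 1ℤ
    chains-once [] = refl
    chains-once {x} {s ∷ S} {nothing ∷ c} (omit v) = begin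
      ∑ (chains x (s ∷ S)) (λ c′ → ⟦ ⌊ c′ ≟ᶜʰ (nothing ∷ c) ⌋ ⟧)
        ≡⟨ ∑-chains x s S _ ⟩
      ∑ (chains x S) (λ c′ → ⟦ ⌊ (nothing ∷ c′) ≟ᶜʰ (nothing ∷ c) ⌋ ⟧) +
        ∑ codes (λ z → ⟦ above x s z ⟧ * ∑ (chains z S) (λ c′ → ⟦ ⌊ (just z ∷ c′) ≟ᶜʰ (nothing ∷ c) ⌋ ⟧))
        ≡⟨ cong₂ _+_
             (∑-cong (chains x S) (λ c′ → cong ⟦_⟧ (ind-iff ((nothing ∷ c′) ≟ᶜʰ (nothing ∷ c)) (c′ ≟ᶜʰ c)
               Listₚ.∷-injectiveʳ (cong (nothing ∷_)))))
             (∑-zero∈ codes (λ z _ → trans (cong (⟦ above x s z ⟧ *_) (∑-zero∈ (chains z S)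
               (λ c′ _ → cong ⟦_⟧ (no-false ((just z ∷ c′) ≟ᶜʰ (nothing ∷ c)) λ ())))) (ℤₚ.*-zeroʳ ⟦ above x s z ⟧))) ⟩
      ∑ (chains x S) (λ c′ → ⟦ ⌊ c′ ≟ᶜʰ c ⌋ ⟧) + 0ℤ
        ≡⟨ trans (ℤₚ.+-identityʳ _) (chains-once v) ⟩
      1ℤ ∎
    chains-once {x} {s ∷ S} {just z ∷ c} (pick iz x⊑z eq v) = begin
      ∑ (chains x (s ∷ S)) (λ c′ → ⟦ ⌊ c′ ≟ᶜʰ (just z ∷ c) ⌋ ⟧)
        ≡⟨ ∑-chains x s S _ ⟩
      ∑ (chains x S) (λ c′ → ⟦ ⌊ (nothing ∷ c′) ≟ᶜʰ (just z ∷ c) ⌋ ⟧) +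
        ∑ codes (λ w → ⟦ above x s w ⟧ * ∑ (chains w S) (λ c′ → ⟦ ⌊ (just w ∷ c′) ≟ᶜʰ (just z ∷ c) ⌋ ⟧))
        ≡⟨ cong₂ _+_
             (∑-zero∈ (chains x S) (λ c′ _ → cong ⟦_⟧ (no-false ((nothing ∷ c′) ≟ᶜʰ (just z ∷ c)) λ ())))
             (∑-cong codes term) ⟩
      0ℤ + ∑ codes (λ w → ⟦ ⌊ w ≟ᶜ z ⌋ ⟧)
        ≡⟨ trans (ℤₚ.+-identityˡ _) (codes-once iz) ⟩
      1ℤ ∎
      where
      term : ∀ w → ⟦ above x s w ⟧ * ∑ (chains w S) (λ c′ → ⟦ ⌊ (just w ∷ c′) ≟ᶜʰ (just z ∷ c) ⌋ ⟧) ≡ ⟦ ⌊ w ≟ᶜ z ⌋ ⟧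
      term w = trans (cong (⟦ above x s w ⟧ *_) (trans
          (∑-cong (chains w S) (λ c′ → ind-× ((just w ∷ c′) ≟ᶜʰ (just z ∷ c)) (w ≟ᶜ z) (c′ ≟ᶜʰ c)
            (Maybeₚ.just-injective ∘ Listₚ.∷-injectiveˡ) Listₚ.∷-injectiveʳ (λ { refl refl → refl })))
          (∑-* (chains w S) ⟦ ⌊ w ≟ᶜ z ⌋ ⟧ _)))
        (cases (w ≟ᶜ z))
        where
        cases : (w≟z : Dec (w ≡ z)) →
          ⟦ above x s w ⟧ * (⟦ ⌊ w≟z ⌋ ⟧ * ∑ (chains w S) (λ c′ → ⟦ ⌊ c′ ≟ᶜʰ c ⌋ ⟧)) ≡ ⟦ ⌊ w≟z ⌋ ⟧
        cases (yes refl) = cong₂ (λ p q → ⟦ p ⟧ * (1ℤ * q)) (above-complete {x} {s} {z} eq x⊑z) (chains-once v)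
        cases (no _) = trans (cong (⟦ above x s w ⟧ *_) (ℤₚ.*-zeroˡ (∑ (chains w S) (λ c′ → ⟦ ⌊ c′ ≟ᶜʰ c ⌋ ⟧)))) (ℤₚ.*-zeroʳ ⟦ above x s w ⟧)

    valid-chains : ∀ {x S c} → Valid x S c → c ∈ chains x S
    valid-chains {x} {S} {c} v with anyNonzero (chains x S) (λ c′ → ⟦ ⌊ c′ ≟ᶜʰ c ⌋ ⟧)
    ... | inj₁ (c′ , c′∈ , ne) with c′ ≟ᶜʰ c
    ...   | yes refl = c′∈
    ...   | no _ = ⊥-elim (ne refl)
    valid-chains {x} {S} {c} v | inj₂ all0 with () ← trans (sym (chains-once v)) (∑-zero∈ (chains x S) all0)

    actC : (Fin n → Fin n) → Chain → Chain
    actC σ = map (Maybe.map (act σ))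

    act-mono : ∀ (σ : Fin n → Fin n) {x z} → IsCode x → x ⊑ z → act σ x ⊑ act σ z
    act-mono σ {x} {z} ix x⊑z .at v = act-related σ z m v (trans (sym (at x⊑z (σ m)))
      (trans (cong (lookup z) (related-act σ x m v (idem (act-isCode σ x) v))) (at x⊑z (σ v))))
      where m = lookup (act σ x) v

    actC-valid : ∀ {σ : Fin n → Fin n} → Perm σ → ∀ {x S c} → IsCode x → Valid x S c → Valid (act σ x) S (actC σ c)
    actC-valid pσ ix [] = []
    actC-valid pσ ix (omit v) = omit (actC-valid pσ ix v)
    actC-valid {σ} pσ ix (pick {z = z} iz x⊑z eq v) =
      pick (act-isCode σ z) (act-mono σ ix x⊑z) (trans (act-rk pσ iz) eq) (actC-valid pσ iz v)

    actC-absent : ∀ (σ : Fin n → Fin n) c → absent (actC σ c) ≡ absent c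
    actC-absent σ [] = refl
    actC-absent σ (nothing ∷ c) = cong suc (actC-absent σ c)
    actC-absent σ (just z ∷ c) = actC-absent σ c

    act-ext : ∀ {σ ρ : Fin n → Fin n} → (∀ i → σ i ≡ ρ i) → ∀ z → act σ z ≡ act ρ z
    act-ext {σ} {ρ} e z = code-cong (pull-Equiv σ (rel-Equiv z)) (pull-Equiv ρ (rel-Equiv z))
      (λ i j → cong₂ (rel z) (e i) (e j))

    act-∘ : ∀ (σ ρ : Fin n → Fin n) z → act σ (act ρ z) ≡ act (ρ ∘ σ) z
    act-∘ σ ρ z = code-cong (pull-Equiv σ (rel-Equiv (act ρ z))) (pull-Equiv (ρ ∘ σ) (rel-Equiv z))
      (λ i j → rel-act ρ z (σ i) (σ j))

    actC-ext : ∀ {σ ρ : Fin n → Fin n} → (∀ i → σ i ≡ ρ i) → ∀ c → actC σ c ≡ actC ρ c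
    actC-ext e [] = refl
    actC-ext e (nothing ∷ c) = cong (nothing ∷_) (actC-ext e c)
    actC-ext e (just z ∷ c) = cong₂ (λ w c → just w ∷ c) (act-ext e z) (actC-ext e c)

    actC-∘ : ∀ (σ ρ : Fin n → Fin n) c → actC σ (actC ρ c) ≡ actC (ρ ∘ σ) c
    actC-∘ σ ρ [] = refl
    actC-∘ σ ρ (nothing ∷ c) = cong (nothing ∷_) (actC-∘ σ ρ c)
    actC-∘ σ ρ (just z ∷ c) = cong₂ (λ w c → just w ∷ c) (act-∘ σ ρ z) (actC-∘ σ ρ c)

    -- For a chain with rank set T this is the sign of |S - T| in β_S, used as the grading of the
    -- supertrace.
    sgn : Chain {k} → ℤ
    sgn [] = 1ℤ
    sgn (nothing ∷ c) = - sgn c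
    sgn (just z ∷ c) = sgn c

  ∑-foldr : ∀ {A : Set} (xs : List A) f → foldr ℤ._+_ (ℤ.+ 0) (map f xs) ≡ ∑ xs f
  ∑-foldr [] f = refl
  ∑-foldr (x ∷ xs) f = cong (f x +_) (∑-foldr xs f)

  sum-∑ : ∀ {A : Set} (f : A → ℕ) xs → ℤ.+ sum (map f xs) ≡ ∑ xs (λ x → ℤ.+ f x)
  sum-∑ f [] = refl
  sum-∑ f (x ∷ xs) = trans (ℤₚ.pos-+ (f x) (sum (map f xs))) (cong (ℤ.+ f x +_) (sum-∑ f xs))

  sum-filter-∑ : ∀ {A : Set} (f : A → ℕ) p xs → ℤ.+ sum (map f (filterᵇ p xs)) ≡ ∑ xs (λ x → ⟦ p x ⟧ * ℤ.+ f x)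
  sum-filter-∑ f p xs = trans (sum-∑ f (filterᵇ p xs)) (∑-filter p xs (λ x → ℤ.+ f x))

  sublists-length : ∀ S T → T ∈ sublists S → length T ≤ length S
  sublists-length [] T (here refl) = z≤n
  sublists-length (s ∷ S) T T∈ with ∈-++⁻ (map (s ∷_) (sublists S)) T∈
  ... | inj₁ p with T′ , T′∈ , refl ← ∈-map⁻ (s ∷_) p = s≤s (sublists-length S T′ T′∈)
  ... | inj₂ p = ℕₚ.m≤n⇒m≤1+n (sublists-length S T p)

  module _ {k : ℕ} (σ : Fin (suc k) → Fin (suc k)) where

    private
      n : ℕ
      n = suc k

    -- The character counts chains with no member below the first one, while `chains` starts from a
    -- given code; this matches the two conventions.
    data Previous : Maybe (Rel n) → Code n → Set where
      none : Previous nothing bot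
      some : ∀ {P} → Equiv P → Previous (just P) (code P)

    fixedAbove : Code n → ℕ → Rel n → Bool
    fixedAbove x s R = (rk (code R) ≡ᵇ s) ∧ ⌊ act σ (code R) ≟ᶜ code R ⌋ ∧ ⌊ ⊑? x (code R) ⌋

    fixedChains-step : ∀ {prev x} → Previous prev x → ∀ s T →
      ℤ.+ fixedChainsFrom σ prev (s ∷ T) ≡
      ∑ (partitions n) (λ R → ⟦ fixedAbove x s R ⟧ * ℤ.+ fixedChainsFrom σ (just R) T)
    fixedChains-step {x = x} none s T = trans
      (sum-filter-∑ (λ R → fixedChainsFrom σ (just R) T) _ (partitions n))
      (∑-cong∈ (partitions n) λ R R∈ →
        cong (λ q → ⟦ q ⟧ * ℤ.+ fixedChainsFrom σ (just R) T) (test R (partitions-Equiv R R∈)))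
      where
      test : ∀ R → Equiv R → (rank R ≡ᵇ s) ∧ fixesᵇ σ R ∧ true ≡ fixedAbove x s R
      test R eq = cong₂ _∧_ (cong (_≡ᵇ s) (rank-code eq))
        (cong₂ _∧_ (fixes-code σ eq) (sym (yes-true (⊑? bot (code R)) (⊑-bot (code R)))))
    fixedChains-step {x = x} (some {P} eP) s T = trans
      (sum-filter-∑ (λ R → fixedChainsFrom σ (just R) T) _ (partitions n))
      (∑-cong∈ (partitions n) λ R R∈ →
        cong (λ q → ⟦ q ⟧ * ℤ.+ fixedChainsFrom σ (just R) T) (test R (partitions-Equiv R R∈)))
      where
      test : ∀ R → Equiv R → (rank R ≡ᵇ s) ∧ fixesᵇ σ R ∧ (P ≤Π R) ≡ fixedAbove x s R
      test R eq = cong₂ _∧_ (cong (_≡ᵇ s) (rank-code eq)) (cong₂ _∧_ (fixes-code σ eq) (≤Π-code eP eq))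

    -- The supertrace of the permutation operator of σ on functions of chains.
    signedFixed : Code n → List ℕ → ℤ
    signedFixed x S = ∑ (chains x S) (λ c → sgn c * ⟦ ⌊ actC σ c ≟ᶜʰ c ⌋ ⟧)

    signedFixed-∷ : ∀ x s S → signedFixed x (s ∷ S) ≡
      ∑ (partitions n) (λ R → ⟦ fixedAbove x s R ⟧ * signedFixed (code R) S) + - signedFixed x S
    signedFixed-∷ x s S = trans (∑-chains x s S _) (trans (cong₂ _+_
      (trans (∑-cong (chains x S) omitted)
        (trans (∑-* (chains x S) (- 1ℤ) (λ c → sgn c * ⟦ ⌊ actC σ c ≟ᶜʰ c ⌋ ⟧)) (neg (signedFixed x S))))
      (trans (∑-cong codes (λ z → trans (cong (⟦ above x s z ⟧ *_) (trans (∑-cong (chains z S) (picked z))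
                                          (∑-* (chains z S) ⟦ ⌊ act σ z ≟ᶜ z ⌋ ⟧ _)))
                                  (regroup z)))
             (∑-map code (partitions n) _)))
      (ℤₚ.+-comm (- signedFixed x S) (∑ (partitions n) (λ R → ⟦ fixedAbove x s R ⟧ * signedFixed (code R) S))))
      where
      neg : ∀ a → - 1ℤ * a ≡ - a
      neg = solve-∀
      omitted : ∀ c → - sgn c * ⟦ ⌊ actC σ (nothing ∷ c) ≟ᶜʰ (nothing ∷ c) ⌋ ⟧ ≡ - 1ℤ * (sgn c * ⟦ ⌊ actC σ c ≟ᶜʰ c ⌋ ⟧)
      omitted c = trans (cong (λ q → - sgn c * ⟦ q ⟧) (ind-iff (actC σ (nothing ∷ c) ≟ᶜʰ (nothing ∷ c)) (actC σ c ≟ᶜʰ c)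
        Listₚ.∷-injectiveʳ (cong (nothing ∷_)))) (lem (sgn c) ⟦ ⌊ actC σ c ≟ᶜʰ c ⌋ ⟧)
        where
        lem : ∀ a b → - a * b ≡ - 1ℤ * (a * b)
        lem = solve-∀
      picked : ∀ z c → sgn c * ⟦ ⌊ actC σ (just z ∷ c) ≟ᶜʰ (just z ∷ c) ⌋ ⟧ ≡
        ⟦ ⌊ act σ z ≟ᶜ z ⌋ ⟧ * (sgn c * ⟦ ⌊ actC σ c ≟ᶜʰ c ⌋ ⟧)
      picked z c = trans (cong (sgn c *_) (ind-× (actC σ (just z ∷ c) ≟ᶜʰ (just z ∷ c)) (act σ z ≟ᶜ z) (actC σ c ≟ᶜʰ c)
        (Maybeₚ.just-injective ∘ Listₚ.∷-injectiveˡ) Listₚ.∷-injectiveʳ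
        (cong₂ (λ w c → just w ∷ c)))) (lem (sgn c) ⟦ ⌊ act σ z ≟ᶜ z ⌋ ⟧ ⟦ ⌊ actC σ c ≟ᶜʰ c ⌋ ⟧)
        where
        lem : ∀ a b c → a * (b * c) ≡ b * (a * c)
        lem = solve-∀
      regroup : ∀ z → ⟦ above x s z ⟧ * (⟦ ⌊ act σ z ≟ᶜ z ⌋ ⟧ * signedFixed z S) ≡
        ⟦ (rk z ≡ᵇ s) ∧ ⌊ act σ z ≟ᶜ z ⌋ ∧ ⌊ ⊑? x z ⌋ ⟧ * signedFixed z S
      regroup z = trans (cong (_* (⟦ ⌊ act σ z ≟ᶜ z ⌋ ⟧ * signedFixed z S)) (⟦∧⟧ (rk z ≡ᵇ s) ⌊ ⊑? x z ⌋))
        (trans (lem ⟦ rk z ≡ᵇ s ⟧ ⟦ ⌊ ⊑? x z ⌋ ⟧ ⟦ ⌊ act σ z ≟ᶜ z ⌋ ⟧ (signedFixed z S))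
          (cong (_* signedFixed z S) (sym (trans (⟦∧⟧ (rk z ≡ᵇ s) _) (cong (⟦ rk z ≡ᵇ s ⟧ *_) (⟦∧⟧ ⌊ act σ z ≟ᶜ z ⌋ _))))))
        where
        lem : ∀ a b c f → a * b * (c * f) ≡ a * (c * b) * f
        lem = solve-∀

    -- Both sides obey the same recursion in the first rank s: sublists with s correspond to chains
    -- with a member of rank s, and leaving s out costs a sign.
    alternating-fixed : ∀ S {prev x} → Previous prev x →
      ∑ (sublists S) (λ T → sign (length S ∸ length T) * ℤ.+ fixedChainsFrom σ prev T) ≡ signedFixed x S
    alternating-fixed [] p = refl
    alternating-fixed (s ∷ S) {prev} {x} p = begin
      ∑ (sublists (s ∷ S)) (λ T → sign (length (s ∷ S) ∸ length T) * ℤ.+ fixedChainsFrom σ prev T)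
        ≡⟨ trans (∑-++ (map (s ∷_) (sublists S)) (sublists S) _) (cong₂ _+_ (∑-map (s ∷_) (sublists S) _) refl) ⟩
      ∑ (sublists S) (λ T → sign (length S ∸ length T) * ℤ.+ fixedChainsFrom σ prev (s ∷ T)) +
        ∑ (sublists S) (λ T → sign (suc (length S) ∸ length T) * ℤ.+ fixedChainsFrom σ prev T)
        ≡⟨ cong₂ _+_ picked omitted ⟩
      ∑ (partitions n) (λ R → ⟦ fixedAbove x s R ⟧ * signedFixed (code R) S) + - signedFixed x S
        ≡⟨ signedFixed-∷ x s S ⟨
      signedFixed x (s ∷ S) ∎
      where
      picked : ∑ (sublists S) (λ T → sign (length S ∸ length T) * ℤ.+ fixedChainsFrom σ prev (s ∷ T)) ≡
        ∑ (partitions n) (λ R → ⟦ fixedAbove x s R ⟧ * signedFixed (code R) S)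
      picked = begin
        ∑ (sublists S) (λ T → sg T * ℤ.+ fixedChainsFrom σ prev (s ∷ T))
          ≡⟨ ∑-cong (sublists S) (λ T → trans (cong (sg T *_) (fixedChains-step p s T)) (sym (∑-* (partitions n) (sg T) _))) ⟩
        ∑ (sublists S) (λ T → ∑ (partitions n) (λ R → sg T * (⟦ fixedAbove x s R ⟧ * ℤ.+ fixedChainsFrom σ (just R) T)))
          ≡⟨ ∑-swap (sublists S) (partitions n) (λ T R → sg T * (⟦ fixedAbove x s R ⟧ * ℤ.+ fixedChainsFrom σ (just R) T)) ⟩
        ∑ (partitions n) (λ R → ∑ (sublists S) (λ T → sg T * (⟦ fixedAbove x s R ⟧ * ℤ.+ fixedChainsFrom σ (just R) T)))
          ≡⟨ ∑-cong∈ (partitions n) (λ R R∈ → trans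
               (∑-cong (sublists S) (λ T → lem (sg T) ⟦ fixedAbove x s R ⟧ (ℤ.+ fixedChainsFrom σ (just R) T)))
               (trans (∑-* (sublists S) ⟦ fixedAbove x s R ⟧ _)
                 (cong (⟦ fixedAbove x s R ⟧ *_) (alternating-fixed S (some (partitions-Equiv R R∈)))))) ⟩
        ∑ (partitions n) (λ R → ⟦ fixedAbove x s R ⟧ * signedFixed (code R) S) ∎
        where
        sg : List ℕ → ℤ
        sg T = sign (length S ∸ length T)
        lem : ∀ a b c → a * (b * c) ≡ b * (a * c)
        lem = solve-∀
      omitted : ∑ (sublists S) (λ T → sign (suc (length S) ∸ length T) * ℤ.+ fixedChainsFrom σ prev T) ≡ - signedFixed x S
      omitted = trans (∑-cong∈ (sublists S) (λ T T∈ → trans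
          (cong (λ q → sign q * ℤ.+ fixedChainsFrom σ prev T) (ℕₚ.+-∸-assoc 1 (sublists-length S T T∈)))
          (lem (sign (length S ∸ length T)) _)))
        (trans (∑-* (sublists S) (- 1ℤ) _) (trans (cong (- 1ℤ *_) (alternating-fixed S p)) (neg _)))
        where
        lem : ∀ a b → - a * b ≡ - 1ℤ * (a * b)
        lem = solve-∀
        neg : ∀ a → - 1ℤ * a ≡ - a
        neg = solve-∀

    χβ-signedFixed : ∀ S → χβ σ S ≡ signedFixed bot S
    χβ-signedFixed S = trans (∑-foldr (sublists S) _) (alternating-fixed S none)

open FixedChains

-- Projection to full chains and summation over the symmetric group.

module Multiplicity where

  open import Data.Integer using (_+_; _*_; -_; _-_)

  module _ {k : ℕ} where

    private
      n : ℕ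
      n = suc k

    Cochain : Set
    Cochain = Chain {k} → ℤ

    shift : (Fin n → Fin n) → Cochain → Cochain
    shift σ φ c = φ (actC σ c)

    signed : Cochain → Cochain
    signed φ c = sgn c * φ c

    d-shift : ∀ (σ : Fin n → Fin n) (φ : Cochain) c → d (shift σ φ) c ≡ shift σ (d φ) c
    d-shift σ φ [] = refl
    d-shift σ φ (nothing ∷ c) = d-shift σ (φ ∘ (nothing ∷_)) c
    d-shift σ φ (just z ∷ c) = cong (λ q → φ (nothing ∷ actC σ c) - q) (d-shift σ (φ ∘ (just (act σ z) ∷_)) c)

    d-signed : ∀ (φ : Cochain) c → d (signed φ) c ≡ - signed (d φ) c
    d-signed φ [] = refl
    d-signed φ (nothing ∷ c) = begin
      d (λ c′ → - sgn c′ * φ₀ c′) c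
        ≡⟨ d-cong c (λ c′ _ → lem₁ (sgn c′) (φ₀ c′)) ⟩
      d (λ c′ → - 1ℤ * signed φ₀ c′) c
        ≡⟨ trans (Lin-d.scale (- 1ℤ) (signed φ₀) c) (cong (- 1ℤ *_) (d-signed φ₀ c)) ⟩
      - 1ℤ * - (sgn c * d φ₀ c)
        ≡⟨ lem₂ (sgn c) (d φ₀ c) ⟩
      - (- sgn c * d φ₀ c) ∎
      where
      φ₀ = φ ∘ (nothing ∷_)
      lem₁ : ∀ a b → - a * b ≡ - 1ℤ * (a * b)
      lem₁ = solve-∀
      lem₂ : ∀ a b → - 1ℤ * - (a * b) ≡ - (- a * b)
      lem₂ = solve-∀
    d-signed φ (just z ∷ c) = trans (cong (λ q → - sgn c * φ (nothing ∷ c) - q) (d-signed (φ ∘ (just z ∷_)) c))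
      (lem (sgn c) (φ (nothing ∷ c)) (d (φ ∘ (just z ∷_)) c))
      where
      lem : ∀ a p q → - a * p - - (a * q) ≡ - (a * (p - q))
      lem = solve-∀

    sgn-full : ∀ (c : Chain {k}) → absent c ≡ 0 → sgn c ≡ 1ℤ
    sgn-full [] _ = refl
    sgn-full (just z ∷ c) e = sgn-full c e

    h-full : ∀ (x : Code n) S (φ : Cochain) c → absent c ≡ 0 → h x S φ c ≡ 0ℤ
    h-full x [] φ c e = refl
    h-full x (s ∷ S) φ [] e = refl
    h-full x (s ∷ S) φ (just z ∷ c) e with Des? x z (next c)
    ... | yes _ = cong -_ (h-full z S (φ ∘ (just z ∷_)) c e)
    ... | no _ = refl

    module Projection (S : List ℕ) (asc : Asc {k} (rk (bot {k})) S) where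

      L : List (Chain {k})
      L = chains bot S

      H : Cochain → Cochain
      H = h bot S

      N : Cochain → Cochain
      N φ c = φ c - (H (d φ) c + d (H φ) c)

      iterate : ℕ → Cochain → Cochain
      iterate zero φ = φ
      iterate (suc m) φ = N (iterate m φ)

      J₀ : PairSet {k}
      J₀ _ = false

      prefix₀ : Prefix bot J₀
      prefix₀ = record { contains = λ { _ (inv _ nb _ _) → ⊥-elim (nb (bot-min _)) } ; bounded = λ a b () }

      -- By `homotopy`, one more application of N kills the value at c once the values at chains
      -- with fewer inversions are zero; m applications therefore reach all chains with fewer than m
      -- inversions.
      iterate-vanish : ∀ m φ c → Valid bot S c → ¬ absent c ≡ 0 → size (inversions J₀ c) < m → iterate m φ c ≡ 0ℤ
      iterate-vanish (suc m) φ c v ne (s≤s le) = trans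
        (cong (λ q → iterate m φ c - q) (homotopy bot-isCode asc prefix₀ v ne (iterate m φ)
          (λ c′ v′ abs lt → iterate-vanish m φ c′ v′ (ne ∘ trans (sym abs)) (ℕₚ.<-≤-trans lt le))))
        (lem (iterate m φ c))
        where
        lem : ∀ a → a - a ≡ 0ℤ
        lem = solve-∀

      -- There are n² pairs of points, so this exceeds every number of inversions.
      bound : ℕ
      bound = suc (n ℕ.* n)

      P : Cochain → Cochain
      P = iterate bound

      P-nonfull : ∀ φ c → c ∈ L → ¬ absent c ≡ 0 → P φ c ≡ 0ℤ
      P-nonfull φ c c∈ ne = iterate-vanish bound φ c (chains-valid bot S c c∈) ne (s≤s (card≤n (inversions J₀ c ∘ remQuot n)))

      N-cong : ∀ {φ ψ} → (∀ c → φ c ≡ ψ c) → ∀ c → N φ c ≡ N ψ c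
      N-cong eq c = cong₂ _-_ (eq c) (cong₂ _+_
        (h-cong bot S c (λ c′ _ → d-cong c′ (λ c″ _ → eq c″))) (d-cong c (λ c′ _ → h-cong bot S c′ (λ c″ _ → eq c″))))

      iterate-cong : ∀ m {φ ψ} → (∀ c → φ c ≡ ψ c) → ∀ c → iterate m φ c ≡ iterate m ψ c
      iterate-cong zero eq = eq
      iterate-cong (suc m) eq = N-cong (iterate-cong m eq)

      N-d : ∀ φ c → N (d φ) c ≡ d (N φ) c
      N-d φ c = begin
        d φ c - (H (d (d φ)) c + d (H (d φ)) c)
          ≡⟨ cong (λ q → d φ c - (q + d (H (d φ)) c)) (h-vanish bot S c (λ c′ _ → d-d φ c′)) ⟩
        d φ c - (0ℤ + d (H (d φ)) c)
          ≡⟨ lem (d φ c) (d (H (d φ)) c) ⟩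
        d φ c - (d (H (d φ)) c + 0ℤ)
          ≡⟨ cong (λ q → d φ c - (d (H (d φ)) c + q)) (d-d (H φ) c) ⟨
        d φ c - (d (H (d φ)) c + d (d (H φ)) c)
          ≡⟨ cong (λ q → d φ c - q) (Lin-d.add (H (d φ)) (d (H φ)) c) ⟨
        d φ c - d (λ c′ → H (d φ) c′ + d (H φ) c′) c
          ≡⟨ Lin-d.sub φ (λ c′ → H (d φ) c′ + d (H φ) c′) c ⟨
        d (N φ) c ∎
        where
        lem : ∀ a b → a - (0ℤ + b) ≡ a - (b + 0ℤ)
        lem = solve-∀

      iterate-d : ∀ m φ c → iterate m (d φ) c ≡ d (iterate m φ) c
      iterate-d zero φ c = refl
      iterate-d (suc m) φ c = trans (N-cong (iterate-d m φ) c) (N-d (iterate m φ) c)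

      chains-δ : ∀ c → c ∈ L → ∀ (f : Cochain) → ∑ L (λ c′ → f c′ * ⟦ ⌊ c′ ≟ᶜʰ c ⌋ ⟧) ≡ f c
      chains-δ c c∈ f = trans (∑-cong L pointwise)
        (trans (∑-* L (f c) _) (trans (cong (f c *_) (chains-once (chains-valid bot S c c∈))) (ℤₚ.*-identityʳ (f c))))
        where
        pointwise : ∀ c′ → f c′ * ⟦ ⌊ c′ ≟ᶜʰ c ⌋ ⟧ ≡ f c * ⟦ ⌊ c′ ≟ᶜʰ c ⌋ ⟧
        pointwise c′ with c′ ≟ᶜʰ c
        ... | yes refl = refl
        ... | no _ = trans (ℤₚ.*-zeroʳ (f c′)) (sym (ℤₚ.*-zeroʳ (f c)))

      open Operators _≟ᶜʰ_ L chains-δ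
      open IsOp

      d-op : IsOp d
      d-op .local eq c c∈ = d-cong c (λ c′ f → eq c′ (valid-chains (Face-valid f (chains-valid bot S c c∈))))
      d-op .add φ ψ c _ = Lin-d.add φ ψ c
      d-op .scale a φ c _ = Lin-d.scale a φ c

      H-op : IsOp H
      H-op .local eq c c∈ = h-cong bot S c
        (λ c′ i → eq c′ (valid-chains (Ins-valid bot-isCode asc i (chains-valid bot S c c∈))))
      H-op .add φ ψ c _ = Lin-h.add bot S φ ψ c
      H-op .scale a φ c _ = Lin-h.scale bot S a φ c

      signed-op : IsOp signed
      signed-op .local eq c c∈ = cong (sgn c *_) (eq c c∈)
      signed-op .add φ ψ c _ = ℤₚ.*-distribˡ-+ (sgn c) (φ c) (ψ c)
      signed-op .scale a φ c _ = lem (sgn c) a (φ c)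
        where
        lem : ∀ s a p → s * (a * p) ≡ a * (s * p)
        lem = solve-∀

      shift∈ : ∀ {σ} → Perm σ → ∀ c → c ∈ L → actC σ c ∈ L
      shift∈ pσ c c∈ =
        valid-chains (Valid-weaken (⊑-bot _) (actC-valid pσ bot-isCode (chains-valid bot S c c∈)))

      shift-op : ∀ {σ} → Perm σ → IsOp (shift σ)
      shift-op pσ .local eq c c∈ = eq _ (shift∈ pσ c c∈)
      shift-op pσ .add φ ψ c _ = refl
      shift-op pσ .scale a φ c _ = refl

      N-op : IsOp N
      N-op .local eq c c∈ = cong₂ _-_ (eq c c∈)
        (cong₂ _+_ (local (H-op ∘ₒ d-op) eq c c∈) (local (d-op ∘ₒ H-op) eq c c∈))
      N-op .add φ ψ c c∈ = trans (cong₂ (λ p q → φ c + ψ c - (p + q))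
          (add (H-op ∘ₒ d-op) φ ψ c c∈) (add (d-op ∘ₒ H-op) φ ψ c c∈))
        (lem (φ c) (ψ c) (H (d φ) c) (H (d ψ) c) (d (H φ) c) (d (H ψ) c))
        where
        lem : ∀ a b p q r s → a + b - (p + q + (r + s)) ≡ a - (p + r) + (b - (q + s))
        lem = solve-∀
      N-op .scale a φ c c∈ = trans (cong₂ (λ p q → a * φ c - (p + q))
          (scale (H-op ∘ₒ d-op) a φ c c∈) (scale (d-op ∘ₒ H-op) a φ c c∈))
        (lem a (φ c) (H (d φ) c) (d (H φ) c))
        where
        lem : ∀ a f p q → a * f - (a * p + a * q) ≡ a * (f - (p + q))
        lem = solve-∀

      iterate-op : ∀ m → IsOp (iterate m)
      iterate-op zero .local eq = eq
      iterate-op zero .add φ ψ c _ = refl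
      iterate-op zero .scale a φ c _ = refl
      iterate-op (suc m) = N-op ∘ₒ iterate-op m

      -- tr (signed ∘ (H d + d H) ∘ B) vanishes for every B commuting with d, because signed anticommutes with d.
      tr-iterate : ∀ {σ} → Perm σ → ∀ m → tr (λ φ → signed (iterate m (shift σ φ))) ≡ tr (λ φ → signed (shift σ φ))
      tr-iterate pσ zero = refl
      tr-iterate {σ} pσ (suc m) = trans invariant (tr-iterate pσ m)
        where
        B : Cochain → Cochain
        B φ = iterate m (shift σ φ)
        B-op : IsOp B
        B-op = iterate-op m ∘ₒ shift-op pσ
        dB : ∀ φ c → d (B φ) c ≡ B (d φ) c
        dB φ c = trans (sym (iterate-d m (shift σ φ) c)) (iterate-cong m (d-shift σ φ) c)
        X Y : Cochain → Cochain
        X φ = signed (H (d (B φ)))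
        Y φ = signed (d (H (B φ)))
        split : tr (λ φ → signed (N (B φ))) ≡ tr (signed ∘ B) - (tr X + tr Y)
        split = trans (∑-cong L (λ c → lem (sgn c) (B (δ c) c) (H (d (B (δ c))) c) (d (H (B (δ c))) c)))
          (trans (∑-lin₂ L 1ℤ (- 1ℤ) (λ c → signed (B (δ c)) c) (λ c → X (δ c) c + Y (δ c) c)) (trans
            (cong (λ q → 1ℤ * tr (signed ∘ B) + - 1ℤ * q) (∑-+ L (λ c → X (δ c) c) (λ c → Y (δ c) c)))
            (lem₂ (tr (signed ∘ B)) (tr X + tr Y))))
          where
          lem : ∀ s a p q → s * (a - (p + q)) ≡ 1ℤ * (s * a) + - 1ℤ * (s * p + s * q)
          lem = solve-∀
          lem₂ : ∀ a b → 1ℤ * a + - 1ℤ * b ≡ a - b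
          lem₂ = solve-∀
        XY : tr Y ≡ - tr X
        XY = begin
          tr Y
            ≡⟨ ∑-cong L (λ c → trans (lem₁ (signed (d (H (B (δ c)))) c)) (cong (- 1ℤ *_) (sym (d-signed (H (B (δ c))) c)))) ⟩
          ∑ L (λ c → - 1ℤ * d (signed (H (B (δ c)))) c)
            ≡⟨ ∑-* L (- 1ℤ) _ ⟩
          - 1ℤ * tr (d ∘ (signed ∘ H ∘ B))
            ≡⟨ cong (- 1ℤ *_) (tr-comm d-op (signed-op ∘ₒ (H-op ∘ₒ B-op))) ⟩
          - 1ℤ * tr (λ φ → signed (H (B (d φ))))
            ≡⟨ cong (- 1ℤ *_) (tr-cong (λ φ c _ → cong (sgn c *_) (h-cong bot S c (λ c′ _ → sym (dB φ c′))))) ⟩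
          - 1ℤ * tr X
            ≡⟨ lem₂ (tr X) ⟩
          - tr X ∎
          where
          lem₁ : ∀ a → a ≡ - 1ℤ * - a
          lem₁ = solve-∀
          lem₂ : ∀ a → - 1ℤ * a ≡ - a
          lem₂ = solve-∀
        invariant : tr (λ φ → signed (N (B φ))) ≡ tr (signed ∘ B)
        invariant = trans split (trans (cong (λ q → tr (signed ∘ B) - (tr X + q)) XY) (lem (tr (signed ∘ B)) (tr X)))
          where
          lem : ∀ a b → a - (b + - b) ≡ a
          lem = solve-∀

      -- The sign operator may be inserted because P φ is supported on full chains, whose sign is 1.
      -- This turns the trace into a supertrace, from which `tr-iterate` removes P.
      tr-P-shift : ∀ {σ} → Perm σ → tr (λ φ → P (shift σ φ)) ≡ χβ σ S
      tr-P-shift {σ} pσ = begin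
        tr (λ φ → P (shift σ φ))
          ≡⟨ tr-cong unsign ⟩
        tr (λ φ → signed (P (shift σ φ)))
          ≡⟨ tr-iterate pσ bound ⟩
        tr (λ φ → signed (shift σ φ))
          ≡⟨ ∑-cong L (λ c → cong (λ q → sgn c * ⟦ q ⟧) (ind-iff (c ≟ᶜʰ actC σ c) (actC σ c ≟ᶜʰ c) sym sym)) ⟩
        signedFixed σ bot S
          ≡⟨ χβ-signedFixed σ S ⟨
        χβ σ S ∎
        where
        unsign : ∀ φ c → c ∈ L → P (shift σ φ) c ≡ signed (P (shift σ φ)) c
        unsign φ c c∈ with absent c ℕ.≟ 0
        ... | yes full = sym (trans (cong (_* P (shift σ φ) c) (sgn-full c full)) (ℤₚ.*-identityˡ _))
        ... | no ne = trans (P-nonfull (shift σ φ) c c∈ ne)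
          (sym (trans (cong (sgn c *_) (P-nonfull (shift σ φ) c c∈ ne)) (ℤₚ.*-zeroʳ (sgn c))))

      sumG : Cochain → Cochain
      sumG φ c = ∑ (Sym n) (λ σ → shift σ φ c)

      sumG-op : IsOp sumG
      sumG-op .local eq c c∈ = ∑-cong∈ (Sym n) (λ σ σ∈ → eq _ (shift∈ (Sym-Perm σ σ∈) c c∈))
      sumG-op .add φ ψ c _ = ∑-+ (Sym n) _ _
      sumG-op .scale a φ c _ = ∑-* (Sym n) a _

      order : ℤ
      order = ∑ (Sym n) (λ _ → 1ℤ)

      sumG-sumG : ∀ φ c → sumG (sumG φ) c ≡ order * sumG φ c
      sumG-sumG φ c = begin
        ∑ (Sym n) (λ σ → ∑ (Sym n) (λ ρ → φ (actC ρ (actC σ c))))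
          ≡⟨ ∑-cong∈ (Sym n) (λ σ σ∈ → trans (∑-cong (Sym n) (λ ρ → cong φ (actC-∘ ρ σ c)))
               (Sym-shift (λ ρ → φ (actC ρ c)) (λ e → cong φ (actC-ext e c)) σ (Sym-Perm σ σ∈))) ⟩
        ∑ (Sym n) (λ σ → sumG φ c)
          ≡⟨ ∑-cong (Sym n) (λ σ → sym (ℤₚ.*-identityʳ (sumG φ c))) ⟩
        ∑ (Sym n) (λ σ → sumG φ c * 1ℤ)
          ≡⟨ trans (∑-* (Sym n) (sumG φ c) _) (ℤₚ.*-comm (sumG φ c) order) ⟩
        order * sumG φ c ∎

      d-sumG : ∀ φ c → c ∈ L → sumG (d φ) c ≡ d (sumG φ) c
      d-sumG φ c c∈ = trans (∑-cong (Sym n) (λ σ → sym (d-shift σ φ c)))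
        (sym (sumOp d-op (Sym n) (λ σ → shift σ φ) c c∈))

      P-op : IsOp P
      P-op = iterate-op bound

      VanishesFull : Cochain → Set
      VanishesFull ψ = ∀ c → c ∈ L → absent c ≡ 0 → ψ c ≡ 0ℤ

      -- At a full chain `H` gives 0, and `d` after `H` deletes a member and inserts one, so it
      -- reads ψ at full chains again.
      N-full : ∀ {ψ} → VanishesFull ψ → VanishesFull (N ψ)
      N-full {ψ} ψ0 c c∈ full = trans (cong₂ _-_ (ψ0 c c∈ full) (cong₂ _+_ (h-full bot S (d ψ) c full)
          (d-vanish c λ c′ f → h-vanish bot S c′ λ c″ i →
            ψ0 c″ (valid-chains (Ins-valid bot-isCode asc i (Face-valid f (chains-valid bot S c c∈))))
              (ℕₚ.suc-injective (trans (sym (Ins-absent i)) (trans (Face-absent f) (cong suc full)))))))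
        refl

      iterate-full : ∀ m {ψ} → VanishesFull ψ → VanishesFull (iterate m ψ)
      iterate-full zero ψ0 = ψ0
      iterate-full (suc m) ψ0 = N-full (iterate-full m ψ0)

      P-vanish : ∀ {ψ} → VanishesFull ψ → ∀ c → c ∈ L → P ψ c ≡ 0ℤ
      P-vanish {ψ} ψ0 c c∈ with absent c ℕ.≟ 0
      ... | yes full = iterate-full bound ψ0 c c∈ full
      ... | no ne = P-nonfull ψ c c∈ ne

      -- P commutes with `d`, and a face always has a vacant rank, where the values of P are zero.
      P-d : ∀ φ c → c ∈ L → P (d φ) c ≡ 0ℤ
      P-d φ c c∈ = trans (iterate-d bound φ c) (d-vanish c λ c′ f →
        P-nonfull φ c′ (valid-chains (Face-valid f (chains-valid bot S c c∈)))
          (λ e → case (trans (sym (Face-absent f)) e)))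
        where
        case : ∀ {m} → ¬ suc m ≡ 0
        case ()

      A : Cochain → Cochain
      A φ = P (sumG φ)

      A-op : IsOp A
      A-op = P-op ∘ₒ sumG-op

      -- N differs from the identity by two terms. `H` after `d` vanishes on full chains, also after
      -- the group sum, so P erases it. `d` after `H` passes through the group sum, since `d` is
      -- equivariant, and falls to `P-d`. Hence A ∘ P = A, which makes up for P not commuting with
      -- the group.
      A-iterate : ∀ m ψ c → c ∈ L → A (iterate m ψ) c ≡ A ψ c
      A-iterate zero ψ c c∈ = refl
      A-iterate (suc m) ψ c c∈ = trans (A-N (iterate m ψ)) (A-iterate m ψ c c∈)
        where
        A-N : ∀ χ → A (N χ) c ≡ A χ c
        A-N χ = begin
          A (N χ) c
            ≡⟨ local A-op (λ x _ → lem₁ (χ x) (H (d χ) x) (d (H χ) x)) c c∈ ⟩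
          A (λ x → χ x + - 1ℤ * (H (d χ) x + d (H χ) x)) c
            ≡⟨ trans (add A-op χ (λ x → - 1ℤ * (H (d χ) x + d (H χ) x)) c c∈) (cong (A χ c +_)
                 (trans (scale A-op (- 1ℤ) (λ x → H (d χ) x + d (H χ) x) c c∈)
                 (cong (- 1ℤ *_) (add A-op (H (d χ)) (d (H χ)) c c∈)))) ⟩
          A χ c + - 1ℤ * (A (H (d χ)) c + A (d (H χ)) c)
            ≡⟨ cong₂ (λ p q → A χ c + - 1ℤ * (p + q))
                 (P-vanish (λ x x∈ full → ∑-zero∈ (Sym n) (λ σ _ →
                   h-full bot S (d χ) (actC σ x) (trans (actC-absent σ x) full))) c c∈)
                 (trans (local P-op (d-sumG (H χ)) c c∈) (P-d (sumG (H χ)) c c∈)) ⟩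
          A χ c + - 1ℤ * (0ℤ + 0ℤ)
            ≡⟨ lem₂ (A χ c) ⟩
          A χ c ∎
          where
          lem₁ : ∀ a p q → a - (p + q) ≡ a + - 1ℤ * (p + q)
          lem₁ = solve-∀
          lem₂ : ∀ a → a + - 1ℤ * (0ℤ + 0ℤ) ≡ a
          lem₂ = solve-∀

      A-A : ∀ φ c → c ∈ L → A (A φ) c ≡ order * A φ c
      A-A φ c c∈ = trans (A-iterate bound (sumG φ) c c∈)
        (trans (local P-op (λ x _ → sumG-sumG φ x) c c∈) (scale P-op order (sumG φ) c c∈))

      tr-A : tr A ≡ ∑ (Sym n) (λ σ → χβ σ S)
      tr-A = begin
        ∑ L (λ c → P (sumG (δ c)) c)
          ≡⟨ ∑-cong∈ L (λ c c∈ → sumOp P-op (Sym n) (λ σ → shift σ (δ c)) c c∈) ⟩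
        ∑ L (λ c → ∑ (Sym n) (λ σ → P (shift σ (δ c)) c))
          ≡⟨ ∑-swap L (Sym n) (λ c σ → P (shift σ (δ c)) c) ⟩
        ∑ (Sym n) (λ σ → tr (λ φ → P (shift σ φ)))
          ≡⟨ ∑-cong∈ (Sym n) (λ σ σ∈ → tr-P-shift (Sym-Perm σ σ∈)) ⟩
        ∑ (Sym n) (λ σ → χβ σ S) ∎

      order-pos : 0ℤ ℤ.< order
      order-pos with anyNonzero (Sym n) (λ σ → ⟦ ⌊ tabulate σ ≟ᶜ tabulate id ⌋ ⟧)
      ... | inj₁ (σ , σ∈ , _) = positive (Sym n) σ∈
        where
        positive : ∀ xs → σ ∈ xs → 0ℤ ℤ.< ∑ xs (λ _ → 1ℤ)
        positive (x ∷ xs) _ = ℤₚ.+-mono-<-≤ (ℤ.+<+ (s≤s z≤n)) (∑-nonneg xs (λ _ → ℤ.+≤+ z≤n))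
      ... | inj₂ all0 with () ← trans (sym (Sym-once {n} id (λ e → e))) (∑-zero∈ (Sym n) all0)

      -- A top-dimensional cycle, given by its evaluation on cochains. `minus` and `vanish-full`
      -- together also show that Z respects pointwise equality, see `same`.
      record Cycle (Z : Cochain → ℤ) : Set where
        field
          vanish-full : ∀ {φ} → (∀ c → Valid bot S c → absent c ≡ 0 → φ c ≡ 0ℤ) → Z φ ≡ 0ℤ
          minus : ∀ φ ψ → Z (λ c → φ c - ψ c) ≡ Z φ - Z ψ
          boundary : ∀ φ → Z (d φ) ≡ 0ℤ

      module _ {Z : Cochain → ℤ} (cyc : Cycle Z) where
        open Cycle cyc

        same : ∀ {φ ψ} → (∀ c → φ c - ψ c ≡ 0ℤ) → Z φ ≡ Z ψ
        same {φ} {ψ} eq = ℤₚ.i-j≡0⇒i≡j (Z φ) (Z ψ) (trans (sym (minus φ ψ)) (vanish-full (λ c _ _ → eq c)))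

        Z-N : ∀ φ → Z (N φ) ≡ Z φ
        Z-N φ = begin
          Z (N φ)
            ≡⟨ same (λ c → lem₁ (φ c) (H (d φ) c) (d (H φ) c)) ⟩
          Z (λ c → φ c - H (d φ) c - d (H φ) c)
            ≡⟨ trans (minus (λ c → φ c - H (d φ) c) (d (H φ))) (cong₂ _-_ (minus φ (H (d φ))) (boundary (H φ))) ⟩
          Z φ - Z (H (d φ)) - 0ℤ
            ≡⟨ cong (λ q → Z φ - q - 0ℤ) (vanish-full (λ c _ full → h-full bot S (d φ) c full)) ⟩
          Z φ - 0ℤ - 0ℤ
            ≡⟨ lem₂ (Z φ) ⟩
          Z φ ∎
          where
          lem₁ : ∀ a p q → a - (p + q) - (a - p - q) ≡ 0ℤ
          lem₁ = solve-∀
          lem₂ : ∀ a → a - 0ℤ - 0ℤ ≡ a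
          lem₂ = solve-∀

        Z-iterate : ∀ m φ → Z (iterate m φ) ≡ Z φ
        Z-iterate zero φ = refl
        Z-iterate (suc m) φ = trans (Z-N (iterate m φ)) (Z-iterate m φ)

        -- Z is invariant under N, so Z (A φ) = Z (sumG φ). If this is nonzero, then A is a nonzero
        -- operator and its trace is positive.
        multiplicity-positive : ∀ φ → ¬ Z (sumG φ) ≡ 0ℤ → 0ℤ ℤ.< ∑ (Sym n) (λ σ → χβ σ S)
        multiplicity-positive φ ≢0 with anyNonzero L (A φ)
        ... | inj₁ (c , c∈ , Aφ≢0) = subst (0ℤ ℤ.<_) tr-A (trace-positive A-op order order-pos A-A φ c c∈ Aφ≢0)
        ... | inj₂ all0 = ⊥-elim (≢0 (trans (sym (Z-iterate bound (sumG φ)))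
                            (vanish-full (λ c v _ → all0 c (valid-chains v)))))

open Multiplicity

-- Interval partitions of a path.

module Intervals where

  -- A set e of edges of the path 0 − 1 − ⋯ − (n−1), where edge v joins v−1 to v, cuts it into intervals;
  -- start e v is the left end of the interval of v.

  start : List ℕ → ℕ → ℕ
  start e zero = zero
  start e (suc v) = if ⌊ suc v ∈? e ⌋ then start e v else suc v

  start-∈ : ∀ {e v} → suc v ∈ e → start e (suc v) ≡ start e v
  start-∈ {e} {v} v∈ = cong (if_then start e v else suc v) (yes-true (suc v ∈? e) v∈)

  start-∉ : ∀ {e} v → v ∉ e → start e v ≡ v
  start-∉ zero v∉ = refl
  start-∉ {e} (suc v) v∉ = cong (if_then start e v else suc v) (no-false (suc v ∈? e) v∉)

  start-≤ : ∀ e v → start e v ≤ v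
  start-≤ e zero = z≤n
  start-≤ e (suc v) with suc v ∈? e
  ... | yes _ = ℕₚ.m≤n⇒m≤1+n (start-≤ e v)
  ... | no _ = ℕₚ.≤-refl

  start-mono : ∀ {e e′} → (∀ v → v ∈ e → v ∈ e′) → ∀ v → start e′ (start e v) ≡ start e′ v
  start-mono sub zero = refl
  start-mono {e} {e′} sub (suc v) with suc v ∈? e
  ... | yes v∈ = trans (start-mono {e} {e′} sub v) (sym (start-∈ {e′} (sub (suc v) v∈)))
  ... | no _ = refl

  start-cong : ∀ {e e′} → (∀ v → v ∈ e → v ∈ e′) → (∀ v → v ∈ e′ → v ∈ e) → ∀ v → start e v ≡ start e′ v
  start-cong to from zero = refl
  start-cong {e} {e′} to from (suc v) with suc v ∈? e
  ... | yes v∈ = trans (start-cong {e} {e′} to from v) (sym (start-∈ {e′} (to _ v∈)))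
  ... | no v∉ = sym (start-∉ {e′} (suc v) (v∉ ∘ from _))

  start-gap : ∀ {e} a v → a ∉ e → a ≤ v → a ≤ start e v
  start-gap a zero a∉ a≤v = a≤v
  start-gap {e} a (suc v) a∉ a≤v with suc v ∈? e
  ... | no _ = a≤v
  ... | yes v∈ with ℕₚ.m≤n⇒m<n∨m≡n a≤v
  ...   | inj₁ (s≤s a≤) = start-gap a v a∉ a≤
  ...   | inj₂ refl = ⊥-elim (a∉ v∈)

  gap : ∀ {e} a {v w} → a ∉ e → v < a → a ≤ w → ¬ start e v ≡ start e w
  gap {e} a {v} {w} a∉ v<a a≤w eq = ℕₚ.<-irrefl eq
    (ℕₚ.<-≤-trans (ℕₚ.≤-<-trans (start-≤ e v) v<a) (start-gap a w a∉ a≤w))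

  between : ∀ {e v w} → start e v ≡ start e w → ∀ a → v < a → a ≤ w → a ∈ e
  between {e} eq a v<a a≤w with a ∈? e
  ... | yes a∈ = a∈
  ... | no a∉ = ⊥-elim (gap a a∉ v<a a≤w eq)

  join : ∀ {e} v w → v ≤ w → (∀ a → v < a → a ≤ w → a ∈ e) → start e v ≡ start e w
  join v w v≤w all with ℕₚ.m≤n⇒m<n∨m≡n v≤w
  ... | inj₂ refl = refl
  join {e} v (suc w) v≤w all | inj₁ (s≤s v≤) =
    trans (join v w v≤ (λ a v<a a≤w → all a v<a (ℕₚ.m≤n⇒m≤1+n a≤w)))
          (sym (start-∈ {e} (all (suc w) (s≤s v≤) ℕₚ.≤-refl)))

  module _ {n : ℕ} where

    intervals : List ℕ → Code n
    intervals e = tabulate λ v → fromℕ< (ℕₚ.≤-<-trans (start-≤ e (toℕ v)) (toℕ<n v))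

    toℕ-intervals : ∀ e v → toℕ (lookup (intervals e) v) ≡ start e (toℕ v)
    toℕ-intervals e v = trans (cong toℕ (lookup∘tabulate _ v)) (toℕ-fromℕ< _)

    same-interval : ∀ e {v w} → start e (toℕ v) ≡ start e (toℕ w) → lookup (intervals e) v ≡ lookup (intervals e) w
    same-interval e {v} {w} eq = toℕ-injective (trans (toℕ-intervals e v) (trans eq (sym (toℕ-intervals e w))))

    interval-same : ∀ e {v w} → lookup (intervals e) v ≡ lookup (intervals e) w → start e (toℕ v) ≡ start e (toℕ w)
    interval-same e {v} {w} eq = trans (sym (toℕ-intervals e v)) (trans (cong toℕ eq) (toℕ-intervals e w))

    intervals-cong : ∀ {e e′} → (∀ v → v ∈ e → v ∈ e′) → (∀ v → v ∈ e′ → v ∈ e) → intervals e ≡ intervals e′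
    intervals-cong {e} {e′} to from = vec-ext λ v → toℕ-injective (trans (toℕ-intervals e v)
      (trans (start-cong to from (toℕ v)) (sym (toℕ-intervals e′ v))))

    intervals-isCode : ∀ e → IsCode (intervals e)
    intervals-isCode e .decr v = subst (_≤ toℕ v) (sym (toℕ-intervals e v)) (start-≤ e (toℕ v))
    intervals-isCode e .idem v = same-interval e
      (trans (cong (start e) (toℕ-intervals e v)) (start-mono {e} {e} (λ _ → id) (toℕ v)))

    intervals-mono : ∀ {e e′} → (∀ v → v ∈ e → v ∈ e′) → intervals e ⊑ intervals e′
    intervals-mono {e} {e′} sub .at v = same-interval e′
      (trans (cong (start e′) (toℕ-intervals e v)) (start-mono {e} {e′} sub (toℕ v)))

    card-insert : ∀ {n} {p q : Fin n → Bool} w → p w ≡ false → q w ≡ true → (∀ v → ¬ v ≡ w → p v ≡ q v) →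
      card q ≡ suc (card p)
    card-insert {suc n} {p} {q} zero pw qw eq rewrite pw | qw = cong suc (sym (card-cong (λ v → eq (suc v) λ ())))
    card-insert {suc n} {p} {q} (suc w) pw qw eq rewrite eq zero (λ ()) with q zero
    ... | true = cong suc (card-insert w pw qw (λ v ne → eq (suc v) (ne ∘ suc-injective)))
      where open import Data.Fin.Properties using (suc-injective)
    ... | false = card-insert w pw qw (λ v ne → eq (suc v) (ne ∘ suc-injective))
      where open import Data.Fin.Properties using (suc-injective)

    card-list : ∀ e → Unique e → All (_< n) e → card {n} (λ v → ⌊ toℕ v ∈? e ⌋) ≡ length e
    card-list [] _ _ = card-false {n} (λ v → no-false (toℕ v ∈? []) λ ())
    card-list (x ∷ e) (x∉ ∷ u) (x<n ∷ lt) = trans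
      (card-insert {p = λ v → ⌊ toℕ v ∈? e ⌋} w
        (no-false (toℕ w ∈? e) (λ w∈ → All.lookup x∉ (subst (_∈ e) w≡x w∈) refl))
        (yes-true (toℕ w ∈? (x ∷ e)) (here w≡x))
        other)
      (cong suc (card-list e u lt))
      where
      w : Fin n
      w = fromℕ< x<n
      w≡x : toℕ w ≡ x
      w≡x = toℕ-fromℕ< x<n
      other : ∀ v → ¬ v ≡ w → ⌊ toℕ v ∈? e ⌋ ≡ ⌊ toℕ v ∈? (x ∷ e) ⌋
      other v ne = ind-iff (toℕ v ∈? e) (toℕ v ∈? (x ∷ e)) there
        λ { (here eq) → ⊥-elim (ne (toℕ-injective (trans eq (sym w≡x)))) ; (there v∈) → v∈ }

    -- A point v is a non-minimum exactly when the edge v is present. The point 0 has no edge to its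
    -- left, hence the condition `0 ∉ e`.
    intervals-rk : ∀ e → Unique e → All (_< n) e → 0 ∉ e → rk (intervals e) ≡ length e
    intervals-rk e u lt 0∉ = trans (card-cong nonMin-∈) (card-list e u lt)
      where
      moves : ∀ v → v ∈ e → ¬ start e v ≡ v
      moves zero v∈ = ⊥-elim (0∉ v∈)
      moves (suc v) v∈ eq = ℕₚ.<-irrefl (trans (sym (start-∈ {e} v∈)) eq) (s≤s (start-≤ e v))
      nonMin-∈ : ∀ v → nonMin (intervals e) v ≡ ⌊ toℕ v ∈? e ⌋
      nonMin-∈ v with toℕ v ∈? e
      ... | yes v∈ = nonMin-true (intervals e) v λ eq → moves (toℕ v) v∈ (trans (sym (toℕ-intervals e v)) (cong toℕ eq))
      ... | no v∉ = nonMin-false (intervals e) v (toℕ-injective (trans (toℕ-intervals e v) (start-∉ (toℕ v) v∉)))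

open Intervals

-- Alternating sums over orders of edges as cycles.

module AlternatingFlags where

  open import Data.Integer using (_+_; _*_; -_; _-_)

  -- picks A lists the ways to remove one item from A, with the sign of its position.

  Pick : Set
  Pick = ℤ × ℕ × List ℕ

  sg : Pick → ℤ
  sg = proj₁

  item : Pick → ℕ
  item = proj₁ ∘ proj₂

  rest : Pick → List ℕ
  rest = proj₂ ∘ proj₂

  behind : ℕ → Pick → Pick
  behind x p = - sg p , item p , x ∷ rest p

  picks : List ℕ → List Pick
  picks [] = []
  picks (x ∷ A) = (1ℤ , x , A) ∷ map (behind x) (picks A)

  picks-↭ : ∀ A p → p ∈ picks A → A ↭ item p ∷ rest p
  picks-↭ (x ∷ A) p (here refl) = ↭-refl
  picks-↭ (x ∷ A) p (there p∈) with q , q∈ , refl ← ∈-map⁻ (behind x) p∈ =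
    ↭-trans (prep x (picks-↭ A q q∈)) (swap x (item q) ↭-refl)

  picks-∈ : ∀ A p → p ∈ picks A → item p ∈ A
  picks-∈ (x ∷ A) p (here refl) = here refl
  picks-∈ (x ∷ A) p (there p∈) with q , q∈ , refl ← ∈-map⁻ (behind x) p∈ = there (picks-∈ A q q∈)

  picks-length : ∀ A p → p ∈ picks A → length A ≡ suc (length (rest p))
  picks-length (x ∷ A) p (here refl) = refl
  picks-length (x ∷ A) p (there p∈) with q , q∈ , refl ← ∈-map⁻ (behind x) p∈ = cong suc (picks-length A q q∈)

  -- Taking two items in the other order changes the sign and, Ψ being symmetric, nothing else. For
  -- a head x, the terms with x first cancel those with x second, and the terms without x form the
  -- same kind of sum over A.
  double-pick : ∀ A (Ψ : ℕ → ℕ → List ℕ → ℤ) → (∀ a b R → Ψ a b R ≡ Ψ b a R) →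
    ∑ (picks A) (λ p → sg p * ∑ (picks (rest p)) (λ q → sg q * Ψ (item p) (item q) (rest q))) ≡ 0ℤ
  double-pick [] Ψ sym-Ψ = refl
  double-pick (x ∷ A) Ψ sym-Ψ = begin
    1ℤ * ∑ (picks A) (λ q → sg q * Ψ x (item q) (rest q)) +
      ∑ (map (behind x) (picks A)) (λ p → sg p * ∑ (picks (rest p)) (λ q → sg q * Ψ (item p) (item q) (rest q)))
      ≡⟨ cong (1ℤ * first +_) (trans (∑-map (behind x) (picks A) _) (∑-cong (picks A) term)) ⟩
    1ℤ * first + ∑ (picks A) (λ p → - 1ℤ * (sg p * Ψ x (item p) (rest p)) +
      1ℤ * (sg p * ∑ (picks (rest p)) (λ q → sg q * Ψ (item p) (item q) (x ∷ rest q))))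
      ≡⟨ cong (1ℤ * first +_) (∑-lin₂ (picks A) (- 1ℤ) 1ℤ _ _) ⟩
    1ℤ * first + (- 1ℤ * first +
      1ℤ * ∑ (picks A) (λ p → sg p * ∑ (picks (rest p)) (λ q → sg q * Ψ (item p) (item q) (x ∷ rest q))))
      ≡⟨ cong (λ r → 1ℤ * first + (- 1ℤ * first + 1ℤ * r))
           (double-pick A (λ a b R → Ψ a b (x ∷ R)) (λ a b R → sym-Ψ a b (x ∷ R))) ⟩
    1ℤ * first + (- 1ℤ * first + 1ℤ * 0ℤ)
      ≡⟨ lem first ⟩
    0ℤ ∎
    where
    first = ∑ (picks A) (λ q → sg q * Ψ x (item q) (rest q))
    lem : ∀ a → 1ℤ * a + (- 1ℤ * a + 1ℤ * 0ℤ) ≡ 0ℤ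
    lem = solve-∀
    term : ∀ p → - sg p * (1ℤ * Ψ (item p) x (rest p) +
        ∑ (map (behind x) (picks (rest p))) (λ q → sg q * Ψ (item p) (item q) (rest q))) ≡
      - 1ℤ * (sg p * Ψ x (item p) (rest p)) +
        1ℤ * (sg p * ∑ (picks (rest p)) (λ q → sg q * Ψ (item p) (item q) (x ∷ rest q)))
    term p = trans (cong₂ (λ a b → - sg p * (1ℤ * a + b)) (sym-Ψ (item p) x (rest p))
        (trans (∑-map (behind x) (picks (rest p)) _) (trans
          (∑-cong (picks (rest p)) (λ q → lem₁ (sg q) (Ψ (item p) (item q) (x ∷ rest q))))
          (∑-* (picks (rest p)) (- 1ℤ) _))))
      (lem₂ (sg p) (Ψ x (item p) (rest p)) _)
      where
      lem₁ : ∀ a b → - a * b ≡ - 1ℤ * (a * b)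
      lem₁ = solve-∀
      lem₂ : ∀ s a b → - s * (1ℤ * a + - 1ℤ * b) ≡ - 1ℤ * (s * a) + 1ℤ * (s * b)
      lem₂ = solve-∀

  module _ {k : ℕ} where

    private
      n : ℕ
      n = suc k

    level : List ℕ → ℕ → List ℕ → Code n
    level F a acc = intervals (F ++ a ∷ acc)

    -- The part of a cycle above the block under consideration. `functional` turns an alternating
    -- sum over such a part into a `Functional` again, so blocks can be stacked; `Supp` bounds the
    -- chains that the value depends on.
    record Functional : Set₁ where
      field
        value : Cochain {k} → ℤ
        Supp : Chain {k} → Set
        vanish : ∀ {φ} → (∀ c → Supp c → φ c ≡ 0ℤ) → value φ ≡ 0ℤ
        minus : ∀ φ ψ → value (λ c → φ c - ψ c) ≡ value φ - value ψ
        boundary : ∀ φ → value (d φ) ≡ 0ℤ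
    open Functional

    atEmpty : Functional
    atEmpty .value φ = φ []
    atEmpty .Supp c = c ≡ []
    atEmpty .vanish φ0 = φ0 [] refl
    atEmpty .minus φ ψ = refl
    atEmpty .boundary φ = refl

    module Alternating (K : Functional) where

      -- Alternating sum over the orders in which items can be added, one per level, to the set acc of edges;
      -- level F also contains the edges F.
      alt : List (List ℕ) → List ℕ → List ℕ → Cochain {k} → ℤ
      alt [] A acc φ = value K φ
      alt (F ∷ Fs) A acc φ =
        ∑ (picks A) (λ p → sg p * alt Fs (rest p) (item p ∷ acc) (φ ∘ (just (level F (item p) acc) ∷_)))

      data Flag : List (List ℕ) → List ℕ → List ℕ → Chain {k} → Set where
        stop : ∀ {A acc c} → Supp K c → Flag [] A acc c
        go : ∀ {F Fs A acc p c} → p ∈ picks A → Flag Fs (rest p) (item p ∷ acc) c →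
          Flag (F ∷ Fs) A acc (just (level F (item p) acc) ∷ c)

      alt-vanish : ∀ Fs A acc {φ} → (∀ c → Flag Fs A acc c → φ c ≡ 0ℤ) → alt Fs A acc φ ≡ 0ℤ
      alt-vanish [] A acc φ0 = vanish K (λ c s → φ0 c (stop s))
      alt-vanish (F ∷ Fs) A acc φ0 = ∑-zero∈ (picks A) (λ p p∈ → trans
        (cong (sg p *_) (alt-vanish Fs (rest p) (item p ∷ acc) (λ c f → φ0 _ (go p∈ f)))) (ℤₚ.*-zeroʳ (sg p)))

      alt-minus : ∀ Fs A acc φ ψ → alt Fs A acc (λ c → φ c - ψ c) ≡ alt Fs A acc φ - alt Fs A acc ψ
      alt-minus [] A acc φ ψ = minus K φ ψ
      alt-minus (F ∷ Fs) A acc φ ψ = begin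
        ∑ (picks A) (λ p → sg p * alt Fs (rest p) (item p ∷ acc) (λ c → φ (new p ∷ c) - ψ (new p ∷ c)))
          ≡⟨ ∑-cong (picks A) (λ p → trans (cong (sg p *_) (alt-minus Fs (rest p) (item p ∷ acc) _ _))
               (lem (sg p) (left p) (right p))) ⟩
        ∑ (picks A) (λ p → 1ℤ * (sg p * left p) + - 1ℤ * (sg p * right p))
          ≡⟨ ∑-lin₂ (picks A) 1ℤ (- 1ℤ) (λ p → sg p * left p) (λ p → sg p * right p) ⟩
        1ℤ * alt (F ∷ Fs) A acc φ + - 1ℤ * alt (F ∷ Fs) A acc ψ
          ≡⟨ lem₂ (alt (F ∷ Fs) A acc φ) (alt (F ∷ Fs) A acc ψ) ⟩
        alt (F ∷ Fs) A acc φ - alt (F ∷ Fs) A acc ψ ∎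
        where
        new : Pick → Maybe (Code n)
        new p = just (level F (item p) acc)
        left right : Pick → ℤ
        left p = alt Fs (rest p) (item p ∷ acc) (φ ∘ (new p ∷_))
        right p = alt Fs (rest p) (item p ∷ acc) (ψ ∘ (new p ∷_))
        lem : ∀ s a b → s * (a - b) ≡ 1ℤ * (s * a) + - 1ℤ * (s * b)
        lem = solve-∀
        lem₂ : ∀ a b → 1ℤ * a + - 1ℤ * b ≡ a - b
        lem₂ = solve-∀

      infix 4 _⊆ₗ_
      _⊆ₗ_ : List ℕ → List ℕ → Set
      e ⊆ₗ e′ = ∀ v → v ∈ e → v ∈ e′

      ∷-⊆ : ∀ {e e′} a → e ⊆ₗ e′ → a ∷ e ⊆ₗ a ∷ e′
      ∷-⊆ a sub v (here eq) = here eq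
      ∷-⊆ a sub v (there v∈) = there (sub v v∈)

      ++-⊆ : ∀ F {e e′} → e ⊆ₗ e′ → F ++ e ⊆ₗ F ++ e′
      ++-⊆ F sub v v∈ with ∈-++⁻ F v∈
      ... | inj₁ p = ∈-++⁺ˡ p
      ... | inj₂ p = ∈-++⁺ʳ F (sub v p)

      alt-acc : ∀ Fs A {acc acc′} → acc ⊆ₗ acc′ → acc′ ⊆ₗ acc → ∀ φ → alt Fs A acc φ ≡ alt Fs A acc′ φ
      alt-acc [] A to from φ = refl
      alt-acc (F ∷ Fs) A {acc} {acc′} to from φ = ∑-cong (picks A) λ p → cong (sg p *_)
        (trans (alt-acc Fs (rest p) (∷-⊆ (item p) to) (∷-⊆ (item p) from) _)
               (cong (λ z → alt Fs (rest p) (item p ∷ acc′) (φ ∘ (just z ∷_)))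
                 (intervals-cong (++-⊆ F (∷-⊆ (item p) to)) (++-⊆ F (∷-⊆ (item p) from)))))

      swap-⊆ : ∀ a b acc → a ∷ b ∷ acc ⊆ₗ b ∷ a ∷ acc
      swap-⊆ a b acc v (here eq) = there (here eq)
      swap-⊆ a b acc v (there (here eq)) = here eq
      swap-⊆ a b acc v (there (there v∈)) = there (there v∈)

      -- Omitting a level leaves two consecutive picks indistinguishable.
      alt-cancel : ∀ Fs A acc φ → length A ≡ suc (suc (length Fs)) →
        ∑ (picks A) (λ p → sg p * alt Fs (rest p) (item p ∷ acc) φ) ≡ 0ℤ
      alt-cancel [] (x ∷ y ∷ []) acc φ len = lem (value K φ)
        where
        lem : ∀ a → 1ℤ * a + (- 1ℤ * a + 0ℤ) ≡ 0ℤ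
        lem = solve-∀
      alt-cancel (F ∷ Fs) A acc φ len = double-pick A Ψ λ a b R →
        trans (alt-acc Fs R (swap-⊆ b a acc) (swap-⊆ a b acc) _)
              (cong (λ z → alt Fs R (a ∷ b ∷ acc) (φ ∘ (just z ∷_)))
                (intervals-cong (++-⊆ F (swap-⊆ b a acc)) (++-⊆ F (swap-⊆ a b acc))))
        where
        Ψ : ℕ → ℕ → List ℕ → ℤ
        Ψ a b R = alt Fs R (b ∷ a ∷ acc) (φ ∘ (just (level F b (a ∷ acc)) ∷_))

      -- Deleting a level of the block is treated by `alt-cancel`, deleting a member above it by the
      -- boundary property of K. The length condition leaves one item over, the partner of the last
      -- pick when the last level is deleted.
      alt-boundary : ∀ Fs A acc φ → length A ≡ suc (length Fs) → alt Fs A acc (d φ) ≡ 0ℤ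
      alt-boundary [] A acc φ len = boundary K φ
      alt-boundary (F ∷ Fs) A acc φ len = trans (∑-cong∈ (picks A) λ p p∈ → trans
          (cong (sg p *_) (trans (alt-minus Fs (rest p) (item p ∷ acc) _ _)
            (cong (λ q → alt Fs (rest p) (item p ∷ acc) (φ ∘ (nothing ∷_)) - q)
              (alt-boundary Fs (rest p) (item p ∷ acc) _
                (ℕₚ.suc-injective (trans (sym (picks-length A p p∈)) len))))))
          (lem (sg p) (alt Fs (rest p) (item p ∷ acc) (φ ∘ (nothing ∷_)))))
        (alt-cancel Fs A acc (φ ∘ (nothing ∷_)) len)
        where
        lem : ∀ s a → s * (a - 0ℤ) ≡ s * a
        lem = solve-∀

      functional : ∀ Fs A acc → length A ≡ suc (length Fs) → Functional
      functional Fs A acc len .value = alt Fs A acc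
      functional Fs A acc len .Supp = Flag Fs A acc
      functional Fs A acc len .vanish = alt-vanish Fs A acc
      functional Fs A acc len .minus = alt-minus Fs A acc
      functional Fs A acc len .boundary φ = alt-boundary Fs A acc φ len

      headChain : List (List ℕ) → List ℕ → List ℕ → Chain {k} → Chain {k}
      headChain (F ∷ Fs) (x ∷ A) acc e = just (level F x acc) ∷ headChain Fs A (x ∷ acc) e
      headChain _ _ _ e = e

      module Deviation (D : Chain {k} → Set) (e : Chain {k}) where

        -- Flags are sorted by the first level whose pick is not the first item of its list; D does
        -- the same for the part above the block, where e is the distinguished chain.
        data Dev : List (List ℕ) → List ℕ → List ℕ → Chain {k} → Set where
          stop : ∀ {A acc c} → D c → Dev [] A acc c
          here : ∀ {F Fs x A acc p c} → p ∈ picks A → Flag Fs (x ∷ rest p) (item p ∷ acc) c →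
            Dev (F ∷ Fs) (x ∷ A) acc (just (level F (item p) acc) ∷ c)
          there : ∀ {F Fs x A acc c} → Dev Fs A (x ∷ acc) c →
            Dev (F ∷ Fs) (x ∷ A) acc (just (level F x acc) ∷ c)

        alt-head : (∀ {φ} → (∀ c → D c → φ c ≡ 0ℤ) → value K φ ≡ φ e) →
          ∀ Fs A acc φ → length A ≡ suc (length Fs) → (∀ c → Dev Fs A acc c → φ c ≡ 0ℤ) →
          alt Fs A acc φ ≡ φ (headChain Fs A acc e)
        alt-head K-head [] (x ∷ A) acc φ len φ0 = K-head (λ c s → φ0 c (stop s))
        alt-head K-head (F ∷ Fs) (x ∷ A) acc φ len φ0 = begin
          1ℤ * alt Fs A (x ∷ acc) (φ ∘ (just (level F x acc) ∷_)) +
            ∑ (map (behind x) (picks A)) (λ p → sg p * alt Fs (rest p) (item p ∷ acc) (φ ∘ (just (level F (item p) acc) ∷_)))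
            ≡⟨ cong₂ (λ a b → 1ℤ * a + b)
                 (alt-head K-head Fs A (x ∷ acc) _ (ℕₚ.suc-injective len) (λ c dv → φ0 _ (there dv)))
                 (trans (∑-map (behind x) (picks A) _) (∑-zero∈ (picks A) (λ p p∈ →
                   trans (cong (- sg p *_) (alt-vanish Fs (x ∷ rest p) (item p ∷ acc) (λ c f → φ0 _ (here p∈ f))))
                         (ℤₚ.*-zeroʳ (- sg p))))) ⟩
          1ℤ * φ (headChain (F ∷ Fs) (x ∷ A) acc e) + 0ℤ
            ≡⟨ lem (φ (headChain (F ∷ Fs) (x ∷ A) acc e)) ⟩
          φ (headChain (F ∷ Fs) (x ∷ A) acc e) ∎
          where
          lem : ∀ a → 1ℤ * a + 0ℤ ≡ a
          lem = solve-∀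

        Flag-split : (∀ c → Supp K c → D c ⊎ c ≡ e) → ∀ Fs A acc c → length A ≡ suc (length Fs) →
          Flag Fs A acc c → Dev Fs A acc c ⊎ c ≡ headChain Fs A acc e
        Flag-split K-split [] (x ∷ A) acc c len (stop s) with K-split c s
        ... | inj₁ dv = inj₁ (stop dv)
        ... | inj₂ eq = inj₂ eq
        Flag-split K-split (F ∷ Fs) (x ∷ A) acc _ len (go (here refl) f)
          with Flag-split K-split Fs A (x ∷ acc) _ (ℕₚ.suc-injective len) f
        ... | inj₁ dv = inj₁ (there dv)
        ... | inj₂ refl = inj₂ refl
        Flag-split K-split (F ∷ Fs) (x ∷ A) acc _ len (go (there p∈) f)
          with q , q∈ , refl ← ∈-map⁻ (behind x) p∈ = inj₁ (here q∈ f)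

open AlternatingFlags

-- The edges of the cycle and invariants of interval partitions.

module Edges where

  open import Data.Nat using (_+_)

  dbl : ℕ → ℕ
  dbl zero = zero
  dbl (suc t) = suc (suc (dbl t))

  -- Odd edges form disjoint pairs, even edges link neighbouring pairs. Both lists are decreasing,
  -- so that the head flag first creates, and later first attaches, the pairs nearest to the big
  -- block.
  odds : ℕ → List ℕ
  odds zero = []
  odds (suc t) = suc (dbl t) ∷ odds t

  evens : ℕ → List ℕ
  evens zero = []
  evens (suc t) = dbl (suc t) ∷ evens t

  range : ℕ → ℕ → List ℕ
  range h zero = []
  range h (suc g) = suc (g + h) ∷ range h g

  -- The edge 2i + 1 is the seed of the big block. It stands last, so it is the one that the head
  -- flag leaves out at the low ranks.
  lowItems : ℕ → List ℕ
  lowItems i = odds i ++ suc (dbl i) ∷ []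

  -- A rank jump of g + 1 is spent on g fixed edges, the `range` to the right of h, and the
  -- alternated edge that follows them.
  singles : ℕ → List ℕ → List ℕ
  singles h [] = []
  singles h (g ∷ gs) = suc (g + h) ∷ singles (suc (g + h)) gs

  -- At these levels the alternated edge of the head flag is an even one on the left, so the right
  -- end advances by g only, against g + 1 in `levels₁`.
  levels₂ : ℕ → List ℕ → List ℕ → List (List ℕ)
  levels₂ h F [] = []
  levels₂ h F (g ∷ gs) = (range h g ++ F) ∷ levels₂ (g + h) (range h g ++ F) gs

  levels₁ : ℕ → List ℕ → List ℕ → List ℕ → List (List ℕ)
  levels₁ h F [] gs₂ = levels₂ h F gs₂
  levels₁ h F (g ∷ gs) gs₂ = (range h g ++ F) ∷ levels₁ (suc (g + h)) (range h g ++ F) gs gs₂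

  dbl-mono : ∀ {s t} → s ≤ t → dbl s ≤ dbl t
  dbl-mono z≤n = z≤n
  dbl-mono (s≤s s≤t) = s≤s (s≤s (dbl-mono s≤t))

  dbl≢odd : ∀ s t → ¬ dbl s ≡ suc (dbl t)
  dbl≢odd (suc s) (suc t) e = dbl≢odd s t (ℕₚ.suc-injective (ℕₚ.suc-injective e))

  ∈-odds⁻ : ∀ i v → v ∈ odds i → ∃ λ t → t < i × v ≡ suc (dbl t)
  ∈-odds⁻ (suc i) v (here eq) = i , ℕₚ.≤-refl , eq
  ∈-odds⁻ (suc i) v (there v∈) with t , t<i , eq ← ∈-odds⁻ i v v∈ = t , ℕₚ.m≤n⇒m≤1+n t<i , eq

  ∈-odds⁺ : ∀ i t → t < i → suc (dbl t) ∈ odds i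
  ∈-odds⁺ (suc i) t (s≤s t≤i) with ℕₚ.m≤n⇒m<n∨m≡n t≤i
  ... | inj₁ t<i = there (∈-odds⁺ i t t<i)
  ... | inj₂ refl = here refl

  ∈-evens⁻ : ∀ i v → v ∈ evens i → ∃ λ t → t < i × v ≡ dbl (suc t)
  ∈-evens⁻ (suc i) v (here eq) = i , ℕₚ.≤-refl , eq
  ∈-evens⁻ (suc i) v (there v∈) with t , t<i , eq ← ∈-evens⁻ i v v∈ = t , ℕₚ.m≤n⇒m≤1+n t<i , eq

  ∈-low⁻ : ∀ i v → v ∈ lowItems i → ∃ λ t → t ≤ i × v ≡ suc (dbl t)
  ∈-low⁻ i v v∈ with ∈-++⁻ (odds i) v∈
  ... | inj₁ p with t , t<i , eq ← ∈-odds⁻ i v p = t , ℕₚ.<⇒≤ t<i , eq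
  ... | inj₂ (here eq) = i , ℕₚ.≤-refl , eq

  ∈-low⁺ : ∀ i t → t ≤ i → suc (dbl t) ∈ lowItems i
  ∈-low⁺ i t t≤i with ℕₚ.m≤n⇒m<n∨m≡n t≤i
  ... | inj₁ t<i = ∈-++⁺ˡ (∈-odds⁺ i t t<i)
  ... | inj₂ refl = ∈-++⁺ʳ (odds i) (here refl)

  ∈-range⁻ : ∀ h g v → v ∈ range h g → h < v × v ≤ g + h
  ∈-range⁻ h (suc g) v (here refl) = s≤s (ℕₚ.m≤n+m h g) , ℕₚ.≤-refl
  ∈-range⁻ h (suc g) v (there v∈) with h<v , v≤ ← ∈-range⁻ h g v v∈ = h<v , ℕₚ.m≤n⇒m≤1+n v≤

  ∈-range⁺ : ∀ h g v → h < v → v ≤ g + h → v ∈ range h g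
  ∈-range⁺ h zero v h<v v≤ = ⊥-elim (ℕₚ.<⇒≱ h<v v≤)
  ∈-range⁺ h (suc g) v h<v v≤ with ℕₚ.m≤n⇒m<n∨m≡n v≤
  ... | inj₁ (s≤s v≤′) = there (∈-range⁺ h g v h<v v≤′)
  ... | inj₂ refl = here refl

  ∈-singles⁻ : ∀ h gs v → v ∈ singles h gs → h < v
  ∈-singles⁻ h (g ∷ gs) v (here refl) = s≤s (ℕₚ.m≤n+m h g)
  ∈-singles⁻ h (g ∷ gs) v (there v∈) =
    ℕₚ.<-trans (s≤s (ℕₚ.m≤n+m h g)) (∈-singles⁻ (suc (g + h)) gs v v∈)

  -- Three conditions on interval partitions that are invariant under relabelling:
  -- with x, X, Y members of a chain and b a fixed point,
  --   β  Y only merges blocks of X into the block of b,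
  --   α  Y does not touch the nontrivial blocks of X,
  --   δ  the nontrivial blocks of x lie in the block of b in Y.

  module _ {n : ℕ} where

    β : Code n → Code n → Fin n → Set
    β X Y B = ∀ V W → lookup Y V ≡ lookup Y W → lookup X V ≡ lookup X W ⊎ lookup Y V ≡ lookup Y B

    α : Code n → Code n → Set
    α X Y = ∀ V W U → lookup X V ≡ lookup X W → ¬ V ≡ W → lookup Y V ≡ lookup Y U → lookup X V ≡ lookup X U

    δ : Code n → Code n → Fin n → Set
    δ x Y B = ∀ V W → lookup x V ≡ lookup x W → ¬ V ≡ W → lookup Y V ≡ lookup Y B

    βᴺ : List ℕ → List ℕ → ℕ → Set
    βᴺ e E b = ∀ v w → v < n → w < n → start E v ≡ start E w → start e v ≡ start e w ⊎ start E v ≡ start E b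

    αᴺ : List ℕ → List ℕ → Set
    αᴺ e E = ∀ v w u → v < n → w < n → u < n → start e v ≡ start e w → ¬ v ≡ w → start E v ≡ start E u →
      start e v ≡ start e u

    δᴺ : List ℕ → List ℕ → ℕ → Set
    δᴺ e E b = ∀ v w → v < n → w < n → start e v ≡ start e w → ¬ v ≡ w → start E v ≡ start E b

    private
      at-vertex : ∀ e v (v<n : v < n) → toℕ (lookup (intervals {n} e) (fromℕ< v<n)) ≡ start e v
      at-vertex e v v<n = trans (toℕ-intervals e (fromℕ< v<n)) (cong (start e) (toℕ-fromℕ< v<n))

      related⁺ : ∀ e {v w} (v<n : v < n) (w<n : w < n) → start e v ≡ start e w →
        lookup (intervals {n} e) (fromℕ< v<n) ≡ lookup (intervals e) (fromℕ< w<n)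
      related⁺ e {v} {w} v<n w<n eq = toℕ-injective (trans (at-vertex e v v<n) (trans eq (sym (at-vertex e w w<n))))

      related⁻ : ∀ e {v w} (v<n : v < n) (w<n : w < n) →
        lookup (intervals {n} e) (fromℕ< v<n) ≡ lookup (intervals e) (fromℕ< w<n) → start e v ≡ start e w
      related⁻ e {v} {w} v<n w<n eq = trans (sym (at-vertex e v v<n)) (trans (cong toℕ eq) (at-vertex e w w<n))

      vertex≢ : ∀ {v w} (v<n : v < n) (w<n : w < n) → ¬ v ≡ w → ¬ fromℕ< v<n ≡ fromℕ< w<n
      vertex≢ v<n w<n ne eq = ne (trans (sym (toℕ-fromℕ< v<n)) (trans (cong toℕ eq) (toℕ-fromℕ< w<n)))

    β⇒βᴺ : ∀ {e E B} → β (intervals e) (intervals E) B → βᴺ e E (toℕ B)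
    β⇒βᴺ {e} {E} {B} p v w v<n w<n eq with p (fromℕ< v<n) (fromℕ< w<n) (related⁺ E v<n w<n eq)
    ... | inj₁ q = inj₁ (related⁻ e v<n w<n q)
    ... | inj₂ q = inj₂ (trans (sym (at-vertex E v v<n)) (trans (cong toℕ q) (toℕ-intervals E B)))

    βᴺ⇒β : ∀ {e E} B → βᴺ e E (toℕ B) → β (intervals e) (intervals E) B
    βᴺ⇒β {e} {E} B p V W eq with p (toℕ V) (toℕ W) (toℕ<n V) (toℕ<n W) (interval-same E eq)
    ... | inj₁ q = inj₁ (same-interval e q)
    ... | inj₂ q = inj₂ (same-interval E q)

    α⇒αᴺ : ∀ {e E} → α (intervals e) (intervals E) → αᴺ e E
    α⇒αᴺ {e} {E} p v w u v<n w<n u<n eq ne eq′ = related⁻ e v<n u<n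
      (p (fromℕ< v<n) (fromℕ< w<n) (fromℕ< u<n) (related⁺ e v<n w<n eq) (vertex≢ v<n w<n ne) (related⁺ E v<n u<n eq′))

    αᴺ⇒α : ∀ {e E} → αᴺ e E → α (intervals e) (intervals E)
    αᴺ⇒α {e} {E} p V W U eq ne eq′ = same-interval e
      (p (toℕ V) (toℕ W) (toℕ U) (toℕ<n V) (toℕ<n W) (toℕ<n U) (interval-same e eq) (ne ∘ toℕ-injective) (interval-same E eq′))

    δ⇒δᴺ : ∀ {e E B} → δ (intervals e) (intervals E) B → δᴺ e E (toℕ B)
    δ⇒δᴺ {e} {E} {B} p v w v<n w<n eq ne = trans (sym (at-vertex E v v<n))
      (trans (cong toℕ (p (fromℕ< v<n) (fromℕ< w<n) (related⁺ e v<n w<n eq) (vertex≢ v<n w<n ne))) (toℕ-intervals E B))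

    δᴺ⇒δ : ∀ {e E} B → δᴺ e E (toℕ B) → δ (intervals e) (intervals E) B
    δᴺ⇒δ {e} {E} B p V W eq ne = same-interval E
      (p (toℕ V) (toℕ W) (toℕ<n V) (toℕ<n W) (interval-same e eq) (ne ∘ toℕ-injective))

    -- The new edge merges two blocks of e, while the missing edge x separates the merged block from
    -- b.
    β-kill : ∀ {e E b} a x → βᴺ e E b → suc a < n → suc a ∈ E → suc a ∉ e → x ∉ E →
      (b < x × x ≤ suc a) ⊎ (suc a < x × x ≤ b) → ⊥
    β-kill {e} {E} a x p a<n a∈ a∉ x∉ sep with p (suc a) a a<n (ℕₚ.<-trans (ℕₚ.n<1+n a) a<n) (start-∈ {E} a∈)
    ... | inj₁ eq = gap {e} (suc a) a∉ (ℕₚ.n<1+n a) ℕₚ.≤-refl (sym eq)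
    ... | inj₂ eq with sep
    ...   | inj₁ (b<x , x≤a) = gap {E} x x∉ b<x x≤a (sym eq)
    ...   | inj₂ (a<x , x≤b) = gap {E} x x∉ a<x x≤b eq

    α-kill-left : ∀ {e E} a → αᴺ e E → suc (suc a) < n → suc (suc a) ∈ E → suc (suc a) ∉ e → suc a ∈ e → ⊥
    α-kill-left {e} {E} a p a<n a∈ a∉ a∈e = gap {e} (suc (suc a)) a∉ (ℕₚ.n<1+n (suc a)) ℕₚ.≤-refl
      (p (suc a) a (suc (suc a)) a<n₁ (ℕₚ.<-trans (ℕₚ.n<1+n a) a<n₁) a<n
        (start-∈ {e} a∈e) (λ eq → ℕₚ.<-irrefl (sym eq) (ℕₚ.n<1+n a)) (sym (start-∈ {E} a∈)))
      where
      a<n₁ : suc a < n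
      a<n₁ = ℕₚ.<-trans (ℕₚ.n<1+n (suc a)) a<n

    α-kill-right : ∀ {e E} a → αᴺ e E → suc (suc a) < n → suc a ∈ E → suc a ∉ e → suc (suc a) ∈ e → ⊥
    α-kill-right {e} {E} a p a<n a∈ a∉ a∈e = gap {e} (suc a) a∉ (ℕₚ.n<1+n a) ℕₚ.≤-refl
      (sym (p (suc a) (suc (suc a)) a a<n₁ a<n (ℕₚ.<-trans (ℕₚ.n<1+n a) a<n₁)
        (sym (start-∈ {e} a∈e)) (λ eq → ℕₚ.<-irrefl eq (ℕₚ.n<1+n (suc a))) (start-∈ {E} a∈)))
      where
      a<n₁ : suc a < n
      a<n₁ = ℕₚ.<-trans (ℕₚ.n<1+n (suc a)) a<n

open Edges

-- Flags that deviate above the low ranks violate the invariants.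

module Deviations where

  open import Data.Nat using (_+_)

  module _ {k : ℕ} where

    private
      n : ℕ
      n = suc k

    -- The m-th low member is compared with the m-th attaching level, which has absorbed m pairs.
    -- This reads the order in which pairs were created off the order in which they are absorbed.
    Zip : Fin n → Chain {k} → Chain {k} → Set
    Zip B (just x ∷ low) (just Y ∷ c) = δ x Y B × Zip B low c
    Zip B _ _ = ⊤

    Tail : Code n → Fin n → Chain {k} → Set
    Tail X B (just Y ∷ c) = β X Y B × Tail X B c
    Tail X B _ = ⊤

    -- A description of the head flag that survives relabelling: X is the last low member, B a point
    -- of the big block, and p counts the levels that lengthen this block. By `good-head` the head
    -- flag satisfies it; by `good-kill` no deviating flag does, for any B.
    Good : Code n → Fin n → Chain {k} → ℕ → Chain {k} → Set
    Good X B low zero c = Tail X B c × Zip B low c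
    Good X B low (suc p) (just Y ∷ c) = β X Y B × α X Y × Good X B low p c
    Good X B low (suc p) _ = ⊤

    module Up = Alternating (atEmpty {k})
    module UpDev = Up.Deviation (λ _ → ⊥) []

    module _ (i : ℕ) where

      -- The edges of the last low member: all low items but one.
      record LowSet (e : List ℕ) : Set where
        field
          sub : ∀ v → v ∈ e → v ∈ lowItems i
          omitted : ℕ
          omitted∈ : omitted ∈ lowItems i
          omitted∉ : omitted ∉ e
          cover : ∀ v → v ∈ lowItems i → v ≡ omitted ⊎ v ∈ e

        even∉ : ∀ t → dbl t ∉ e
        even∉ t t∈ with s , _ , eq ← ∈-low⁻ i _ (sub _ t∈) = dbl≢odd t s eq

        ≤top : ∀ v → v ∈ e → v ≤ suc (dbl i)
        ≤top v v∈ with s , s≤i , refl ← ∈-low⁻ i _ (sub _ v∈) = s≤s (dbl-mono s≤i)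

        neighbour : ∀ t → t < i → suc (dbl t) ∈ e ⊎ suc (dbl (suc t)) ∈ e
        neighbour t t<i with cover _ (∈-low⁺ i t (ℕₚ.<⇒≤ t<i)) | cover _ (∈-low⁺ i (suc t) t<i)
        ... | inj₂ p | _ = inj₁ p
        ... | inj₁ _ | inj₂ q = inj₂ q
        ... | inj₁ p | inj₁ q = ⊥-elim (ℕₚ.<-irrefl (trans p (sym q)) (ℕₚ.m≤n⇒m≤1+n (ℕₚ.n<1+n _)))

      -- Only one low edge is missing from e, so an even edge touches a pair that is present,
      -- against α.
      even-kill : ∀ {e E} → LowSet e → αᴺ {n} e E → suc (dbl i) < n → ∀ a → a ∈ evens i → a ∈ E → ⊥
      even-kill {e} {E} ls al top<n a a∈ a∈E with t , t<i , refl ← ∈-evens⁻ i a a∈ with LowSet.neighbour ls t t<i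
      ... | inj₁ p = α-kill-left {E = E} (dbl t) al (ℕₚ.≤-<-trans (dbl-mono t<i) (ℕₚ.<-trans (ℕₚ.n<1+n _) top<n)) a∈E
                       (LowSet.even∉ ls (suc t)) p
      ... | inj₂ p = α-kill-right {E = E} (suc (dbl t)) al (ℕₚ.≤-<-trans (s≤s (dbl-mono t<i)) top<n) a∈E
                       (LowSet.even∉ ls (suc t)) p

      β-kill′ : ∀ {e E b} a x → βᴺ {n} e E b → 0 < a → a < n → a ∈ E → a ∉ e → x ∉ E →
        (b < x × x ≤ a) ⊎ (a < x × x ≤ b) → ⊥
      β-kill′ {E = E} (suc a) x be _ = β-kill {E = E} a x be

      ∉-level : ∀ {x h g F a acc} → (h < x → g + h < x) → x ∉ F → ¬ x ≡ a → x ∉ acc → x ∉ (range h g ++ F) ++ a ∷ acc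
      ∉-level {x} {h} {g} {F} out x∉F x≢a x∉acc x∈ with ∈-++⁻ (range h g ++ F) x∈
      ... | inj₂ (here eq) = x≢a eq
      ... | inj₂ (there p) = x∉acc p
      ... | inj₁ p with ∈-++⁻ (range h g) p
      ...   | inj₂ q = x∉F q
      ...   | inj₁ q with h<x , x≤ ← ∈-range⁻ h g x q = ℕₚ.<⇒≱ (out h<x) x≤

      ∈-level : ∀ h g F a acc → a ∈ (range h g ++ F) ++ a ∷ acc
      ∈-level h g F a acc = ∈-++⁺ʳ (range h g ++ F) (here refl)

      -- Taking a smaller even edge first makes a merge to the left of the missing edge
      -- `dbl (suc s)`, while B lies to its right, against β.
      rest₂ : ∀ {e B} → LowSet e → dbl i ≤ toℕ B → suc (dbl i) < n →
        ∀ gs s h F acc c → s ≤ i → suc (dbl i) ≤ h → (∀ v → v ∈ F → dbl i < v) → (∀ t → t < s → dbl (suc t) ∉ acc) →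
        UpDev.Dev (levels₂ h F gs) (evens s) acc c → Tail (intervals e) B c → ⊥
      rest₂ ls i≤B top<n [] s h F acc c s≤i i≤h F> acc∌ (UpDev.stop ()) good
      rest₂ {e} {B} ls i≤B top<n (g ∷ gs) (suc s) h F acc _ s≤i i≤h F> acc∌ (UpDev.here {p = p} p∈ _) (be , _)
        with t , t<s , eq ← ∈-evens⁻ s (item p) (picks-∈ (evens s) p p∈) =
        β-kill′ {E = (range h g ++ F) ++ item p ∷ acc} (item p) (dbl (suc s)) (β⇒βᴺ {B = B} be)
          (subst (0 <_) (sym eq) (s≤s z≤n))
          (subst (_< n) (sym eq) (ℕₚ.≤-<-trans (dbl-mono (ℕₚ.≤-trans t<s (ℕₚ.<⇒≤ s≤i))) (ℕₚ.<-trans (ℕₚ.n<1+n _) top<n)))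
          (∈-level h g F (item p) acc)
          (λ a∈ → LowSet.even∉ ls (suc t) (subst (_∈ e) eq a∈))
          (∉-level {h = h} {g} {F} (λ h<x → ⊥-elim (ℕₚ.<⇒≱ h<x (ℕₚ.≤-trans (dbl-mono s≤i) (ℕₚ.<⇒≤ i≤h))))
            (λ x∈ → ℕₚ.<⇒≱ (F> _ x∈) (dbl-mono s≤i))
            (λ x≡a → ℕₚ.<-irrefl (sym x≡a) a<x) (acc∌ s ℕₚ.≤-refl))
          (inj₂ (a<x , ℕₚ.≤-trans (dbl-mono s≤i) i≤B))
        where
        a<x : item p < dbl (suc s)
        a<x = subst (_< dbl (suc s)) (sym eq) (s≤s (s≤s (ℕₚ.<⇒≤ (dbl-mono t<s))))
      rest₂ ls i≤B top<n (g ∷ gs) (suc s) h F acc _ s≤i i≤h F> acc∌ (UpDev.there dv) (_ , good) =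
        rest₂ ls i≤B top<n gs s (g + h) (range h g ++ F) (dbl (suc s) ∷ acc) _ (ℕₚ.<⇒≤ s≤i)
          (ℕₚ.≤-trans i≤h (ℕₚ.m≤n+m h g)) F>′ acc∌′ dv good
        where
        F>′ : ∀ v → v ∈ range h g ++ F → dbl i < v
        F>′ v v∈ with ∈-++⁻ (range h g) v∈
        ... | inj₁ q = ℕₚ.<-≤-trans i≤h (ℕₚ.<⇒≤ (proj₁ (∈-range⁻ h g v q)))
        ... | inj₂ q = F> v q
        acc∌′ : ∀ t → t < s → dbl (suc t) ∉ dbl (suc s) ∷ acc
        acc∌′ t t<s (here eq) = ℕₚ.<-irrefl eq (s≤s (s≤s (ℕₚ.<⇒≤ (dbl-mono t<s))))
        acc∌′ t t<s (there p) = acc∌ t (ℕₚ.m≤n⇒m≤1+n t<s) p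

      module _ (gs₂ : List ℕ) where

        -- In place of the next single edge x there are the even edges, excluded by α, and later
        -- singles, which merge beyond the missing edge x while B lies before it.
        rest₁ : ∀ {e B low} → LowSet e → dbl i ≤ toℕ B → suc (dbl i) < n →
          ∀ gs h F acc c → toℕ B ≤ h → suc (dbl i) ≤ h → (∀ v → v ∈ F → dbl i < v × v ≤ h) → (∀ v → v ∈ acc → v ≤ h) →
          (∀ t → t < i → dbl (suc t) ∉ acc) → (∀ v → v ∈ singles h gs → v < n) →
          UpDev.Dev (levels₁ h F gs gs₂) (singles h gs ++ evens i) acc c → Good (intervals e) B low (length gs) c → ⊥
        rest₁ ls i≤B top<n [] h F acc c B≤h i≤h FOK acc≤ acc∌ <n dv (good , _) =
          rest₂ ls i≤B top<n gs₂ i h F acc c ℕₚ.≤-refl i≤h (λ v v∈ → proj₁ (FOK v v∈)) acc∌ dv good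
        rest₁ {e} {B} ls i≤B top<n (g ∷ gs) h F acc _ B≤h i≤h FOK acc≤ acc∌ <n (UpDev.here {p = p} p∈ _) (be , al , _)
          with ∈-++⁻ (singles (suc (g + h)) gs) (picks-∈ (singles (suc (g + h)) gs ++ evens i) p p∈)
        ... | inj₂ ev = even-kill {E = (range h g ++ F) ++ item p ∷ acc} ls (α⇒αᴺ al) top<n (item p) ev
                          (∈-level h g F (item p) acc)
        ... | inj₁ si = β-kill′ {E = (range h g ++ F) ++ item p ∷ acc} (item p) x (β⇒βᴺ {B = B} be)
            (ℕₚ.≤-<-trans z≤n x<a) (<n _ (there si)) (∈-level h g F (item p) acc)
            (λ a∈ → ℕₚ.<⇒≱ (ℕₚ.<-trans (ℕₚ.≤-<-trans i≤h h<x) x<a) (LowSet.≤top ls _ a∈))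
            (∉-level {h = h} {g} {F} (λ _ → ℕₚ.n<1+n (g + h)) (λ x∈ → ℕₚ.<⇒≱ h<x (proj₂ (FOK _ x∈)))
              (λ x≡a → ℕₚ.<-irrefl x≡a x<a) (λ x∈ → ℕₚ.<⇒≱ h<x (acc≤ _ x∈)))
            (inj₁ (ℕₚ.≤-<-trans B≤h h<x , ℕₚ.<⇒≤ x<a))
          where
          x = suc (g + h)
          h<x : h < x
          h<x = s≤s (ℕₚ.m≤n+m h g)
          x<a : x < item p
          x<a = ∈-singles⁻ x gs (item p) si
        rest₁ ls i≤B top<n (g ∷ gs) h F acc _ B≤h i≤h FOK acc≤ acc∌ <n (UpDev.there dv) (_ , _ , good) =
          rest₁ ls i≤B top<n gs x (range h g ++ F) (x ∷ acc) _ (ℕₚ.≤-trans B≤h (ℕₚ.<⇒≤ h<x))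
            (ℕₚ.≤-trans i≤h (ℕₚ.<⇒≤ h<x)) FOK′ acc≤′ acc∌′ (λ v v∈ → <n v (there v∈)) dv good
          where
          x = suc (g + h)
          h<x : h < x
          h<x = s≤s (ℕₚ.m≤n+m h g)
          FOK′ : ∀ v → v ∈ range h g ++ F → dbl i < v × v ≤ x
          FOK′ v v∈ with ∈-++⁻ (range h g) v∈
          ... | inj₁ q with h<v , v≤ ← ∈-range⁻ h g v q = ℕₚ.<-≤-trans i≤h (ℕₚ.<⇒≤ h<v) , ℕₚ.m≤n⇒m≤1+n v≤
          ... | inj₂ q with i<v , v≤ ← FOK v q = i<v , ℕₚ.≤-trans v≤ (ℕₚ.<⇒≤ h<x)
          acc≤′ : ∀ v → v ∈ x ∷ acc → v ≤ x
          acc≤′ v (here refl) = ℕₚ.≤-refl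
          acc≤′ v (there v∈) = ℕₚ.≤-trans (acc≤ v v∈) (ℕₚ.<⇒≤ h<x)
          acc∌′ : ∀ t → t < i → dbl (suc t) ∉ x ∷ acc
          acc∌′ t t<i (here eq) = ℕₚ.<⇒≱ (subst (h <_) (sym eq) h<x) (ℕₚ.≤-trans (dbl-mono t<i) (ℕₚ.<⇒≤ i≤h))
          acc∌′ t t<i (there p) = acc∌ t t<i p

      low≤ : ∀ v → v ∈ lowItems i → v ≤ suc (dbl i)
      low≤ v v∈ with s , s≤i , refl ← ∈-low⁻ i v v∈ = s≤s (dbl-mono s≤i)

      low-even∉ : ∀ t → dbl t ∉ lowItems i
      low-even∉ t t∈ with s , _ , eq ← ∈-low⁻ i _ t∈ = dbl≢odd t s eq

      low-pos : ∀ v → v ∈ lowItems i → 0 < v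
      low-pos v v∈ with s , s≤i , refl ← ∈-low⁻ i v v∈ = s≤s z≤n

      private
        mid : ℕ
        mid = suc (dbl i)

      -- The first level above the low ones pins down the omitted low item and the block containing b.
      first-level : ∀ {e b} g → LowSet e → suc (g + mid) < n →
        βᴺ {n} e ((range mid g ++ []) ++ suc (g + mid) ∷ lowItems i) b →
        αᴺ {n} e ((range mid g ++ []) ++ suc (g + mid) ∷ lowItems i) →
        mid ∉ e × dbl i ≤ b × b ≤ suc (g + mid)
      first-level {e} {b} g ls x<n be al = top∉ , i≤b , b≤x
        where
        open LowSet ls
        x = suc (g + mid)
        E = (range mid g ++ []) ++ x ∷ lowItems i
        low⊆E : ∀ v → v ∈ lowItems i → v ∈ E
        low⊆E v v∈ = ∈-++⁺ʳ (range mid g ++ []) (there v∈)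
        top<x : mid < x
        top<x = s≤s (ℕₚ.m≤n+m mid g)
        suc-top∈ : ∀ g → suc mid ∈ (range mid g ++ []) ++ suc (g + mid) ∷ lowItems i
        suc-top∈ zero = here refl
        suc-top∈ (suc g) = ∈-++⁺ˡ (∈-++⁺ˡ (∈-range⁺ mid (suc g) (suc mid) (ℕₚ.n<1+n mid) (s≤s (ℕₚ.m≤n+m mid g))))
        -- The edge following `mid` belongs to E, as a fixed edge or as x. If the pair of `mid` were
        -- present in e, that edge would touch it, against α.
        top∉ : mid ∉ e
        top∉ top∈ = α-kill-left {E = E} (dbl i) al (ℕₚ.≤-<-trans top<x x<n) (suc-top∈ g)
          (λ p → ℕₚ.<⇒≱ (ℕₚ.n<1+n mid) (≤top _ p)) top∈
        -- The edge `mid` is new at this level, so by β it has to merge into the block of b.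
        top~b : start E mid ≡ start E b
        top~b with be mid (dbl i) (ℕₚ.<-trans top<x x<n) (ℕₚ.<-trans (ℕₚ.n<1+n _) (ℕₚ.<-trans top<x x<n))
                      (start-∈ {E} (low⊆E mid (∈-low⁺ i i ℕₚ.≤-refl)))
        ... | inj₁ eq = ⊥-elim (gap {e} mid top∉ (ℕₚ.n<1+n _) ℕₚ.≤-refl (sym eq))
        ... | inj₂ eq = eq
        i∉E : dbl i ∉ E
        i∉E = ∉-level {h = mid} {g} {[]} (λ top<i → ⊥-elim (ℕₚ.<⇒≱ top<i (ℕₚ.n≤1+n _))) (λ ())
          (λ eq → ℕₚ.<⇒≱ (subst (mid <_) (sym eq) top<x) (ℕₚ.n≤1+n _)) (low-even∉ i)
        suc-x∉E : suc x ∉ E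
        suc-x∉E = ∉-level {h = mid} {g} {[]} (λ _ → s≤s (ℕₚ.n≤1+n _)) (λ ())
          (λ eq → ℕₚ.<-irrefl (sym eq) (ℕₚ.n<1+n x)) (λ p → ℕₚ.<⇒≱ (ℕₚ.m≤n⇒m≤1+n top<x) (low≤ _ p))
        i≤b : dbl i ≤ b
        i≤b with dbl i ≤? b
        ... | yes p = p
        ... | no p = ⊥-elim (gap {E} (dbl i) i∉E (ℕₚ.≰⇒> p) (ℕₚ.n≤1+n _) (sym top~b))
        b≤x : b ≤ x
        b≤x with b ≤? x
        ... | yes p = p
        ... | no p = ⊥-elim (gap {E} (suc x) suc-x∉E (ℕₚ.m≤n⇒m≤1+n top<x) (ℕₚ.≰⇒> p) top~b)

      up-kill : ∀ {e B low} g gs₁ gs₂ c → LowSet e → (∀ v → v ∈ singles mid (g ∷ gs₁) → v < n) →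
        UpDev.Dev (levels₁ mid [] (g ∷ gs₁) gs₂) (singles mid (g ∷ gs₁) ++ evens i) (lowItems i) c →
        Good (intervals e) B low (suc (length gs₁)) c → ⊥
      up-kill {e} {B} g gs₁ gs₂ _ ls <n (UpDev.here {p = p} p∈ _) (be , al , _)
        with ∈-++⁻ (singles (suc (g + mid)) gs₁) (picks-∈ (singles (suc (g + mid)) gs₁ ++ evens i) p p∈)
      ... | inj₂ ev = even-kill {E = (range mid g ++ []) ++ item p ∷ lowItems i} ls (α⇒αᴺ al)
                        (ℕₚ.<-trans (s≤s (ℕₚ.m≤n+m mid g)) (<n _ (here refl))) (item p) ev
                        (∈-level mid g [] (item p) (lowItems i))
      ... | inj₁ si = β-kill′ {E = E} (item p) x (β⇒βᴺ {B = B} be) (ℕₚ.≤-<-trans z≤n x<a) (<n _ (there si))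
            (∈-level mid g [] (item p) (lowItems i))
            (λ a∈ → ℕₚ.<⇒≱ (ℕₚ.<-trans top<x x<a) (LowSet.≤top ls _ a∈)) x∉E (inj₁ (B<x , ℕₚ.<⇒≤ x<a))
        where
        open LowSet ls
        x = suc (g + mid)
        E = (range mid g ++ []) ++ item p ∷ lowItems i
        top<x : mid < x
        top<x = s≤s (ℕₚ.m≤n+m mid g)
        x<a : x < item p
        x<a = ∈-singles⁻ x gs₁ (item p) si
        x∉E : x ∉ E
        x∉E = ∉-level {h = mid} {g} {[]} (λ _ → ℕₚ.n<1+n (g + mid)) (λ ()) (λ x≡a → ℕₚ.<-irrefl x≡a x<a)
          (λ x∈ → ℕₚ.<⇒≱ top<x (low≤ _ x∈))
        -- The position of B is still unknown here. The omitted low edge is new at this level and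
        -- lies left of the missing edge x, so β forces B to that side.
        B<x : toℕ B < x
        B<x with x ≤? toℕ B
        ... | no q = ℕₚ.≰⇒> q
        ... | yes q = ⊥-elim (β-kill′ {E = E} omitted x (β⇒βᴺ {B = B} be) (low-pos _ omitted∈)
                (ℕₚ.≤-<-trans (low≤ _ omitted∈) (ℕₚ.<-trans top<x (<n _ (here refl))))
                (∈-++⁺ʳ (range mid g ++ []) (there omitted∈)) omitted∉ x∉E
                (inj₂ (ℕₚ.≤-<-trans (low≤ _ omitted∈) top<x , q)))
      up-kill {e} {B} g gs₁ gs₂ _ ls <n (UpDev.there dv) (be , al , good)
        with top∉ , i≤B , B≤x ← first-level g ls (<n _ (here refl)) (β⇒βᴺ {B = B} be) (α⇒αᴺ al) =
        rest₁ gs₂ ls i≤B (ℕₚ.<-trans top<x (<n _ (here refl))) gs₁ x (range mid g ++ []) (x ∷ lowItems i) _ B≤x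
          (ℕₚ.<⇒≤ top<x) FOK acc≤ acc∌ (λ v v∈ → <n v (there v∈)) dv good
        where
        x = suc (g + mid)
        top<x : mid < x
        top<x = s≤s (ℕₚ.m≤n+m mid g)
        FOK : ∀ v → v ∈ range mid g ++ [] → dbl i < v × v ≤ x
        FOK v v∈ with ∈-++⁻ (range mid g) v∈
        ... | inj₁ q with h<v , v≤ ← ∈-range⁻ mid g v q = ℕₚ.<-trans (ℕₚ.n<1+n _) h<v , ℕₚ.m≤n⇒m≤1+n v≤
        acc≤ : ∀ v → v ∈ x ∷ lowItems i → v ≤ x
        acc≤ v (here refl) = ℕₚ.≤-refl
        acc≤ v (there v∈) = ℕₚ.≤-trans (low≤ v v∈) (ℕₚ.<⇒≤ top<x)
        acc∌ : ∀ t → t < i → dbl (suc t) ∉ x ∷ lowItems i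
        acc∌ t t<i (here eq) = ℕₚ.<⇒≱ (subst (mid <_) (sym eq) top<x) (ℕₚ.≤-trans (dbl-mono t<i) (ℕₚ.n≤1+n _))
        acc∌ t t<i (there p) = low-even∉ (suc t) p

      good-first : ∀ {e B low p} g c → LowSet e → suc (g + mid) < n →
        Good (intervals e) B low (suc p) (just (level (range mid g ++ []) (suc (g + mid)) (lowItems i)) ∷ c) →
        mid ∉ e × dbl i ≤ toℕ B
      good-first {e} {B} g c ls x<n (be , al , _) with mid∉ , i≤B , _ ← first-level g ls x<n (β⇒βᴺ {B = B} be) (α⇒αᴺ al) =
        mid∉ , i≤B

open Deviations

-- Invariants of the head flag and deviations at the low ranks.

module HeadFlag where

  open import Data.Nat using (_+_)

  module _ {k : ℕ} (i : ℕ) where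

    private
      n mid : ℕ
      n = suc k
      mid = suc (dbl i)

    -- The shape of an upper member of the head flag: the path is complete from lo to hi, which is
    -- the big block, and outside only low pairs occur.
    record Interval (lo hi : ℕ) (E : List ℕ) : Set where
      field
        only : ∀ v → v ∈ E → v ∈ lowItems i ⊎ (lo < v × v ≤ hi)
        lows : ∀ v → v ∈ lowItems i → v ∈ E
        full : ∀ v → lo < v → v ≤ hi → v ∈ E

    module Head {E : List ℕ} {s hi : ℕ} (s≤i : s ≤ i) (mid≤hi : mid ≤ hi) (int : Interval (dbl s) hi E) where
      open Interval int

      lo∉ : dbl s ∉ E
      lo∉ p with only _ p
      ... | inj₁ q = low-even∉ {k} i s q
      ... | inj₂ (q , _) = ℕₚ.<-irrefl refl q

      hi∉ : suc hi ∉ E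
      hi∉ p with only _ p
      ... | inj₁ q = ℕₚ.<⇒≱ (s≤s mid≤hi) (low≤ {k} i _ q)
      ... | inj₂ (_ , q) = ℕₚ.<-irrefl refl q

      inside : ∀ v → dbl s ≤ v → v ≤ hi → start E v ≡ start E (dbl i)
      inside v lo≤v v≤hi with ℕₚ.≤-total v (dbl i)
      ... | inj₁ v≤i = join v (dbl i) v≤i
        (λ a v<a a≤i → full a (ℕₚ.≤-<-trans lo≤v v<a) (ℕₚ.≤-trans a≤i (ℕₚ.≤-trans (ℕₚ.n≤1+n _) mid≤hi)))
      ... | inj₂ i≤v = sym (join (dbl i) v i≤v
        (λ a i<a a≤v → full a (ℕₚ.≤-<-trans (dbl-mono s≤i) i<a) (ℕₚ.≤-trans a≤v v≤hi)))

      -- To the right of the big block there are only single points, and to the left only low pairs,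
      -- which e contains already.
      β-head : ∀ {e} → (∀ v → v ∈ lowItems i → v ≤ dbl s → v ∈ e) → βᴺ {n} e E (dbl i)
      β-head {e} e⊇ v w _ _ eq with dbl s ≤? v | v ≤? hi
      ... | yes lo≤v | yes v≤hi = inj₂ (inside v lo≤v v≤hi)
      ... | yes _ | no v≰hi = inj₁ (cong (start e) v≡w)
        where
        hi<v = ℕₚ.≰⇒> v≰hi
        hi<w : hi < w
        hi<w with suc hi ≤? w
        ... | yes q = q
        ... | no q = ⊥-elim (gap {E} (suc hi) hi∉ (ℕₚ.≰⇒> q) hi<v (sym eq))
        beyond : ∀ a → hi < a → a ∉ E
        beyond a hi<a a∈ with only a a∈
        ... | inj₁ q = ℕₚ.<⇒≱ hi<a (ℕₚ.≤-trans (low≤ {k} i a q) mid≤hi)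
        ... | inj₂ (_ , q) = ℕₚ.<⇒≱ hi<a q
        v≡w : v ≡ w
        v≡w = trans (sym (start-∉ v (beyond v hi<v))) (trans eq (start-∉ w (beyond w hi<w)))
      ... | no lo≰v | _ = inj₁ same
        where
        v<lo = ℕₚ.≰⇒> lo≰v
        w<lo : w < dbl s
        w<lo with dbl s ≤? w
        ... | no q = ℕₚ.≰⇒> q
        ... | yes q = ⊥-elim (gap {E} (dbl s) lo∉ v<lo q eq)
        edge : ∀ a → a ∈ E → a < dbl s → a ∈ e
        edge a a∈ a<lo with only a a∈
        ... | inj₁ q = e⊇ a q (ℕₚ.<⇒≤ a<lo)
        ... | inj₂ (q , _) = ⊥-elim (ℕₚ.<⇒≱ a<lo (ℕₚ.<⇒≤ q))
        same : start e v ≡ start e w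
        same with ℕₚ.≤-total v w
        ... | inj₁ v≤w = join v w v≤w (λ a v<a a≤w → edge a (between {E} eq a v<a a≤w) (ℕₚ.≤-<-trans a≤w w<lo))
        ... | inj₂ w≤v = sym (join w v w≤v
          (λ a w<a a≤v → edge a (between {E} (sym eq) a w<a a≤v) (ℕₚ.≤-<-trans a≤v v<lo)))

      δ-head : ∀ {x} → (∀ v → v ∈ x → dbl s < v × v < dbl i) → δᴺ {n} x E (dbl i)
      δ-head {x} x-in v w _ _ eq v≢w with ℕₚ.<-cmp v w
      ... | tri≈ _ v≡w _ = ⊥-elim (v≢w v≡w)
      ... | tri< v<w _ _ with s≤s lo≤v , _ ← x-in (suc v) (between {x} eq (suc v) (ℕₚ.n<1+n v) v<w)
                         with _ , w<i ← x-in w (between {x} eq w v<w ℕₚ.≤-refl) =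
        inside v lo≤v (ℕₚ.≤-trans (ℕₚ.<⇒≤ (ℕₚ.<-trans v<w w<i)) (ℕₚ.≤-trans (ℕₚ.n≤1+n _) mid≤hi))
      ... | tri> _ _ w<v with lo<v , v<i ← x-in v (between {x} (sym eq) v w<v ℕₚ.≤-refl) =
        inside v (ℕₚ.<⇒≤ lo<v) (ℕₚ.≤-trans (ℕₚ.<⇒≤ v<i) (ℕₚ.≤-trans (ℕₚ.n≤1+n _) mid≤hi))

    -- All pairs of e lie to the left of 2i, where the big block starts as long as it is only being
    -- lengthened.
    α-head : ∀ {e E hi} → mid ≤ hi → Interval (dbl i) hi E → (∀ v → v ∈ e → v < dbl i) →
      (∀ v → v ∈ lowItems i → v ≤ dbl i → v ∈ e) → αᴺ {n} e E
    α-head {e} {E} mid≤hi int e< e⊇ v w u v<n _ u<n eq v≢w eq′ with Head.β-head ℕₚ.≤-refl mid≤hi int e⊇ v u v<n u<n eq′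
    ... | inj₁ q = q
    ... | inj₂ q = ⊥-elim (gap {E} (dbl i) (Head.lo∉ ℕₚ.≤-refl mid≤hi int) v<i ℕₚ.≤-refl q)
      where
      v<i : v < dbl i
      v<i with ℕₚ.<-cmp v w
      ... | tri≈ _ v≡w _ = ⊥-elim (v≢w v≡w)
      ... | tri< v<w _ _ = ℕₚ.<-trans v<w (e< w (between {e} eq w v<w ℕₚ.≤-refl))
      ... | tri> _ _ w<v = e< v (between {e} (sym eq) v w<v ℕₚ.≤-refl)

    -- The edge 2s + 2 moves the left end from 2s + 2 to 2s, because 2s + 1 is a low edge and
    -- present.
    interval₂ : ∀ {s h F acc} g → mid ≤ h → Interval (dbl (suc s)) h (F ++ acc) → s < i →
      Interval (dbl s) (g + h) ((range h g ++ F) ++ dbl (suc s) ∷ acc)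
    interval₂ {s} {h} {F} {acc} g mid≤h int s<i = record { only = only′ ; lows = lows′ ; full = full′ }
      where
      open Interval int
      i<h : dbl (suc s) ≤ h
      i<h = ℕₚ.≤-trans (dbl-mono s<i) (ℕₚ.≤-trans (ℕₚ.n≤1+n _) mid≤h)
      weaken : ∀ v → v ∈ F ++ acc → v ∈ lowItems i ⊎ (dbl s < v × v ≤ g + h)
      weaken v v∈ with only v v∈
      ... | inj₁ q = inj₁ q
      ... | inj₂ (lo<v , v≤h) = inj₂ (ℕₚ.<-trans (ℕₚ.m≤n⇒m≤1+n (ℕₚ.n<1+n _)) lo<v , ℕₚ.≤-trans v≤h (ℕₚ.m≤n+m h g))
      only′ : ∀ v → v ∈ (range h g ++ F) ++ dbl (suc s) ∷ acc → v ∈ lowItems i ⊎ (dbl s < v × v ≤ g + h)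
      only′ v v∈ with ∈-++⁻ (range h g ++ F) v∈
      ... | inj₂ (here refl) = inj₂ (ℕₚ.m≤n⇒m≤1+n (ℕₚ.n<1+n _) , ℕₚ.≤-trans i<h (ℕₚ.m≤n+m h g))
      ... | inj₂ (there p) = weaken v (∈-++⁺ʳ F p)
      ... | inj₁ p with ∈-++⁻ (range h g) p
      ...   | inj₂ q = weaken v (∈-++⁺ˡ q)
      ...   | inj₁ q with h<v , v≤ ← ∈-range⁻ h g v q =
        inj₂ (ℕₚ.<-trans (ℕₚ.<-≤-trans (ℕₚ.m≤n⇒m≤1+n (ℕₚ.n<1+n _)) i<h) h<v , v≤)
      old : ∀ v → v ∈ F ++ acc → v ∈ (range h g ++ F) ++ dbl (suc s) ∷ acc
      old v v∈ with ∈-++⁻ F v∈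
      ... | inj₁ p = ∈-++⁺ˡ (∈-++⁺ʳ (range h g) p)
      ... | inj₂ p = ∈-++⁺ʳ (range h g ++ F) (there p)
      lows′ : ∀ v → v ∈ lowItems i → v ∈ (range h g ++ F) ++ dbl (suc s) ∷ acc
      lows′ v v∈ = old v (lows v v∈)
      full′ : ∀ v → dbl s < v → v ≤ g + h → v ∈ (range h g ++ F) ++ dbl (suc s) ∷ acc
      full′ v lo<v v≤ with ℕₚ.m≤n⇒m<n∨m≡n lo<v
      ... | inj₂ refl = lows′ _ (∈-low⁺ i s (ℕₚ.<⇒≤ s<i))
      ... | inj₁ lo<v₁ with ℕₚ.m≤n⇒m<n∨m≡n lo<v₁
      ...   | inj₂ refl = ∈-++⁺ʳ (range h g ++ F) (here refl)
      ...   | inj₁ lo<v₂ with v ≤? h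
      ...     | yes v≤h = old v (full v lo<v₂ v≤h)
      ...     | no v≰h = ∈-++⁺ˡ (∈-++⁺ˡ (∈-range⁺ h g v (ℕₚ.≰⇒> v≰h) v≤))

    interval₁ : ∀ {h F acc} g → mid ≤ h → Interval (dbl i) h (F ++ acc) →
      Interval (dbl i) (suc (g + h)) ((range h g ++ F) ++ suc (g + h) ∷ acc)
    interval₁ {h} {F} {acc} g mid≤h int = record { only = only′ ; lows = λ v v∈ → old v (lows v v∈) ; full = full′ }
      where
      open Interval int
      x = suc (g + h)
      weaken : ∀ v → v ∈ F ++ acc → v ∈ lowItems i ⊎ (dbl i < v × v ≤ x)
      weaken v v∈ with only v v∈
      ... | inj₁ q = inj₁ q
      ... | inj₂ (lo<v , v≤h) = inj₂ (lo<v , ℕₚ.≤-trans v≤h (ℕₚ.m≤n⇒m≤1+n (ℕₚ.m≤n+m h g)))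
      only′ : ∀ v → v ∈ (range h g ++ F) ++ x ∷ acc → v ∈ lowItems i ⊎ (dbl i < v × v ≤ x)
      only′ v v∈ with ∈-++⁻ (range h g ++ F) v∈
      ... | inj₂ (here refl) = inj₂ (ℕₚ.≤-trans mid≤h (ℕₚ.m≤n⇒m≤1+n (ℕₚ.m≤n+m h g)) , ℕₚ.≤-refl)
      ... | inj₂ (there p) = weaken v (∈-++⁺ʳ F p)
      ... | inj₁ p with ∈-++⁻ (range h g) p
      ...   | inj₂ q = weaken v (∈-++⁺ˡ q)
      ...   | inj₁ q with h<v , v≤ ← ∈-range⁻ h g v q = inj₂ (ℕₚ.≤-<-trans (ℕₚ.<⇒≤ mid≤h) h<v , ℕₚ.m≤n⇒m≤1+n v≤)
      old : ∀ v → v ∈ F ++ acc → v ∈ (range h g ++ F) ++ x ∷ acc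
      old v v∈ with ∈-++⁻ F v∈
      ... | inj₁ p = ∈-++⁺ˡ (∈-++⁺ʳ (range h g) p)
      ... | inj₂ p = ∈-++⁺ʳ (range h g ++ F) (there p)
      full′ : ∀ v → dbl i < v → v ≤ x → v ∈ (range h g ++ F) ++ x ∷ acc
      full′ v lo<v v≤ with v ≤? h
      ... | yes v≤h = old v (full v lo<v v≤h)
      ... | no v≰h with ℕₚ.m≤n⇒m<n∨m≡n v≤
      ...   | inj₂ refl = ∈-++⁺ʳ (range h g ++ F) (here refl)
      ...   | inj₁ (s≤s v≤′) = ∈-++⁺ˡ (∈-++⁺ˡ (∈-range⁺ h g v (ℕₚ.≰⇒> v≰h) v≤′))

    module HeadGood {B : Fin n} (B≡ : toℕ B ≡ dbl i) {e : List ℕ} (e< : ∀ v → v ∈ e → v < dbl i)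
      (e⊇ : ∀ v → v ∈ lowItems i → v ≤ dbl i → v ∈ e) where

      tail-head : ∀ gs s h F acc → s ≤ i → mid ≤ h → Interval (dbl s) h (F ++ acc) →
        Tail (intervals e) B (Up.headChain (levels₂ h F gs) (evens s) acc [])
      tail-head [] s h F acc s≤i mid≤h int = tt
      tail-head (g ∷ gs) zero h F acc s≤i mid≤h int = tt
      tail-head (g ∷ gs) (suc s) h F acc s≤i mid≤h int =
        βᴺ⇒β B (subst (βᴺ e _) (sym B≡) (Head.β-head (ℕₚ.<⇒≤ s≤i) mid≤h′ int′
          (λ v v∈ v≤ → e⊇ v v∈ (ℕₚ.≤-trans v≤ (dbl-mono (ℕₚ.<⇒≤ s≤i)))))) ,
        tail-head gs s (g + h) (range h g ++ F) (dbl (suc s) ∷ acc) (ℕₚ.<⇒≤ s≤i) mid≤h′ int′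
        where
        int′ = interval₂ {s} {h} {F} {acc} g mid≤h int s≤i
        mid≤h′ = ℕₚ.≤-trans mid≤h (ℕₚ.m≤n+m h g)

      zip-head : ∀ m gs s h F acc lacc → s ≤ i → mid ≤ h → Interval (dbl s) h (F ++ acc) → length gs < m → m ≡ s →
        (∀ v → v ∈ lacc → dbl s < v × v < dbl i) →
        Zip B (Up.headChain (replicate m []) (odds s ++ mid ∷ []) lacc []) (Up.headChain (levels₂ h F gs) (evens s) acc [])
      zip-head (suc m) [] (suc s) h F acc lacc s≤i mid≤h int len eq lacc-in = tt
      zip-head (suc m) (g ∷ gs) (suc s) h F acc lacc s≤i mid≤h int (s≤s len) refl lacc-in =
        δᴺ⇒δ B (subst (δᴺ (suc (dbl s) ∷ lacc) _) (sym B≡) (Head.δ-head (ℕₚ.<⇒≤ s≤i) mid≤h′ int′ lacc-in′)) ,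
        zip-head m gs s (g + h) (range h g ++ F) (dbl (suc s) ∷ acc) (suc (dbl s) ∷ lacc) (ℕₚ.<⇒≤ s≤i) mid≤h′ int′ len refl
          lacc-in′
        where
        int′ = interval₂ {s} {h} {F} {acc} g mid≤h int s≤i
        mid≤h′ = ℕₚ.≤-trans mid≤h (ℕₚ.m≤n+m h g)
        lacc-in′ : ∀ v → v ∈ suc (dbl s) ∷ lacc → dbl s < v × v < dbl i
        lacc-in′ v (here refl) = ℕₚ.n<1+n _ , dbl-mono s≤i
        lacc-in′ v (there p) with lo<v , v<i ← lacc-in v p = ℕₚ.<-trans (ℕₚ.m≤n⇒m≤1+n (ℕₚ.n<1+n _)) lo<v , v<i

      good-head : ∀ gs gs₂ h F acc → length gs₂ < i → mid ≤ h → Interval (dbl i) h (F ++ acc) →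
        Good (intervals e) B (Up.headChain (replicate i []) (odds i ++ mid ∷ []) [] []) (length gs)
          (Up.headChain (levels₁ h F gs gs₂) (singles h gs ++ evens i) acc [])
      good-head [] gs₂ h F acc len mid≤h int =
        tail-head gs₂ i h F acc ℕₚ.≤-refl mid≤h int ,
        zip-head i gs₂ i h F acc [] ℕₚ.≤-refl mid≤h int len refl (λ v ())
      good-head (g ∷ gs) gs₂ h F acc len mid≤h int =
        βᴺ⇒β B (subst (βᴺ e _) (sym B≡) (Head.β-head ℕₚ.≤-refl mid≤h′ int′ e⊇)) ,
        αᴺ⇒α (α-head mid≤h′ int′ e< e⊇) ,
        good-head gs gs₂ (suc (g + h)) (range h g ++ F) (suc (g + h) ∷ acc) len mid≤h′ int′
        where
        int′ = interval₁ {h} {F} {acc} g mid≤h int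
        mid≤h′ = ℕₚ.≤-trans mid≤h (ℕₚ.m≤n⇒m≤1+n (ℕₚ.m≤n+m h g))

    -- Low flags without their continuation, indexed by the final edge list e, because the
    -- conditions on upper members refer to the last low member `intervals e`.
    data LowPath : ℕ → List ℕ → List ℕ → Chain {k} → List ℕ → Set where
      end : ∀ {A acc} → LowPath 0 A acc [] acc
      step : ∀ {m A acc p c e} → p ∈ picks A → LowPath m (rest p) (item p ∷ acc) c e →
        LowPath (suc m) A acc (just (level [] (item p) acc) ∷ c) e

    data LowDev : ℕ → List ℕ → List ℕ → Chain {k} → List ℕ → Set where
      here : ∀ {m x A acc p c e} → p ∈ picks A → LowPath m (x ∷ rest p) (item p ∷ acc) c e →
        LowDev (suc m) (x ∷ A) acc (just (level [] (item p) acc) ∷ c) e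
      there : ∀ {m x A acc c e} → LowDev m A (x ∷ acc) c e → LowDev (suc m) (x ∷ A) acc (just (level [] x acc) ∷ c) e

    LowPath-⊆ : ∀ {m A acc c e} → LowPath m A acc c e → ∀ v → v ∈ acc → v ∈ e
    LowPath-⊆ end v v∈ = v∈
    LowPath-⊆ (step _ lp) v v∈ = LowPath-⊆ lp v (there v∈)

    -- The upper part being the head flag, pairs are absorbed from right to left. A pair created too
    -- early occurs in a low member whose counterpart above has not absorbed it, against δ; the edge
    -- `mid` is excluded because it is the omitted one.
    low-kill : ∀ {B} m gs s h F acc lacc lowc e → dbl i ≤ toℕ B → s ≤ i → mid ≤ h → mid < n → Interval (dbl s) h (F ++ acc) →
      suc (length gs) ≡ m → m ≡ s → mid ∉ e → LowDev m (odds s ++ mid ∷ []) lacc lowc e →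
      Zip B lowc (Up.headChain (levels₂ h F gs) (evens s) acc []) → ⊥
    low-kill {B} (suc m) gs (suc s) h F acc lacc _ e i≤B s≤i mid≤h mid<n int len refl mid∉ (here {p = p} p∈ lp) zip
      with ∈-++⁻ (odds s) (picks-∈ (odds s ++ mid ∷ []) p p∈)
    ... | inj₂ (here eq) = mid∉ (subst (_∈ e) eq (LowPath-⊆ lp (item p) (here refl)))
    ... | inj₁ od with t , t<s , eq ← ∈-odds⁻ s (item p) od = kill gs len zip
      where
      kill : ∀ gs → suc (length gs) ≡ suc s →
        Zip B (just (level [] (item p) lacc) ∷ _) (Up.headChain (levels₂ h F gs) (evens (suc s)) acc []) → ⊥
      -- There is one attaching level fewer than low ranks. At the last low rank s is 0, and `mid`
      -- would be the only alternative to the head item.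
      kill [] refl = ⊥-elim (ℕₚ.n≮0 t<s)
      kill (g ∷ gs) _ (de , _) = gap {E} (dbl s) (Head.lo∉ (ℕₚ.<⇒≤ s≤i) mid≤h′ int′) a<lo
            (ℕₚ.≤-trans (dbl-mono (ℕₚ.<⇒≤ s≤i)) i≤B)
            (δ⇒δᴺ {B = B} de (suc (dbl t)) (dbl t) a<n (ℕₚ.<-trans (ℕₚ.n<1+n _) a<n)
              (start-∈ {item p ∷ lacc} (here (sym eq))) (λ q → ℕₚ.<-irrefl (sym q) (ℕₚ.n<1+n _)))
        where
        E = (range h g ++ F) ++ dbl (suc s) ∷ acc
        int′ = interval₂ {s} {h} {F} {acc} g mid≤h int s≤i
        mid≤h′ = ℕₚ.≤-trans mid≤h (ℕₚ.m≤n+m h g)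
        a<lo : suc (dbl t) < dbl s
        a<lo = dbl-mono t<s
        a<n : suc (dbl t) < n
        a<n = ℕₚ.<-trans a<lo (ℕₚ.≤-<-trans (dbl-mono (ℕₚ.<⇒≤ s≤i)) (ℕₚ.<-trans (ℕₚ.n<1+n _) mid<n))
    low-kill (suc m) [] (suc s) h F acc lacc _ e i≤B s≤i mid≤h mid<n int refl refl mid∉ (there dv) zip = dead dv
      where
      dead : ∀ {A lacc c} → ¬ LowDev zero A lacc c e
      dead ()
    low-kill (suc m) (g ∷ gs) (suc s) h F acc lacc _ e i≤B s≤i mid≤h mid<n int len refl mid∉ (there dv) (_ , zip) =
      low-kill m gs s (g + h) (range h g ++ F) (dbl (suc s) ∷ acc) (suc (dbl s) ∷ lacc) _ e i≤B (ℕₚ.<⇒≤ s≤i)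
        (ℕₚ.≤-trans mid≤h (ℕₚ.m≤n+m h g)) mid<n (interval₂ {s} {h} {F} {acc} g mid≤h int s≤i)
        (ℕₚ.suc-injective len) refl mid∉ dv zip

open HeadFlag

-- Ranks of flags, transport under relabelling, splitting of flags.

module FlagRanks where

  open import Data.Nat using (_+_)

  Unique-↭ : ∀ {xs ys : List ℕ} → xs ↭ ys → Unique xs → Unique ys
  Unique-↭ p = ↭ₛ.Unique-resp-↭ (setoid ℕ) (↭⇒↭ₛ p)

  Unique-suffix : ∀ (xs : List ℕ) {ys} → Unique (xs ++ ys) → Unique ys
  Unique-suffix [] u = u
  Unique-suffix (x ∷ xs) (_ ∷ u) = Unique-suffix xs u

  picks-acc : ∀ {A p} acc → p ∈ picks A → A ++ acc ↭ rest p ++ item p ∷ acc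
  picks-acc {A} {p} acc p∈ = ↭-trans (++⁺ʳ acc (picks-↭ A p p∈)) (↭-sym (↭-shift (item p) (rest p) acc))

  odds-unique : ∀ i → Unique (odds i)
  odds-unique zero = []
  odds-unique (suc i) = All.tabulate (λ {v} v∈ eq → case v v∈ eq) ∷ odds-unique i
    where
    case : ∀ v → v ∈ odds i → ¬ suc (dbl i) ≡ v
    case v v∈ eq with t , t<i , refl ← ∈-odds⁻ i v v∈ =
      ℕₚ.<-irrefl (sym eq) (s≤s (ℕₚ.<-trans (ℕₚ.n<1+n _) (dbl-mono t<i)))

  evens-unique : ∀ i → Unique (evens i)
  evens-unique zero = []
  evens-unique (suc i) = All.tabulate (λ {v} v∈ eq → case v v∈ eq) ∷ evens-unique i
    where
    case : ∀ v → v ∈ evens i → ¬ dbl (suc i) ≡ v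
    case v v∈ eq with t , t<i , refl ← ∈-evens⁻ i v v∈ =
      ℕₚ.<-irrefl (sym eq) (s≤s (s≤s (ℕₚ.<-trans (ℕₚ.n<1+n _) (dbl-mono t<i))))

  range-unique : ∀ h g → Unique (range h g)
  range-unique h zero = []
  range-unique h (suc g) =
    All.tabulate (λ {v} v∈ eq → ℕₚ.<-irrefl (sym eq) (s≤s (proj₂ (∈-range⁻ h g v v∈)))) ∷ range-unique h g

  singles-unique : ∀ h gs → Unique (singles h gs)
  singles-unique h [] = []
  singles-unique h (g ∷ gs) =
    All.tabulate (λ {v} v∈ eq → ℕₚ.<-irrefl eq (∈-singles⁻ (suc (g + h)) gs v v∈)) ∷ singles-unique (suc (g + h)) gs

  low-unique : ∀ i → Unique (lowItems i)
  low-unique i = Unique-++⁺ (odds-unique i) ([] ∷ []) λ { {v} (p , here eq) → clash v p eq }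
    where
    clash : ∀ v → v ∈ odds i → ¬ v ≡ suc (dbl i)
    clash v v∈ eq with t , t<i , refl ← ∈-odds⁻ i v v∈ =
      ℕₚ.<-irrefl eq (s≤s (ℕₚ.<-trans (ℕₚ.n<1+n _) (dbl-mono t<i)))

  length-odds : ∀ i → length (odds i) ≡ i
  length-odds zero = refl
  length-odds (suc i) = cong suc (length-odds i)

  length-evens : ∀ i → length (evens i) ≡ i
  length-evens zero = refl
  length-evens (suc i) = cong suc (length-evens i)

  length-range : ∀ h g → length (range h g) ≡ g
  length-range h zero = refl
  length-range h (suc g) = cong suc (length-range h g)

  length-singles : ∀ h gs → length (singles h gs) ≡ length gs
  length-singles h [] = refl
  length-singles h (g ∷ gs) = cong suc (length-singles (suc (g + h)) gs)

  length-low : ∀ i → length (lowItems i) ≡ suc i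
  length-low i = trans (length-++ (odds i)) (trans (cong (_+ 1) (length-odds i)) (ℕₚ.+-comm i 1))

  length-levels₂ : ∀ h F gs → length (levels₂ h F gs) ≡ length gs
  length-levels₂ h F [] = refl
  length-levels₂ h F (g ∷ gs) = cong suc (length-levels₂ (g + h) (range h g ++ F) gs)

  length-levels₁ : ∀ h F gs gs₂ → length (levels₁ h F gs gs₂) ≡ length gs + length gs₂
  length-levels₁ h F [] gs₂ = length-levels₂ h F gs₂
  length-levels₁ h F (g ∷ gs) gs₂ = cong suc (length-levels₁ (suc (g + h)) (range h g ++ F) gs gs₂)

  partials : ℕ → List ℕ → List ℕ
  partials r [] = []
  partials r (g ∷ gs) = suc (g + r) ∷ partials (suc (g + r)) gs

  lastP : ℕ → List ℕ → ℕ
  lastP r [] = r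
  lastP r (g ∷ gs) = lastP (suc (g + r)) gs

  iota : ℕ → ℕ → List ℕ
  iota r zero = []
  iota r (suc m) = suc r ∷ iota (suc r) m

  hiEnd₂ : ℕ → List ℕ → ℕ
  hiEnd₂ h [] = h
  hiEnd₂ h (g ∷ gs) = hiEnd₂ (g + h) gs

  hiEnd₁ : ℕ → List ℕ → List ℕ → ℕ
  hiEnd₁ h [] gs₂ = hiEnd₂ h gs₂
  hiEnd₁ h (g ∷ gs) gs₂ = hiEnd₁ (suc (g + h)) gs gs₂

  ≤hiEnd₂ : ∀ h gs → h ≤ hiEnd₂ h gs
  ≤hiEnd₂ h [] = ℕₚ.≤-refl
  ≤hiEnd₂ h (g ∷ gs) = ℕₚ.≤-trans (ℕₚ.m≤n+m h g) (≤hiEnd₂ (g + h) gs)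

  ≤hiEnd₁ : ∀ h gs gs₂ → h ≤ hiEnd₁ h gs gs₂
  ≤hiEnd₁ h [] gs₂ = ≤hiEnd₂ h gs₂
  ≤hiEnd₁ h (g ∷ gs) gs₂ = ℕₚ.≤-trans (ℕₚ.m≤n⇒m≤1+n (ℕₚ.m≤n+m h g)) (≤hiEnd₁ (suc (g + h)) gs gs₂)

  singles≤ : ∀ h gs gs₂ v → v ∈ singles h gs → v ≤ hiEnd₁ h gs gs₂
  singles≤ h (g ∷ gs) gs₂ v (here refl) = ≤hiEnd₁ (suc (g + h)) gs gs₂
  singles≤ h (g ∷ gs) gs₂ v (there p) = singles≤ (suc (g + h)) gs gs₂ v p

  -- Of the edges up to h, the current member lacks the even edges not yet attached: one for each
  -- remaining level and one that is always left over. This is the surplus of h over the rank r.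
  hiEnd₂-last : ∀ r h gs → h ≡ r + suc (length gs) → hiEnd₂ h gs ≡ suc (lastP r gs)
  hiEnd₂-last r h [] eq = trans eq (ℕₚ.+-comm r 1)
  hiEnd₂-last r h (g ∷ gs) eq = hiEnd₂-last (suc (g + r)) (g + h) gs
    (trans (cong (g +_) (trans eq (ℕₚ.+-suc r (suc (length gs)))))
      (trans (ℕₚ.+-suc g _) (cong suc (sym (ℕₚ.+-assoc g r (suc (length gs)))))))

  hiEnd₁-last : ∀ r h gs gs₂ → h ≡ r + suc (length gs₂) → hiEnd₁ h gs gs₂ ≡ suc (lastP r (gs ++ gs₂))
  hiEnd₁-last r h [] gs₂ eq = hiEnd₂-last r h gs₂ eq
  hiEnd₁-last r h (g ∷ gs) gs₂ eq = hiEnd₁-last (suc (g + r)) (suc (g + h)) gs gs₂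
    (cong suc (trans (cong (g +_) eq) (sym (ℕₚ.+-assoc g r (suc (length gs₂))))))

  module _ {k : ℕ} where

    private
      n : ℕ
      n = suc k

    asc-partials : ∀ gs r r′ → r ≤ r′ → lastP r′ gs < k → Asc {k} r (partials r′ gs)
    asc-partials [] r r′ r≤ lt = [] (ℕₚ.≤-<-trans r≤ lt)
    asc-partials (g ∷ gs) r r′ r≤ lt =
      s≤s (ℕₚ.≤-trans r≤ (ℕₚ.m≤n+m r′ g)) ∷ asc-partials gs (suc (g + r′)) (suc (g + r′)) ℕₚ.≤-refl lt

    asc-iota : ∀ r m T → Asc {k} (m + r) T → Asc {k} r (iota r m ++ T)
    asc-iota r zero T asc = asc
    asc-iota r (suc m) T asc = ℕₚ.n<1+n r ∷ asc-iota (suc r) m T (subst (λ q → Asc {k} q T) (sym (ℕₚ.+-suc m r)) asc)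

    -- Here a counts the items already picked, so the next member has `length F + suc a` edges. As F
    -- avoids the set U of all items, none of them is counted twice.
    data Levels (U : List ℕ) (Q : List ℕ → Set) : List ℕ → ℕ → List (List ℕ) → List ℕ → Set where
      [] : ∀ {F a} → Q F → Levels U Q F a [] []
      cons : ∀ {F₀ a F Fs s S} → (∀ v → v ∈ F₀ → v ∈ F) → Unique F → (∀ v → v ∈ F → v ∉ U × 0 < v × v < n) →
        length F + suc a ≡ s → Levels U Q F (suc a) Fs S → Levels U Q F₀ a (F ∷ Fs) (s ∷ S)

    module _ (K : Functional {k}) {U : List ℕ} {Q : List ℕ → Set} (uU : Unique U) (U-ok : ∀ v → v ∈ U → 0 < v × v < n) (S′ : List ℕ)
      (K-valid : ∀ F acc e c → Q F → (∀ v → v ∈ acc → v ∈ U) → (∀ v → v ∈ e → v ∈ F ++ acc) → Functional.Supp K c →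
        Valid (intervals e) S′ c × absent c ≡ 0) where

      open Alternating K

      flag-valid : ∀ {F₀ Fs S A acc e c} → Levels U Q F₀ (length acc) Fs S → A ++ acc ↭ U → (∀ v → v ∈ e → v ∈ F₀ ++ acc) →
        Flag Fs A acc c → Valid (intervals e) (S ++ S′) c × absent c ≡ 0
      flag-valid {F₀} {A = A} {acc} {e} {c} ([] q) perm e⊆ (stop s) =
        K-valid F₀ acc e c q (λ v v∈ → ∈-resp-↭ perm (∈-++⁺ʳ A v∈)) e⊆ s
      flag-valid {F₀} {A = A} {acc} {e} (cons {F = F} F₀⊆ uF F-ok len lv) perm e⊆ (go {p = p} p∈ f) =
        pick (intervals-isCode E) (intervals-mono e⊆E) (trans (intervals-rk E uE E<n 0∉E) (trans (length-++ F) len)) (proj₁ later) ,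
        proj₂ later
        where
        E = F ++ item p ∷ acc
        perm′ : rest p ++ item p ∷ acc ↭ U
        perm′ = ↭-trans (↭-sym (picks-acc acc p∈)) perm
        acc⊆U : ∀ v → v ∈ item p ∷ acc → v ∈ U
        acc⊆U v v∈ = ∈-resp-↭ perm′ (∈-++⁺ʳ (rest p) v∈)
        uE : Unique E
        uE = Unique-++⁺ uF (Unique-suffix (rest p) (Unique-↭ (↭-sym perm′) uU))
          (λ { {v} (v∈F , v∈acc) → proj₁ (F-ok v v∈F) (acc⊆U v v∈acc) })
        E-ok : ∀ v → v ∈ E → 0 < v × v < n
        E-ok v v∈ with ∈-++⁻ F v∈
        ... | inj₁ q = proj₂ (F-ok v q)
        ... | inj₂ q = U-ok v (acc⊆U v q)
        E<n : All (_< n) E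
        E<n = All.tabulate (λ {v} v∈ → proj₂ (E-ok v v∈))
        0∉E : 0 ∉ E
        0∉E 0∈ = ℕₚ.n≮0 (proj₁ (E-ok 0 0∈))
        e⊆E : ∀ v → v ∈ e → v ∈ E
        e⊆E v v∈ with ∈-++⁻ F₀ (e⊆ v v∈)
        ... | inj₁ q = ∈-++⁺ˡ (F₀⊆ v q)
        ... | inj₂ q = ∈-++⁺ʳ F (there q)
        later = flag-valid {e = E} lv perm′ (λ _ v∈ → v∈) f

    low-levels : ∀ i m a → Levels (lowItems i) (_≡ []) [] a (replicate m []) (iota a m)
    low-levels i zero a = [] refl
    low-levels i (suc m) a = cons (λ _ v∈ → v∈) [] (λ v ()) refl (low-levels i m (suc a))

    row : ∀ {h F} g → Unique F → (∀ v → v ∈ F → 0 < v × v ≤ h) →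
      Unique (range h g ++ F) × (∀ v → v ∈ range h g ++ F → 0 < v × v ≤ g + h)
    row {h} {F} g uF F-ok =
      Unique-++⁺ (range-unique h g) uF (λ { {v} (p , q) → ℕₚ.<⇒≱ (proj₁ (∈-range⁻ h g v p)) (proj₂ (F-ok v q)) }) , ok
      where
      ok : ∀ v → v ∈ range h g ++ F → 0 < v × v ≤ g + h
      ok v v∈ with ∈-++⁻ (range h g) v∈
      ... | inj₁ p with h<v , v≤ ← ∈-range⁻ h g v p = ℕₚ.≤-<-trans z≤n h<v , v≤
      ... | inj₂ p with 0<v , v≤ ← F-ok v p = 0<v , ℕₚ.≤-trans v≤ (ℕₚ.m≤n+m h g)

    row-length : ∀ {h F a r} g → length F + a ≡ r → length (range h g ++ F) + suc a ≡ suc (g + r)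
    row-length {h} {F} {a} g eq = trans (ℕₚ.+-suc _ a) (cong suc (trans (cong (_+ a) (trans (length-++ (range h g))
      (cong (_+ length F) (length-range h g)))) (trans (ℕₚ.+-assoc g (length F) a) (cong (g +_) eq))))

    up-levels₂ : ∀ {U} gs h F a r → length F + a ≡ r → Unique F → (∀ v → v ∈ F → 0 < v × v ≤ h) → (∀ v → v ∈ F → v ∉ U) →
      (∀ u → u ∈ U → u ≤ h) → hiEnd₂ h gs < n → Levels U (λ _ → ⊤) F a (levels₂ h F gs) (partials r gs)
    up-levels₂ [] h F a r len uF F-ok F∌ U≤ <n = [] tt
    up-levels₂ {U} (g ∷ gs) h F a r len uF F-ok F∌ U≤ <n with uF′ , F-ok′ ← row {h} {F} g uF F-ok =
      cons (λ v v∈ → ∈-++⁺ʳ (range h g) v∈) uF′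
        (λ v v∈ → F∌′ v v∈ , proj₁ (F-ok′ v v∈) , ℕₚ.≤-<-trans (ℕₚ.≤-trans (proj₂ (F-ok′ v v∈)) (≤hiEnd₂ (g + h) gs)) <n)
        (row-length {h} {F} g len)
        (up-levels₂ gs (g + h) (range h g ++ F) (suc a) (suc (g + r)) (row-length {h} {F} g len) uF′ F-ok′ F∌′
          (λ u u∈ → ℕₚ.≤-trans (U≤ u u∈) (ℕₚ.m≤n+m h g)) <n)
      where
      F∌′ : ∀ v → v ∈ range h g ++ F → v ∉ U
      F∌′ v v∈ with ∈-++⁻ (range h g) v∈
      ... | inj₁ p = λ v∈U → ℕₚ.<⇒≱ (proj₁ (∈-range⁻ h g v p)) (U≤ v v∈U)
      ... | inj₂ p = F∌ v p

    up-levels₁ : ∀ {U} gs₂ gs h F a r → length F + a ≡ r → Unique F → (∀ v → v ∈ F → 0 < v × v ≤ h) → (∀ v → v ∈ F → v ∉ U) →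
      (∀ u → u ∈ U → u ≤ h ⊎ u ∈ singles h gs) → hiEnd₁ h gs gs₂ < n →
      Levels U (λ _ → ⊤) F a (levels₁ h F gs gs₂) (partials r (gs ++ gs₂))
    up-levels₁ {U} gs₂ [] h F a r len uF F-ok F∌ U-ok <n = up-levels₂ gs₂ h F a r len uF F-ok F∌ U≤ <n
      where
      U≤ : ∀ u → u ∈ U → u ≤ h
      U≤ u u∈ with inj₁ p ← U-ok u u∈ = p
    up-levels₁ {U} gs₂ (g ∷ gs) h F a r len uF F-ok F∌ U-ok <n with uF′ , F-ok′ ← row {h} {F} g uF F-ok =
      cons (λ v v∈ → ∈-++⁺ʳ (range h g) v∈) uF′
        (λ v v∈ → F∌′ v v∈ , proj₁ (F-ok′ v v∈) ,
          ℕₚ.≤-<-trans (ℕₚ.≤-trans (ℕₚ.m≤n⇒m≤1+n (proj₂ (F-ok′ v v∈))) (≤hiEnd₁ x gs gs₂)) <n)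
        (row-length {h} {F} g len)
        (up-levels₁ gs₂ gs x (range h g ++ F) (suc a) (suc (g + r)) (row-length {h} {F} g len) uF′
          (λ v v∈ → proj₁ (F-ok′ v v∈) , ℕₚ.m≤n⇒m≤1+n (proj₂ (F-ok′ v v∈))) F∌′ U-ok′ <n)
      where
      x = suc (g + h)
      h<x : h < x
      h<x = s≤s (ℕₚ.m≤n+m h g)
      F∌′ : ∀ v → v ∈ range h g ++ F → v ∉ U
      F∌′ v v∈ with ∈-++⁻ (range h g) v∈
      ... | inj₂ p = F∌ v p
      ... | inj₁ p with h<v , v≤ ← ∈-range⁻ h g v p = λ v∈U → absurd (U-ok v v∈U)
        where
        absurd : ¬ (v ≤ h ⊎ v ∈ singles h (g ∷ gs))
        absurd (inj₁ q) = ℕₚ.<⇒≱ h<v q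
        absurd (inj₂ (here eq)) = ℕₚ.<-irrefl eq (s≤s v≤)
        absurd (inj₂ (there q)) = ℕₚ.<⇒≱ (ℕₚ.<-trans (s≤s v≤) (∈-singles⁻ x gs v q)) ℕₚ.≤-refl
      U-ok′ : ∀ u → u ∈ U → u ≤ x ⊎ u ∈ singles x gs
      U-ok′ u u∈ with U-ok u u∈
      ... | inj₁ q = inj₁ (ℕₚ.≤-trans q (ℕₚ.<⇒≤ h<x))
      ... | inj₂ (here refl) = inj₁ ℕₚ.≤-refl
      ... | inj₂ (there q) = inj₂ q

    lastOf : Code n → Chain {k} → Code n
    lastOf x [] = x
    lastOf x (nothing ∷ c) = lastOf x c
    lastOf x (just z ∷ c) = lastOf z c

    lastOf-act : ∀ σ x c → act σ (lastOf x c) ≡ lastOf (act σ x) (actC σ c)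
    lastOf-act σ x [] = refl
    lastOf-act σ x (nothing ∷ c) = lastOf-act σ x c
    lastOf-act σ x (just z ∷ c) = lastOf-act σ z c

    -- The three conditions speak only of points being equal or lying in a common block, so they can
    -- be carried back along σ, with B becoming σ B.
    module Transport {σ : Fin n → Fin n} (pσ : Perm σ) where

      private
        τ : Fin n → Fin n
        τ = inverse pσ

        pulled : ∀ z V W → lookup z V ≡ lookup z W → lookup (act σ z) (τ V) ≡ lookup (act σ z) (τ W)
        pulled z V W e = act-related σ z (τ V) (τ W)
          (trans (cong (lookup z) (inverseʳ pσ V)) (trans e (cong (lookup z) (sym (inverseʳ pσ W)))))

        pushed : ∀ z V W → lookup (act σ z) (τ V) ≡ lookup (act σ z) W → lookup z V ≡ lookup z (σ W)
        pushed z V W e = trans (cong (lookup z) (sym (inverseʳ pσ V))) (related-act σ z (τ V) W e)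

        pushed² : ∀ z V W → lookup (act σ z) (τ V) ≡ lookup (act σ z) (τ W) → lookup z V ≡ lookup z W
        pushed² z V W e = trans (pushed z V (τ W) e) (cong (lookup z) (inverseʳ pσ W))

        τ≢ : ∀ {V W} → ¬ V ≡ W → ¬ τ V ≡ τ W
        τ≢ {V} {W} ne e = ne (trans (sym (inverseʳ pσ V)) (trans (cong σ e) (inverseʳ pσ W)))

      β-act : ∀ X Y B → β (act σ X) (act σ Y) B → β X Y (σ B)
      β-act X Y B be V W e with be (τ V) (τ W) (pulled Y V W e)
      ... | inj₁ q = inj₁ (pushed² X V W q)
      ... | inj₂ q = inj₂ (pushed Y V B q)

      α-act : ∀ X Y → α (act σ X) (act σ Y) → α X Y
      α-act X Y al V W U e ne e′ = pushed² X V U (al (τ V) (τ W) (τ U) (pulled X V W e) (τ≢ ne) (pulled Y V U e′))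

      δ-act : ∀ x Y B → δ (act σ x) (act σ Y) B → δ x Y (σ B)
      δ-act x Y B de V W e ne = pushed Y V B (de (τ V) (τ W) (pulled x V W e) (τ≢ ne))

      zip-act : ∀ B low c → Zip B (actC σ low) (actC σ c) → Zip (σ B) low c
      zip-act B [] c z = tt
      zip-act B (nothing ∷ low) c z = tt
      zip-act B (just x ∷ low) [] z = tt
      zip-act B (just x ∷ low) (nothing ∷ c) z = tt
      zip-act B (just x ∷ low) (just Y ∷ c) (de , z) = δ-act x Y B de , zip-act B low c z

      tail-act : ∀ X B c → Tail (act σ X) B (actC σ c) → Tail X (σ B) c
      tail-act X B [] t = tt
      tail-act X B (nothing ∷ c) t = tt
      tail-act X B (just Y ∷ c) (be , t) = β-act X Y B be , tail-act X B c t

      good-act : ∀ X B low p c → Good (act σ X) B (actC σ low) p (actC σ c) → Good X (σ B) low p c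
      good-act X B low zero c (t , z) = tail-act X B c t , zip-act B low c z
      good-act X B low (suc p) [] g = tt
      good-act X B low (suc p) (nothing ∷ c) g = tt
      good-act X B low (suc p) (just Y ∷ c) (be , al , g) = β-act X Y B be , α-act X Y al , good-act X B low p c g

    module _ (i : ℕ) where

      LowPath-perm : ∀ {m A acc c e} → LowPath {k} i m A acc c e →
        ∃ λ A′ → A ++ acc ↭ A′ ++ e × m + length A′ ≡ length A
      LowPath-perm {A = A} end = A , ↭-refl , refl
      LowPath-perm {A = A} {acc} (step {p = p} p∈ lp) with A′ , perm , len ← LowPath-perm lp =
        A′ , ↭-trans (picks-acc acc p∈) perm , trans (cong suc len) (sym (picks-length A p p∈))

      LowPath-last : ∀ {m A acc c e} → LowPath {k} i m A acc c e → lastOf (intervals acc) c ≡ intervals e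
      LowPath-last end = refl
      LowPath-last (step _ lp) = LowPath-last lp

      LowPath-length : ∀ {m A acc c e} → LowPath {k} i m A acc c e → length c ≡ m
      LowPath-length end = refl
      LowPath-length (step _ lp) = cong suc (LowPath-length lp)

      -- Picking i times from i + 1 distinct items leaves exactly one item over.
      lowSet : ∀ {c e} → LowPath {k} i i (lowItems i) [] c e → LowSet {k} i e
      lowSet {c} {e} lp with LowPath-perm lp
      ... | [] , perm , len = ⊥-elim (ℕₚ.<-irrefl (trans (sym (ℕₚ.+-identityʳ i)) (trans len (length-low i))) (ℕₚ.n<1+n i))
      ... | r ∷ r′ ∷ A′ , perm , len = ⊥-elim (ℕₚ.<-irrefl (sym (trans (sym (trans (ℕₚ.+-suc i _) (cong suc (ℕₚ.+-suc i (length A′)))))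
          (trans len (length-low i)))) (s≤s (s≤s (ℕₚ.m≤m+n i (length A′)))))
      ... | r ∷ [] , perm , len = record
        { sub = λ v v∈ → ∈-resp-↭ (↭-sym perm′) (there v∈)
        ; omitted = r
        ; omitted∈ = ∈-resp-↭ (↭-sym perm′) (here refl)
        ; omitted∉ = λ r∈ → All.lookup (AllPairs.head (Unique-↭ perm′ (low-unique i))) r∈ refl
        ; cover = λ v v∈ → covered (∈-resp-↭ perm′ v∈) }
        where
        perm′ : lowItems i ↭ r ∷ e
        perm′ = ↭-trans (↭-reflexive (sym (++-identityʳ (lowItems i)))) perm
        covered : ∀ {v} → v ∈ r ∷ e → v ≡ r ⊎ v ∈ e
        covered (here eq) = inj₁ eq
        covered (there p) = inj₂ p

      LowDev-path : ∀ {m A acc c e} → LowDev {k} i m A acc c e → LowPath {k} i m A acc c e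
      LowDev-path (here {A = A} {p = p} p∈ lp) = step (there (∈-map⁺ (behind _) p∈)) lp
      LowDev-path (there dv) = step (here refl) (LowDev-path dv)

      module LowSplit (K : Functional {k}) where

        open Alternating K

        flag-split : ∀ m {A acc c} → Flag (replicate m []) A acc c →
          ∃ λ low → ∃ λ up → ∃ λ e → c ≡ low ++ up × LowPath {k} i m A acc low e × Functional.Supp K up
        flag-split zero (stop s) = [] , _ , _ , refl , end , s
        flag-split (suc m) (go p∈ f) with low , up , e , refl , lp , s ← flag-split m f =
          _ , up , e , refl , step p∈ lp , s

        dev-split : ∀ {D e₀} m {A acc c} → Deviation.Dev D e₀ (replicate m []) A acc c →
          ∃ λ low → ∃ λ up → ∃ λ e → c ≡ low ++ up ×
            ((LowPath {k} i m A acc low e × D up) ⊎ (LowDev {k} i m A acc low e × Functional.Supp K up))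
        dev-split zero (Deviation.stop s) = [] , _ , _ , refl , inj₁ (end , s)
        dev-split (suc m) (Deviation.here p∈ f) with low , up , e , refl , lp , s ← flag-split m f =
          _ , up , e , refl , inj₂ (here p∈ lp , s)
        dev-split (suc m) (Deviation.there dv) with dev-split m dv
        ... | low , up , e , refl , inj₁ (lp , s) = _ , up , e , refl , inj₁ (step (here refl) lp , s)
        ... | low , up , e , refl , inj₂ (ld , s) = _ , up , e , refl , inj₂ (there ld , s)

        head-++ : ∀ m A acc e₀ → headChain (replicate m []) A acc e₀ ≡ Up.headChain (replicate m []) A acc [] ++ e₀
        head-++ zero A acc e₀ = refl
        head-++ (suc m) [] acc e₀ = refl
        head-++ (suc m) (x ∷ A) acc e₀ = cong (_ ∷_) (head-++ m A (x ∷ acc) e₀)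

open FlagRanks

-- The cycle and its value on an orbit.

module NonzeroCycle where

  open import Data.Nat using (_+_)

  ++-split : ∀ {A : Set} (xs ys : List A) {us vs} → length xs ≡ length ys → xs ++ us ≡ ys ++ vs → xs ≡ ys × us ≡ vs
  ++-split [] [] _ e = refl , e
  ++-split (x ∷ xs) (y ∷ ys) len e with refl , q ← ++-split xs ys (ℕₚ.suc-injective len) (Listₚ.∷-injectiveʳ e) =
    cong (_∷ xs) (Listₚ.∷-injectiveˡ e) , q

  ∑-pos : ∀ {A : Set} (xs : List A) {f} x → x ∈ xs → (∀ y → 0ℤ ℤ.≤ f y) → 0ℤ ℤ.< f x → 0ℤ ℤ.< ∑ xs f
  ∑-pos (y ∷ xs) x (here refl) nn fx = ℤₚ.+-mono-<-≤ fx (∑-nonneg xs nn)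
  ∑-pos (y ∷ xs) x (there x∈) nn fx = ℤₚ.+-mono-≤-< (nn y) (∑-pos xs x x∈ nn fx)

  ⟦⟧-nonneg : ∀ b → 0ℤ ℤ.≤ ⟦ b ⟧
  ⟦⟧-nonneg true = ℤ.+≤+ z≤n
  ⟦⟧-nonneg false = ℤ.+≤+ z≤n

  dbl-+ : ∀ t → dbl t ≡ t + t
  dbl-+ zero = refl
  dbl-+ (suc t) = cong suc (trans (cong suc (dbl-+ t)) (sym (ℕₚ.+-suc t t)))

  module _ {k : ℕ} where

    private
      n : ℕ
      n = suc k

    act-id : ∀ {z : Code n} → IsCode z → act id z ≡ z
    act-id iz = code-rel iz

    actC-id : ∀ {x S c} → Valid {k} x S c → actC id c ≡ c
    actC-id [] = refl
    actC-id (omit v) = cong (nothing ∷_) (actC-id v)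
    actC-id (pick iz _ _ v) = cong₂ (λ z c → just z ∷ c) (act-id iz) (actC-id v)

    -- All terms are 0 or 1, and the identity, listed in `Sym` up to pointwise equality, contributes
    -- 1.
    orbit-sum : ∀ S (asc : Asc {k} (rk (bot {k})) S) c → Valid bot S c →
      ¬ Projection.sumG S asc (λ c′ → ⟦ ⌊ c′ ≟ᶜʰ c ⌋ ⟧) c ≡ 0ℤ
    orbit-sum S asc c v eq with anyNonzero (Sym n) (λ σ → ⟦ ⌊ tabulate σ ≟ᶜ tabulate id ⌋ ⟧)
    ... | inj₂ all0 with () ← trans (sym (Sym-once {n} id (λ e → e))) (∑-zero∈ (Sym n) all0)
    orbit-sum S asc c v eq | inj₁ (σ , σ∈ , ne) with tabulate σ ≟ᶜ tabulate id
    ...   | no _ = ⊥-elim (ne refl)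
    ...   | yes σ≡id = ℤₚ.<-irrefl (sym eq) (∑-pos (Sym n) σ σ∈ (λ ρ → ⟦⟧-nonneg _)
            (subst (0ℤ ℤ.<_) (sym (cong ⟦_⟧ (yes-true (actC σ c ≟ᶜʰ c)
              (trans (actC-ext {σ = σ} {ρ = id} (tabulate-ext σ≡id) c) (actC-id v))))) (ℤ.+<+ (s≤s z≤n))))

    head-low : ∀ i m s acc → ∃ λ e →
      LowPath {k} i s (odds s ++ m ∷ []) acc (Up.headChain (replicate s []) (odds s ++ m ∷ []) acc []) e ×
      (∀ v → v ∈ e → v ∈ odds s ⊎ v ∈ acc)
    head-low i m zero acc = acc , end , λ v v∈ → inj₂ v∈
    head-low i m (suc s) acc with e , lp , e-in ← head-low i m s (suc (dbl s) ∷ acc) = e , step (here refl) lp , λ v v∈ → widen (e-in v v∈)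
      where
      widen : ∀ {v} → v ∈ odds s ⊎ v ∈ suc (dbl s) ∷ acc → v ∈ odds (suc s) ⊎ v ∈ acc
      widen (inj₁ p) = inj₁ (there p)
      widen (inj₂ (here eq)) = inj₁ (here eq)
      widen (inj₂ (there p)) = inj₂ p

    good-zip : ∀ i {X : Code n} {B : Fin n} {low : Chain {k}} gs₂ gs h F acc → suc (dbl i) ≤ h → Interval {k} i (dbl i) h (F ++ acc) →
      Good X B low (length gs) (Up.headChain (levels₁ h F gs gs₂) (singles h gs ++ evens i) acc []) →
      ∃ λ h → ∃ λ F → ∃ λ acc → suc (dbl i) ≤ h × Interval {k} i (dbl i) h (F ++ acc) ×
        Zip B low (Up.headChain (levels₂ h F gs₂) (evens i) acc [])
    good-zip i gs₂ [] h F acc mid≤h int (_ , z) = h , F , acc , mid≤h , int , z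
    good-zip i gs₂ (g ∷ gs) h F acc mid≤h int (_ , _ , good) =
      good-zip i gs₂ gs (suc (g + h)) (range h g ++ F) (suc (g + h) ∷ acc)
        (ℕₚ.≤-trans mid≤h (ℕₚ.m≤n⇒m≤1+n (ℕₚ.m≤n+m h g))) (interval₁ {k} i {h} {F} {acc} g mid≤h int) good

  -- The gaps of the lengthening levels are g ∷ gs₁, those of the i - 1 attaching levels gs₂. That
  -- the first list is nonempty encodes i ≤ l; that the upper ranks are counted from i + 1 encodes
  -- j₁ - i > 1.
  module Construction (k i′ g : ℕ) (gs₁ gs₂ : List ℕ) (len₂ : length gs₂ ≡ i′)
    (last<k : lastP (suc (suc i′)) ((g ∷ gs₁) ++ gs₂) < k) where

    n i mid : ℕ
    n = suc k
    i = suc i′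
    mid = suc (dbl i)

    ups : List ℕ
    ups = singles mid (g ∷ gs₁) ++ evens i

    Fs : List (List ℕ)
    Fs = levels₁ mid [] (g ∷ gs₁) gs₂

    S : List ℕ
    S = iota 0 i ++ partials (suc i) ((g ∷ gs₁) ++ gs₂)

    end<n : hiEnd₁ mid (g ∷ gs₁) gs₂ < n
    end<n = subst (_< n) (sym (hiEnd₁-last (suc i) mid (g ∷ gs₁) gs₂
      (cong suc (trans (dbl-+ i) (cong (λ q → i + suc q) (sym len₂)))))) (s≤s last<k)

    mid<n : mid < n
    mid<n = ℕₚ.≤-<-trans (≤hiEnd₁ mid (g ∷ gs₁) gs₂) end<n

    singles<n : ∀ v → v ∈ singles mid (g ∷ gs₁) → v < n
    singles<n v v∈ = ℕₚ.≤-<-trans (singles≤ mid (g ∷ gs₁) gs₂ v v∈) end<n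

    lenUp : length ups ≡ suc (length Fs)
    lenUp = trans (length-++ (singles mid (g ∷ gs₁))) (trans
      (cong₂ _+_ (length-singles mid (g ∷ gs₁)) (length-evens i))
      (trans (ℕₚ.+-suc (suc (length gs₁)) i′)
        (cong suc (sym (trans (length-levels₁ mid [] (g ∷ gs₁) gs₂) (cong (suc (length gs₁) +_) len₂))))))

    bare : List (List ℕ)
    bare = replicate i []

    lenLow : length (lowItems i) ≡ suc (length bare)
    lenLow = trans (length-low i) (cong suc (sym (length-replicate i)))

    -- The upper sum starts from all i + 1 low edges, whichever of them the low flag left out.
    -- Therefore it can be the common continuation of all low flags.
    UpF : Functional {k}
    UpF = Up.functional Fs ups (lowItems i) lenUp

    module Low = Alternating UpF

    ZF : Functional {k}
    ZF = Low.functional bare (lowItems i) [] lenLow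

    asc : Asc {k} (rk (bot {k})) S
    asc = subst (λ r → Asc {k} r S) (sym (bot-rk {k})) (asc-iota 0 i _
      (asc-partials ((g ∷ gs₁) ++ gs₂) (i + 0) (suc i) (ℕₚ.m≤n⇒m≤1+n (ℕₚ.≤-reflexive (ℕₚ.+-identityʳ i))) last<k))

    low-ok : ∀ v → v ∈ lowItems i → 0 < v × v < n
    low-ok v v∈ = low-pos {k} i v v∈ , ℕₚ.≤-<-trans (low≤ {k} i v v∈) mid<n

    up-item : ∀ v → v ∈ ups → (mid < v × v ∈ singles mid (g ∷ gs₁)) ⊎ v ∈ evens i
    up-item v v∈ with ∈-++⁻ (singles mid (g ∷ gs₁)) v∈
    ... | inj₁ p = inj₁ (∈-singles⁻ mid (g ∷ gs₁) v p , p)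
    ... | inj₂ p = inj₂ p

    even-ok : ∀ v → v ∈ evens i → 0 < v × v ≤ mid × v ∉ lowItems i
    even-ok v v∈ with t , t<i , refl ← ∈-evens⁻ i v v∈ =
      s≤s z≤n , ℕₚ.≤-trans (dbl-mono t<i) (ℕₚ.n≤1+n _) , low-even∉ {k} i (suc t)

    items-unique : Unique (ups ++ lowItems i)
    items-unique = Unique-++⁺
      (Unique-++⁺ (singles-unique mid (g ∷ gs₁)) (evens-unique i)
        (λ { {v} (p , q) → ℕₚ.<⇒≱ (∈-singles⁻ mid (g ∷ gs₁) v p) (proj₁ (proj₂ (even-ok v q))) }))
      (low-unique i) (λ { {v} (p , q) → disjoint v q (up-item v p) })
      where
      disjoint : ∀ v → v ∈ lowItems i → ¬ ((mid < v × v ∈ singles mid (g ∷ gs₁)) ⊎ v ∈ evens i)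
      disjoint v q (inj₁ (mid<v , _)) = ℕₚ.<⇒≱ mid<v (low≤ {k} i v q)
      disjoint v q (inj₂ p) = proj₂ (proj₂ (even-ok v p)) q

    items-place : ∀ u → u ∈ ups ++ lowItems i → u ≤ mid ⊎ u ∈ singles mid (g ∷ gs₁)
    items-place u u∈ with ∈-++⁻ ups u∈
    ... | inj₂ p = inj₁ (low≤ {k} i u p)
    ... | inj₁ p with up-item u p
    ...   | inj₁ (_ , q) = inj₂ q
    ...   | inj₂ q = inj₁ (proj₁ (proj₂ (even-ok u q)))

    items-ok : ∀ u → u ∈ ups ++ lowItems i → 0 < u × u < n
    items-ok u u∈ with ∈-++⁻ ups u∈
    ... | inj₂ p = low-ok u p
    ... | inj₁ p with up-item u p
    ...   | inj₁ (mid<u , q) = ℕₚ.≤-<-trans z≤n mid<u , singles<n u q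
    ...   | inj₂ q = proj₁ (even-ok u q) , ℕₚ.≤-<-trans (proj₁ (proj₂ (even-ok u q))) mid<n

    up-valid : ∀ e c → (∀ v → v ∈ e → v ∈ lowItems i) → Functional.Supp UpF c →
      Valid (intervals e) (partials (suc i) ((g ∷ gs₁) ++ gs₂)) c × absent c ≡ 0
    up-valid e c e⊆ f with v , full ← flag-valid (atEmpty {k}) {U = ups ++ lowItems i} {Q = λ _ → ⊤} items-unique items-ok []
        (λ { _ _ _ _ _ _ _ refl → [] , refl }) {e = e}
        (up-levels₁ gs₂ (g ∷ gs₁) mid [] (length (lowItems i)) (suc i) (length-low i) [] (λ v ()) (λ v ()) items-place end<n)
        ↭-refl e⊆ f = subst (λ T → Valid (intervals e) T c) (++-identityʳ _) v , full

    Z-valid : ∀ c → Functional.Supp ZF c → Valid bot S c × absent c ≡ 0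
    Z-valid c f with v , full ← flag-valid UpF {U = lowItems i} {Q = _≡ []} (low-unique i) low-ok
        (partials (suc i) ((g ∷ gs₁) ++ gs₂))
        (λ { F acc e c refl acc⊆ e⊆ s → up-valid e c (λ v v∈ → acc⊆ v (e⊆ v v∈)) s }) {e = []}
        (low-levels i i 0) (↭-reflexive (++-identityʳ (lowItems i))) (λ v ()) f = Valid-weaken (⊑-bot _) v , full

    open Projection S asc

    cycle : Cycle (Functional.value ZF)
    cycle = record
      { vanish-full = λ φ0 → Functional.vanish ZF (λ c s → φ0 c (proj₁ (Z-valid c s)) (proj₂ (Z-valid c s)))
      ; minus = Functional.minus ZF
      ; boundary = Functional.boundary ZF }

    up₀ low₀ c₀ : Chain {k}
    up₀ = Up.headChain Fs ups (lowItems i) []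
    low₀ = Up.headChain (replicate i []) (lowItems i) [] []
    c₀ = low₀ ++ up₀

    e₀ : List ℕ
    e₀ = proj₁ (head-low {k} i mid i [])

    path₀ : LowPath {k} i i (lowItems i) [] low₀ e₀
    path₀ = proj₁ (proj₂ (head-low {k} i mid i []))

    e₀-odd : ∀ v → v ∈ e₀ → v ∈ odds i
    e₀-odd v v∈ with inj₁ p ← proj₂ (proj₂ (head-low {k} i mid i [])) v v∈ = p

    e₀< : ∀ v → v ∈ e₀ → v < dbl i
    e₀< v v∈ with t , t<i , refl ← ∈-odds⁻ i v (e₀-odd v v∈) = dbl-mono t<i

    e₀⊇ : ∀ v → v ∈ lowItems i → v ≤ dbl i → v ∈ e₀
    e₀⊇ v v∈ v≤ with LowSet.cover (lowSet i path₀) v v∈ | LowSet.cover (lowSet i path₀) mid (∈-low⁺ i i ℕₚ.≤-refl)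
    ... | inj₂ p | _ = p
    ... | inj₁ _ | inj₂ q = ⊥-elim (ℕₚ.<⇒≱ (e₀< mid q) (ℕₚ.n≤1+n _))
    ... | inj₁ p | inj₁ q = ⊥-elim (ℕₚ.<⇒≱ (ℕₚ.n<1+n (dbl i)) (subst (_≤ dbl i) (trans p (sym q)) v≤))

    i<n : dbl i < n
    i<n = ℕₚ.<-trans (ℕₚ.n<1+n _) mid<n

    -- The left point of the pair of `mid`, which lies in the big block of every upper member of the
    -- head flag.
    B₀ : Fin n
    B₀ = fromℕ< i<n

    interval₀ : Interval {k} i (dbl i) mid ([] ++ lowItems i)
    interval₀ = record
      { only = λ v v∈ → inj₁ v∈ ; lows = λ v v∈ → v∈
      ; full = λ v lo hi → subst (_∈ lowItems i) (ℕₚ.≤-antisym lo hi) (∈-low⁺ i i ℕₚ.≤-refl) }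

    good₀ : Good (intervals e₀) B₀ low₀ (suc (length gs₁)) up₀
    good₀ = HeadGood.good-head {k} i {B₀} (toℕ-fromℕ< i<n) e₀< e₀⊇ (g ∷ gs₁) gs₂ mid [] (lowItems i)
      (subst (_< i) (sym len₂) (ℕₚ.n<1+n i′)) ℕₚ.≤-refl interval₀

    D : Chain {k} → Set
    D = UpDev.Dev Fs ups (lowItems i)

    module LowDeviation = Low.Deviation D up₀

    head-kill : ∀ B low e → LowDev {k} i i (lowItems i) [] low e → Good (intervals e) B low (suc (length gs₁)) up₀ → ⊥
    head-kill B low e ld good
      with mid∉ , i≤B ← good-first {k} i {e} {B} {low} g _ (lowSet i (LowDev-path i ld)) (singles<n _ (here refl)) good
      with h , F , acc , mid≤h , int , zip ← good-zip {k} i {intervals e} {B} {low} gs₂ (g ∷ gs₁) mid [] (lowItems i)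
                                               ℕₚ.≤-refl interval₀ good =
      low-kill {k} i {B} i gs₂ i h F acc [] low e i≤B ℕₚ.≤-refl mid≤h mid<n int (cong suc len₂) refl mid∉ ld zip

    good-kill : ∀ B low up e →
      (LowPath {k} i i (lowItems i) [] low e × D up) ⊎ (LowDev {k} i i (lowItems i) [] low e × Functional.Supp UpF up) →
      Good (intervals e) B low (suc (length gs₁)) up → ⊥
    good-kill B low up e (inj₁ (lp , dv)) good = up-kill i g gs₁ gs₂ up (lowSet i lp) singles<n dv good
    good-kill B low up e (inj₂ (ld , f)) good = [
      (λ dv → up-kill i g gs₁ gs₂ up (lowSet i (LowDev-path i ld)) singles<n dv good) ,
      (λ up≡ → head-kill B low e ld (subst (Good (intervals e) B low (suc (length gs₁))) up≡ good)) ]′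
      (UpDev.Flag-split (λ c s → inj₂ s) Fs ups (lowItems i) up lenUp f)

    -- If σ carried c to the head flag, the invariants of the head flag would hold for c with the
    -- point σ B₀, which `good-kill` rules out.
    dev-kill : ∀ c → LowDeviation.Dev bare (lowItems i) [] c → ∀ σ → Perm σ → actC σ c ≡ c₀ → ⊥
    dev-kill c dv σ pσ eq with low , up , e , refl , paths ← LowSplit.dev-split i UpF i dv = good-kill (σ B₀) low up e paths
      (Transport.good-act pσ (intervals e) B₀ low (suc (length gs₁)) up
        (subst₂ (λ l u → Good (act σ (intervals e)) B₀ l (suc (length gs₁)) u) (sym low≡) (sym up≡)
          (subst (λ X → Good X B₀ low₀ (suc (length gs₁)) up₀) (sym X≡) good₀)))
      where
      path : LowPath {k} i i (lowItems i) [] low e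
      path = [ proj₁ , LowDev-path i ∘ proj₁ ]′ paths
      split : actC σ low ≡ low₀ × actC σ up ≡ up₀
      split = ++-split (actC σ low) low₀
        (trans (length-map _ low) (trans (LowPath-length i path) (sym (LowPath-length i path₀))))
        (trans (sym (map-++ (Maybe.map (act σ)) low up)) eq)
      low≡ = proj₁ split
      up≡ = proj₂ split
      X≡ : act σ (intervals e) ≡ intervals e₀
      X≡ = trans (cong (act σ) (sym (LowPath-last i path))) (trans (lastOf-act σ (intervals []) low)
        (trans (cong (lastOf (act σ (intervals []))) low≡) (LowPath-last i path₀)))

    φ₀ : Cochain {k}
    φ₀ c = ⟦ ⌊ c ≟ᶜʰ c₀ ⌋ ⟧

    -- By `dev-kill` the symmetrized indicator vanishes at all deviating flags, and the head flag
    -- occurs with sign + 1.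
    Z-c₀ : Functional.value ZF (sumG φ₀) ≡ sumG φ₀ c₀
    Z-c₀ = trans (LowDeviation.alt-head
        (λ {φ} φ0 → UpDev.alt-head (λ _ → refl) Fs ups (lowItems i) φ lenUp φ0)
        bare (lowItems i) [] (sumG φ₀) lenLow
        (λ c dv → ∑-zero∈ (Sym n) (λ σ σ∈ → cong ⟦_⟧ (no-false (actC σ c ≟ᶜʰ c₀) (dev-kill c dv σ (Sym-Perm σ σ∈))))))
      (cong (sumG φ₀) (LowSplit.head-++ i UpF i (lowItems i) [] up₀))

    c₀-valid : Valid bot S c₀
    c₀-valid = subst (Valid bot S) (LowSplit.head-++ i UpF i (lowItems i) [] up₀)
      (proj₁ (Z-valid _ (head-flag UpF {up₀} (head-flag (atEmpty {k}) refl Fs ups (lowItems i) lenUp) bare (lowItems i) [] lenLow)))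
      where
      head-flag : ∀ (K : Functional {k}) {e} → Functional.Supp K e → ∀ Gs A acc → length A ≡ suc (length Gs) →
        Alternating.Flag K Gs A acc (Alternating.headChain K Gs A acc e)
      head-flag K s [] (x ∷ A) acc len = Alternating.stop s
      head-flag K s (F ∷ Gs) (x ∷ A) acc len = Alternating.go (here refl) (head-flag K s Gs A (x ∷ acc) (ℕₚ.suc-injective len))

    multiplicity>0 : 0ℤ ℤ.< ∑ (Sym n) (λ σ → χβ σ S)
    multiplicity>0 = multiplicity-positive cycle φ₀ (λ eq → orbit-sum S asc c₀ c₀-valid (trans (sym Z-c₀) eq))

open NonzeroCycle

-- Rank sets described by their gaps.

module RankSets where

  open import Data.Nat using (_+_)

  iota-upTo : ∀ i → map suc (upTo i) ≡ iota 0 i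
  iota-upTo i = trans (map-applyUpTo id suc i) (go i 0 suc (λ x → cong suc (sym (ℕₚ.+-identityʳ x))))
    where
    go : ∀ m r f → (∀ x → f x ≡ suc (x + r)) → applyUpTo f m ≡ iota r m
    go zero r f eq = refl
    go (suc m) r f eq = cong₂ _∷_ (eq 0) (go m (suc r) (f ∘ suc) (λ x → trans (eq (suc x)) (cong suc (sym (ℕₚ.+-suc x r)))))

  -- It is applied with r = i + 1, where the first gap j₁ - i - 2 is a natural number because j₁ - i
  -- > 1.
  gaps : ∀ {r js} → Linked _<_ (r ∷ js) → ∃ λ gs → js ≡ partials r gs × length gs ≡ length js
  gaps [-] = [] , refl , refl
  gaps {r} (_∷_ {y = j} r<j lk) with gs , eq , len ← gaps lk =
    j ∸ suc r ∷ gs ,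
    cong₂ _∷_ (sym next≡j) (trans eq (cong (λ q → partials q gs) (sym next≡j))) ,
    cong suc len
    where
    next≡j : suc ((j ∸ suc r) + r) ≡ j
    next≡j = trans (sym (ℕₚ.+-suc (j ∸ suc r) r)) (ℕₚ.m∸n+n≡m r<j)

  split-gaps : ∀ m (gs : List ℕ) → suc m ≤ length gs → ∃ λ g → ∃ λ gs₁ → ∃ λ gs₂ → gs ≡ (g ∷ gs₁) ++ gs₂ × length gs₂ ≡ m
  split-gaps m (g ∷ gs) (s≤s m≤) with ℕₚ.m≤n⇒m<n∨m≡n m≤
  ... | inj₂ eq = g , [] , gs , refl , sym eq
  ... | inj₁ m< with g′ , gs₁ , gs₂ , refl , len ← split-gaps m gs m< = g , g′ ∷ gs₁ , gs₂ , refl , len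

  lastP-≤ : ∀ r g gs m → All (_≤ m) (partials r (g ∷ gs)) → lastP r (g ∷ gs) ≤ m
  lastP-≤ r g [] m (p ∷ []) = p
  lastP-≤ r g (g′ ∷ gs) m (p ∷ ps) = lastP-≤ (suc (g + r)) g′ gs m ps

  /-positive : ∀ p q .{{_ : NonZero q}} → 0ℤ ℤ.< p → 0ℚ <ℚ p / q
  /-positive ℤ.+[1+ m ] q _ = ℚₚ.positive⁻¹ (ℤ.+[1+ m ] / q) {{ℚₚ.normalize-pos (suc m) q}}
  /-positive ℤ.+0 q (ℤ.+<+ ())

open RankSets

theorem2p2 : (n i : ℕ) (js : List ℕ) →
    3 ≤ n → 1 ≤ i →
    Linked _<_ (suc i ∷ js) →
    All (λ j → j ≤ n ∸ 2) js →
    i ≤ length js →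
    0ℚ <ℚ b (map suc (upTo i) ++ js) n
theorem2p2 (suc (suc k)) (suc i′) js (s≤s (s≤s 1≤k)) (s≤s _) lk all i≤l
  with gs , refl , len ← gaps lk
  -- The last i - 1 gaps go to the attaching levels; i ≤ l guarantees that a lengthening level
  -- remains.
  with g , gs₁ , gs₂ , refl , len₂ ← split-gaps i′ gs (subst (suc i′ ≤_) (sym len) i≤l) =
  subst (λ S → 0ℚ <ℚ b (S ++ partials (suc (suc i′)) ((g ∷ gs₁) ++ gs₂)) (suc (suc k))) (sym (iota-upTo (suc i′)))
    (/-positive _ (suc (suc k) !) {{suc (suc k) !≢0}}
      (subst (0ℤ ℤ.<_) (sym (∑-foldr (Sym (suc (suc k))) _))
        (Construction.multiplicity>0 (suc k) i′ g gs₁ gs₂ len₂ (s≤s (lastP-≤ _ g (gs₁ ++ gs₂) k all)))))
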